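{- Let $k\ge 1$ be an integer and let $G$ be a finite simple $2$-connected non-bipartite graph which is not $3$-connected. If the minimum degree of $G$ is at least $k+1$, then $G$ contains $\lceil k/2\rceil$ cycles with consecutive odd lengths, i.e. there is an odd integer $\ell$ such that $G$ contains, for each $i\in\{0,1,\dots,\lceil k/2\rceil-1\}$, a cycle of length $\ell+2i$.
   Context: All graphs are finite, simple and undirected. The length of a cycle is its number of edges. -}

module Defs where

open import Data.Nat using (ℕ; zero; suc; _+_; _*_; _∸_; _≤_; _<_; ⌈_/2⌉)
open import Data.Bool using (Bool; true; false; if_then_else_)
open import Data.Fin using (Fin; toℕ)
open import Data.Fin.Subset using (Subset; _∉_; ∣_∣)
open import Data.List using (map; allFin)
open import Data.Nat.ListAction using (sum)
open import Data.Product using (Σ; ∃; _×_; _,_)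
open import Relation.Nullary using (¬_)
open import Relation.Binary.PropositionalEquality using (_≡_; _≢_)
open import Function.Definitions using (Injective)

record Graph (n : ℕ) : Set where
  field
    adj     : Fin n → Fin n → Bool
    symm    : ∀ u v → adj u v ≡ adj v u
    irrefl  : ∀ v → adj v v ≡ false
open Graph public

module _ {n : ℕ} (G : Graph n) where

  degree : Fin n → ℕ
  degree v = sum (map (λ u → if adj G v u then 1 else 0) (allFin n))

  MinDegreeAtLeast : ℕ → Set
  MinDegreeAtLeast d = ∀ v → d ≤ degree v

  -- walks in G − X from u to v (all vertices after the first avoid X)
  data WalkAvoiding (X : Subset n) : Fin n → Fin n → Set where
    stop : ∀ {u} → WalkAvoiding X u u
    step : ∀ {u w v} → adj G u w ≡ true → w ∉ X → WalkAvoiding X w v → WalkAvoiding X u v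

  ConnectedAfterRemoving : Subset n → Set
  ConnectedAfterRemoving X = ∀ u v → u ∉ X → v ∉ X → WalkAvoiding X u v

  KConnected : ℕ → Set
  KConnected k = (k < n) × (∀ (X : Subset n) → ∣ X ∣ < k → ConnectedAfterRemoving X)

  Bipartite : Set
  Bipartite = Σ (Fin n → Bool) λ c → ∀ u v → adj G u v ≡ true → c u ≢ c v

  HasCycleOfLength : ℕ → Set
  HasCycleOfLength L =
    (3 ≤ L) × Σ (Fin L → Fin n) λ c →
      Injective _≡_ _≡_ c
      × (∀ (i j : Fin L) → suc (toℕ i) ≡ toℕ j → adj G (c i) (c j) ≡ true)
      × (∀ (i j : Fin L) → suc (toℕ i) ≡ L → toℕ j ≡ 0 → adj G (c i) (c j) ≡ true)

Odd : ℕ → Set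
Odd ℓ = ∃ λ m → ℓ ≡ suc (2 * m)

{-# OPTIONS --safe #-}
module Submission where

-- Let {x , y} be a 2-cut.  The heart of the proof is a statement about one side W of it:
-- if every vertex of W has degree at least e + 2, then the lengths of the x–y paths through W
-- contain e + 1 consecutive integers or a progression of difference 2 spanning at least e.
-- This is proved by induction on W.  Take a complete bipartite "core" with x in its part A,
-- locally maximal; x reaches every vertex of the other part T by paths of lengths
-- 1, 3, …, 2 ∣A∣ − 1, and a vertex outside the core sends at most 2 ∣A∣ − 1 edges to it.
-- Hence contracting the core costs exactly as many degrees as the core paths give back, and
-- the lengths of the two stages add up.  Pieces that see the core only in A, cut vertices and
-- 2-cuts of W are split off and treated by the same induction, and if y has no neighbour
-- outside the core the argument is repeated from y.
-- Both sides of the 2-cut thus carry ⌈ k /2⌉ paths whose lengths have a common parity and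
-- difference 2.  If the parities of the two sides do not combine to odd cycles, the
-- non-bipartiteness of G provides an x–y path of the other parity; its interior lies in a
-- single component of G − {x , y}, so it avoids one of the two sides.

open import Defs
open import Data.Nat using (ℕ; suc; _+_; _*_; _≤_; _<_; ⌈_/2⌉)
open import Data.Product using (Σ; _×_)
open import Relation.Nullary using (¬_)

open import Data.Nat using (zero; _∸_; z≤n; s≤s; s≤s⁻¹)
open import Data.Nat.Properties hiding (_≟_)
open import Data.Nat.ListAction using (sum)
open import Data.Nat.Solver using (module +-*-Solver)
open +-*-Solver using (solve; _:+_; _:*_; _:=_; con)
open import Algebra.Properties.CommutativeSemigroup +-commutativeSemigroup using () renaming (interchange to +-interchange)
open import Data.Bool using (Bool; true; false; if_then_else_; not; _xor_)
import Data.Bool.Properties as Bool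
open import Data.Fin using (Fin; zero; suc; toℕ)
open import Data.Fin.Properties using (any?; all?; _≟_)
open import Data.Fin.Subset using (Subset; ∣_∣) renaming (_∉_ to _∉ˢ_; ⁅_⁆ to ⁅_⁆ˢ)
open import Data.Fin.Subset.Properties using (x∈⁅x⁆; x∈⁅y⁆⇒x≡y; ∣⁅x⁆∣≡1)
open import Data.List using (tabulate)
open import Data.List.Properties using (map-tabulate)
open import Data.Vec using ([]; _∷_; lookup)
open import Data.Vec.Properties using (lookup⇒[]=; []=⇒lookup)
open import Data.Product using (∃; _,_; proj₁; proj₂)
open import Data.Sum using (_⊎_; inj₁; inj₂; [_,_]′)
open import Data.Empty using (⊥; ⊥-elim)
open import Data.Unit using (⊤; tt)
open import Relation.Nullary using (Dec; yes; no; does)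
open import Relation.Nullary.Decidable using (_×-dec_; _⊎-dec_; ¬?; map′; _→-dec_)
open import Relation.Binary.PropositionalEquality using (_≡_; _≢_; refl; sym; trans; cong; subst)

-- The degree bound counts the roots: a vertex of `W` earns one unit for each root it is adjacent
-- to. Replacing a root by a cut vertex, or contracting part of `W` into a root, therefore yields an
-- instance of the same shape, and only the number of lost units matters. A loss of `d` costs `d`
-- units of span, to be repaid by the choice of lengths in the part that was removed. The core pays
-- for itself; two losses escape it. Splitting at a cut vertex or a 2-cut costs one unit, repaid by
-- two lengths, differing by 1 or 2, on the far side. These need only degree 3, but a 2-cut leaves
-- behind a vertex with no bound at all, so that statement is a separate induction with one exempt
-- vertex. And a piece that sees the core in one vertex of `A` besides the root cannot pay for its
-- edge to the root, because such a core offers no choice; the piece then hangs on a 2-cut of `W`.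
-- In the cases left over neither root reaches beyond its core, and comparing the two cores shows
-- that both roots have the same neighbours in `W`; leaving one vertex of `A` out of the core then
-- makes room for a last contraction.

-- Indicators and finite sums

ι : ∀ {P : Set} → Dec P → ℕ
ι d = if does d then 1 else 0

ι-mono : ∀ {P Q : Set} (p : Dec P) (q : Dec Q) → (P → Q) → ι p ≤ ι q
ι-mono (no _)  q       f = z≤n
ι-mono (yes p) (yes _) f = ≤-refl
ι-mono (yes p) (no ¬q) f = ⊥-elim (¬q (f p))

ι-⊎ : ∀ {P Q R : Set} (p : Dec P) (q : Dec Q) (r : Dec R) → (P → Q ⊎ R) → ι p ≤ ι q + ι r
ι-⊎ (no _)  q       r       f = z≤n
ι-⊎ (yes p) (yes _) r       f = s≤s z≤n
ι-⊎ (yes p) (no ¬q) (yes _) f = ≤-refl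
ι-⊎ (yes p) (no ¬q) (no ¬r) f = ⊥-elim ([ ¬q , ¬r ]′ (f p))

ι≤1 : ∀ {P : Set} (p : Dec P) → ι p ≤ 1
ι≤1 (yes _) = ≤-refl
ι≤1 (no _)  = z≤n

ι-no : ∀ {P : Set} (p : Dec P) → ¬ P → ι p ≡ 0
ι-no (yes p) ¬p = ⊥-elim (¬p p)
ι-no (no _)  _  = refl

ι-yes : ∀ {P : Set} (p : Dec P) → P → ι p ≡ 1
ι-yes (yes _) _ = refl
ι-yes (no ¬p) p = ⊥-elim (¬p p)

cnt : ∀ {n} → (Fin n → ℕ) → ℕ
cnt {zero}  f = 0
cnt {suc n} f = f zero + cnt (λ i → f (suc i))

cnt-mono : ∀ {n} (f g : Fin n → ℕ) → (∀ i → f i ≤ g i) → cnt f ≤ cnt g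
cnt-mono {zero}  f g h = z≤n
cnt-mono {suc n} f g h = +-mono-≤ (h zero) (cnt-mono _ _ (λ i → h (suc i)))

cnt-mono-< : ∀ {n} (f g : Fin n → ℕ) → (∀ i → f i ≤ g i) → ∀ j → f j < g j → cnt f < cnt g
cnt-mono-< {suc n} f g h zero    l = +-mono-<-≤ l (cnt-mono _ _ (λ i → h (suc i)))
cnt-mono-< {suc n} f g h (suc j) l = +-mono-≤-< (h zero) (cnt-mono-< _ _ (λ i → h (suc i)) j l)

cnt-+ : ∀ {n} (f g : Fin n → ℕ) → cnt (λ i → f i + g i) ≡ cnt f + cnt g
cnt-+ {zero}  f g = refl
cnt-+ {suc n} f g rewrite cnt-+ (λ i → f (suc i)) (λ i → g (suc i)) =
  +-interchange (f zero) (g zero) (cnt (λ i → f (suc i))) (cnt (λ i → g (suc i)))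

cnt-0 : ∀ {n} (f : Fin n → ℕ) → (∀ i → f i ≡ 0) → cnt f ≡ 0
cnt-0 {zero}  f h = refl
cnt-0 {suc n} f h rewrite h zero = cnt-0 _ (λ i → h (suc i))

cnt-1 : ∀ {n} (f : Fin n → ℕ) (c : Fin n) → (∀ i → i ≢ c → f i ≡ 0) → cnt f ≡ f c
cnt-1 {suc n} f zero    h rewrite cnt-0 (λ i → f (suc i)) (λ i → h (suc i) (λ ())) = +-identityʳ (f zero)
cnt-1 {suc n} f (suc c) h rewrite h zero (λ ()) =
  cnt-1 (λ i → f (suc i)) c (λ i ne → h (suc i) (λ { refl → ne refl }))

cnt-pos : ∀ {n} (f : Fin n → ℕ) → 1 ≤ cnt f → ∃ λ i → 1 ≤ f i
cnt-pos {suc n} f h with f zero in eq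
... | suc a = zero , subst (1 ≤_) (sym eq) (s≤s z≤n)
... | zero  with cnt-pos (λ i → f (suc i)) h
...   | i , l = suc i , l

-- Progressions of lengths and their sumsets

-- The index is normalised so that spans of sums of lengths add up (Span-+).
data Span (L : ℕ → Set) (e : ℕ) : Set where
  run : ∀ ℓ → (∀ i → i ≤ e → L (ℓ + i)) → Span L e
  alt : ∀ ℓ m → e ≤ m + m → (∀ i → i ≤ m → L (ℓ + (i + i))) → Span L e

Span-≤ : ∀ {L e f} → f ≤ e → Span L e → Span L f
Span-≤ l (run ℓ h)         = run ℓ (λ i i≤ → h i (≤-trans i≤ l))
Span-≤ l (alt ℓ m b h) = alt ℓ m (≤-trans l b) h

Span-map : ∀ {L L′ : ℕ → Set} {e} c → (∀ ℓ → L ℓ → L′ (c + ℓ)) → Span L e → Span L′ e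
Span-map {L′ = L′} c f (run ℓ h) = run (c + ℓ) (λ i l → subst L′ (sym (+-assoc c ℓ i)) (f _ (h i l)))
Span-map {L′ = L′} c f (alt ℓ m b h) =
  alt (c + ℓ) m b (λ i l → subst L′ (sym (+-assoc c ℓ (i + i))) (f _ (h i l)))

split≤ : ∀ a b i → i ≤ a + b → ∃ λ x → ∃ λ y → x ≤ a × y ≤ b × x + y ≡ i
split≤ zero    b i       l       = 0 , i , z≤n , l , refl
split≤ (suc a) b zero    l       = 0 , 0 , z≤n , z≤n , refl
split≤ (suc a) b (suc i) (s≤s l) with split≤ a b i l
... | x , y , lx , ly , eq = suc x , y , s≤s lx , ly , cong suc eq

split2 : ∀ a m i → i ≤ suc a + (m + m) → ∃ λ x → ∃ λ y → x ≤ suc a × y ≤ m × x + (y + y) ≡ i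
split2 a zero    i l = i , 0 , subst (i ≤_) (+-identityʳ (suc a)) l , z≤n , +-identityʳ i
split2 a (suc m) zero l = 0 , 0 , z≤n , z≤n , refl
split2 a (suc m) (suc zero) l = 1 , 0 , s≤s z≤n , z≤n , refl
split2 a (suc m) (suc (suc i)) l
  with split2 a m i (s≤s⁻¹ (s≤s⁻¹ (subst (suc (suc i) ≤_) eq l)))
  where
  eq : suc a + (suc m + suc m) ≡ suc (suc (suc a + (m + m)))
  eq = trans (cong (λ z → suc a + suc z) (+-suc m m)) (trans (+-suc (suc a) _) (cong suc (+-suc (suc a) _)))
... | x , y , lx , ly , e = x , suc y , lx , s≤s ly ,
      trans (cong (λ z → x + suc z) (+-suc y y)) (trans (+-suc x _) (cong suc (trans (+-suc x _) (cong suc e))))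

-- A run of at least two lengths fills the gaps of an alternating progression, so the sum is a run;
-- a run of one length merely shifts it. Two alternating progressions add up to an alternating one.
Span-+ : ∀ {L₁ L₂ L : ℕ → Set} {d e} → (∀ a b → L₁ a → L₂ b → L (a + b)) →
         Span L₁ d → Span L₂ e → Span L (d + e)
Span-+ {L = L} {d} {e} f (run ℓ h) (run ℓ′ h′) = run (ℓ + ℓ′) go
  where
  go : ∀ i → i ≤ d + e → L ((ℓ + ℓ′) + i)
  go i l with split≤ d e i l
  ... | x , y , lx , ly , refl = subst L (+-interchange ℓ x ℓ′ y) (f _ _ (h x lx) (h′ y ly))
Span-+ {L = L} {zero} {e} f (run ℓ h) (alt ℓ′ m b h′) =
  alt (ℓ + ℓ′) m b (λ i l → subst L (+-interchange ℓ 0 ℓ′ (i + i)) (f _ _ (h 0 z≤n) (h′ i l)))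
Span-+ {L = L} {suc d} {e} f (run ℓ h) (alt ℓ′ m b h′) = run (ℓ + ℓ′) go
  where
  go : ∀ i → i ≤ suc d + e → L ((ℓ + ℓ′) + i)
  go i l with split2 d m i (≤-trans l (+-monoʳ-≤ (suc d) b))
  ... | x , y , lx , ly , refl = subst L (+-interchange ℓ x ℓ′ (y + y)) (f _ _ (h x lx) (h′ y ly))
Span-+ {L = L} {d} {zero} f (alt ℓ′ m b h′) (run ℓ h) =
  alt (ℓ′ + ℓ) m (subst (_≤ m + m) (sym (+-identityʳ d)) b) (λ i l →
    subst L (trans (+-interchange ℓ′ (i + i) ℓ 0) (cong ((ℓ′ + ℓ) +_) (+-identityʳ _))) (f _ _ (h′ i l) (h 0 z≤n)))
Span-+ {L = L} {d} {suc e} f (alt ℓ′ m b h′) (run ℓ h) = run (ℓ′ + ℓ) go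
  where
  go : ∀ i → i ≤ d + suc e → L ((ℓ′ + ℓ) + i)
  go i l with split2 e m i (≤-trans (subst (i ≤_) (+-comm d (suc e)) l) (+-monoʳ-≤ (suc e) b))
  ... | x , y , lx , ly , refl =
    subst L (trans (+-interchange ℓ′ (y + y) ℓ x) (cong ((ℓ′ + ℓ) +_) (+-comm (y + y) x))) (f _ _ (h′ y ly) (h x lx))
Span-+ {L = L} {d} {e} f (alt ℓ m b h) (alt ℓ′ m′ b′ h′) =
  alt (ℓ + ℓ′) (m + m′) (≤-trans (+-mono-≤ b b′) (≤-reflexive (+-interchange m m m′ m′))) go
  where
  go : ∀ i → i ≤ m + m′ → L ((ℓ + ℓ′) + (i + i))
  go i l with split≤ m m′ i l
  ... | x , y , lx , ly , refl =
    subst L (trans (+-interchange ℓ (x + x) ℓ′ (y + y)) (cong ((ℓ + ℓ′) +_) (+-interchange x x y y)))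
      (f _ _ (h x lx) (h′ y ly))

Span-diff1 : ∀ {L : ℕ → Set} ℓ → L ℓ → L (suc ℓ) → Span L 1
Span-diff1 {L} ℓ a b = run ℓ (λ { zero _ → subst L (sym (+-identityʳ ℓ)) a
                                  ; (suc zero) _ → subst L (+-comm 1 ℓ) b
                                  ; (suc (suc _)) (s≤s ()) })

-- A difference of 2 would support index 2 as well; claiming only 1 makes it interchangeable with a
-- difference of 1.
Span-diff2 : ∀ {L : ℕ → Set} ℓ → L ℓ → L (suc (suc ℓ)) → Span L 1
Span-diff2 {L} ℓ a b = alt ℓ 1 (s≤s z≤n) (λ { zero _ → subst L (sym (+-identityʳ ℓ)) a
                                  ; (suc zero) _ → subst L (+-comm 2 ℓ) b
                                  ; (suc (suc _)) (s≤s ()) })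

Span-0 : ∀ {L : ℕ → Set} ℓ → L ℓ → Span L 0
Span-0 {L} ℓ a = run ℓ (λ { zero _ → subst L (sym (+-identityʳ ℓ)) a })

-- Vertex sets, degrees, walks, paths and components

module _ {n : ℕ} (G : Graph n) where

  V : Set
  V = Fin n

  infix 4 _~_ _~?_ _∈_ _⊆_
  infixl 6 _∪_ _∩_ _∖_ _⊖_

  _~_ : V → V → Set
  u ~ v = adj G u v ≡ true

  _~?_ : ∀ u v → Dec (u ~ v)
  u ~? v = adj G u v Bool.≟ true

  ~-sym : ∀ {u v} → u ~ v → v ~ u
  ~-sym {u} {v} e = trans (symm G v u) e

  ~-irrefl : ∀ {u v} → u ~ v → u ≢ v
  ~-irrefl {u} e refl with trans (sym e) (irrefl G u)
  ... | ()

  -- Predicates with a decision procedure: neighbourhoods and components are given by their defining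
  -- property and can still be counted.
  record VSet : Set₁ where
    constructor vset
    field
      mem  : V → Set
      mem? : ∀ v → Dec (mem v)
  open VSet public

  _∈_ : V → VSet → Set
  v ∈ W = mem W v

  _⊆_ : VSet → VSet → Set
  A ⊆ B = ∀ z → z ∈ A → z ∈ B

  Disjoint : VSet → VSet → Set
  Disjoint A B = ∀ z → z ∈ A → z ∈ B → ⊥

  _∪_ _∩_ _∖_ : VSet → VSet → VSet
  A ∪ B = vset (λ z → z ∈ A ⊎ z ∈ B) (λ z → mem? A z ⊎-dec mem? B z)
  A ∩ B = vset (λ z → z ∈ A × z ∈ B) (λ z → mem? A z ×-dec mem? B z)
  A ∖ B = vset (λ z → z ∈ A × ¬ z ∈ B) (λ z → mem? A z ×-dec ¬? (mem? B z))

  _⊖_ : VSet → V → VSet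
  A ⊖ v = vset (λ z → z ∈ A × z ≢ v) (λ z → mem? A z ×-dec ¬? (z ≟ v))

  ⁅_⁆ : V → VSet
  ⁅ v ⁆ = vset (_≡ v) (_≟ v)

  N : V → VSet
  N v = vset (v ~_) (v ~?_)

  N[_] : VSet → VSet
  N[ A ] = vset (λ z → ∃ λ a → a ∈ A × a ~ z) (λ z → any? (λ a → mem? A a ×-dec (a ~? z)))

  [_]ι : VSet → V → ℕ
  [ A ]ι v = ι (mem? A v)

  count : VSet → ℕ
  count A = cnt [ A ]ι

  deg : VSet → V → ℕ
  deg W v = count (N v ∩ W)

  count-mono : ∀ A B → A ⊆ B → count A ≤ count B
  count-mono A B s = cnt-mono [ A ]ι [ B ]ι (λ v → ι-mono (mem? A v) (mem? B v) (s v))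

  count-< : ∀ A B → A ⊆ B → ∀ v → v ∈ B → ¬ v ∈ A → count A < count B
  count-< A B s v b ¬a = cnt-mono-< [ A ]ι [ B ]ι (λ v → ι-mono (mem? A v) (mem? B v) (s v)) v h
    where
    h : [ A ]ι v < [ B ]ι v
    h rewrite ι-no (mem? A v) ¬a | ι-yes (mem? B v) b = s≤s z≤n

  count-∪ : ∀ A B C → (∀ z → z ∈ A → z ∈ B ⊎ z ∈ C) → count A ≤ count B + count C
  count-∪ A B C s = subst (count A ≤_) (cnt-+ [ B ]ι [ C ]ι)
    (cnt-mono [ A ]ι (λ z → [ B ]ι z + [ C ]ι z) (λ z → ι-⊎ (mem? A z) (mem? B z) (mem? C z) (s z)))

  count-single : ∀ A c {Q : Set} (q : Dec Q) → (∀ z → z ∈ A → z ≡ c) → (c ∈ A → Q) → count A ≤ ι q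
  count-single A c q h f = subst (_≤ ι q) (sym (cnt-1 [ A ]ι c (λ i ne → ι-no (mem? A i) (λ m → ne (h i m)))))
    (ι-mono (mem? A c) q f)

  -- The one extra element is charged to a property of the caller's choice; for degrees this is
  -- adjacency to `c`, so that a lost edge reappears as membership in `N c`.
  count-∪₁ : ∀ A B c {Q : Set} (q : Dec Q) → (∀ z → z ∈ A → z ∈ B ⊎ z ≡ c) → (c ∈ A → Q) → count A ≤ count B + ι q
  count-∪₁ A B c q h f = ≤-trans (count-∪ A B (A ∩ ⁅ c ⁆) s)
    (+-monoʳ-≤ (count B) (count-single (A ∩ ⁅ c ⁆) c q (λ z m → proj₂ m) (λ m → f (proj₁ m))))
    where
    s : ∀ z → z ∈ A → z ∈ B ⊎ z ∈ (A ∩ ⁅ c ⁆)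
    s z m with h z m
    ... | inj₁ b = inj₁ b
    ... | inj₂ e = inj₂ (m , e)

  count-⊖ : ∀ A v → count A ≤ suc (count (A ⊖ v))
  count-⊖ A v = ≤-trans (count-∪₁ A (A ⊖ v) v (mem? A v) s (λ m → m))
    (≤-trans (+-monoʳ-≤ (count (A ⊖ v)) (ι≤1 (mem? A v))) (≤-reflexive (+-comm _ 1)))
    where
    s : ∀ z → z ∈ A → z ∈ (A ⊖ v) ⊎ z ≡ v
    s z m with z ≟ v
    ... | yes e = inj₂ e
    ... | no ne = inj₁ (m , ne)

  count-elem : ∀ A → 1 ≤ count A → ∃ λ v → v ∈ A
  count-elem A l with cnt-pos [ A ]ι l
  ... | v , p with mem? A v
  ...   | yes m = v , m
  ...   | no _ with () ← p

  count-∅ : ∀ A → (∀ z → ¬ z ∈ A) → count A ≡ 0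
  count-∅ A h = cnt-0 [ A ]ι (λ i → ι-no (mem? A i) (h i))

  count≥1 : ∀ A v → v ∈ A → 1 ≤ count A
  count≥1 A v m = ≤-trans (s≤s z≤n) (count-< (A ⊖ v) A (λ z → proj₁) v m (λ k → proj₂ k refl))

  count-two : ∀ A → 2 ≤ count A → ∀ v → ∃ λ w → w ∈ A × w ≢ v
  count-two A l v with count-elem (A ⊖ v) (s≤s⁻¹ (≤-trans l (count-⊖ A v)))
  ... | w , m , ne = w , m , ne

  data Walk (W : VSet) : V → V → Set where
    stop : ∀ {u} → u ∈ W → Walk W u u
    step : ∀ {u w v} → u ∈ W → u ~ w → Walk W w v → Walk W u v

  -- The allowed set loses each vertex that is left, so paths are simple by construction.
  data Path (W : VSet) : V → V → ℕ → Set where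
    stop : ∀ {u} → u ∈ W → Path W u u 0
    step : ∀ {u w v ℓ} → u ∈ W → u ~ w → Path (W ⊖ u) w v ℓ → Path W u v (suc ℓ)

  walk-mono : ∀ {A B u v} → A ⊆ B → Walk A u v → Walk B u v
  walk-mono s (stop m)     = stop (s _ m)
  walk-mono s (step m e w) = step (s _ m) e (walk-mono s w)

  walk-++ : ∀ {W u v w} → Walk W u v → Walk W v w → Walk W u w
  walk-++ (stop m)     q = q
  walk-++ (step m e p) q = step m e (walk-++ p q)

  walk-start : ∀ {W u v} → Walk W u v → u ∈ W
  walk-start (stop m)     = m
  walk-start (step m _ _) = m

  walk-end : ∀ {W u v} → Walk W u v → v ∈ W
  walk-end (stop m)     = m
  walk-end (step _ _ w) = walk-end w

  walk-rev : ∀ {W u v} → Walk W u v → Walk W v u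
  walk-rev (stop m)     = stop m
  walk-rev (step m e w) = walk-++ (walk-rev w) (step (walk-start w) (~-sym e) (stop m))

  path-mono : ∀ {A B u v ℓ} → A ⊆ B → Path A u v ℓ → Path B u v ℓ
  path-mono s (stop m)     = stop (s _ m)
  path-mono s (step m e p) = step (s _ m) e (path-mono (λ z (a , ne) → s z a , ne) p)

  path-start : ∀ {W u v ℓ} → Path W u v ℓ → u ∈ W
  path-start (stop m)     = m
  path-start (step m _ _) = m

  path-end : ∀ {W u v ℓ} → Path W u v ℓ → v ∈ W
  path-end (stop m)     = m
  path-end (step _ _ p) = proj₁ (path-end p)

  path→walk : ∀ {W u v ℓ} → Path W u v ℓ → Walk W u v
  path→walk (stop m)     = stop m
  path→walk (step m e p) = step m e (walk-mono (λ z → proj₁) (path→walk p))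

  path-concat : ∀ {A B W u z w v k ℓ} → A ⊆ W → B ⊆ W → Disjoint A B →
                Path A u z k → z ~ w → Path B w v ℓ → Path W u v (suc (k + ℓ))
  path-concat a b d (stop m) e q =
    step (a _ m) e (path-mono (λ z y → b z y , λ { refl → d _ m y }) q)
  path-concat a b d (step m e′ p) e q =
    step (a _ m) e′ (path-concat (λ z (x , ne) → a z x , ne) (λ z y → b z y , λ { refl → d _ m y })
      (λ z (x , _) y → d z x y) p e q)

  path-rev : ∀ {W u v ℓ} → Path W u v ℓ → Path W v u ℓ
  path-rev (stop m) = stop m
  path-rev {W} {u} {v} (step {ℓ = ℓ} m e p) =
    subst (Path W v u) (cong suc (+-identityʳ ℓ))
      (path-concat {B = ⁅ u ⁆} (λ z → proj₁) (λ { z refl → m }) (λ z (_ , ne) eq → ne eq) (path-rev p) (~-sym e) (stop refl))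

  path-avoid : ∀ {W u v ℓ} z → Path W u v ℓ → Path (W ⊖ z) u v ℓ ⊎ (∃ λ k → Path W z v k)
  path-avoid {u = u} z (stop m) with u ≟ z
  ... | yes refl = inj₂ (_ , stop m)
  ... | no ne    = inj₁ (stop (m , ne))
  path-avoid {u = u} z (step m e p) with u ≟ z
  ... | yes refl = inj₂ (_ , step m e p)
  ... | no ne with path-avoid z p
  ...   | inj₁ q       = inj₁ (step (m , ne) e (path-mono (λ { y ((a , b) , c) → (a , c) , b }) q))
  ...   | inj₂ (k , q) = inj₂ (k , path-mono (λ y → proj₁) q)

  -- Loop erasure: if `u` reappears later, the path from that occurrence on replaces the whole walk.
  walk→path : ∀ {W u v} → Walk W u v → ∃ λ ℓ → Path W u v ℓ
  walk→path (stop m) = 0 , stop m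
  walk→path {u = u} (step m e w) with walk→path w
  ... | ℓ , p with path-avoid u p
  ...   | inj₁ q = suc ℓ , step m e q
  ...   | inj₂ q = q

  -- Every step of a path removes a vertex, so the search is bounded by the size of `W`. Deciding
  -- reachability through paths is what turns components into `VSet`s.
  path? : ∀ fuel W → count W ≤ fuel → ∀ u v → Dec (∃ λ ℓ → Path W u v ℓ)
  path? fuel W l u v with mem? W u
  ... | no ¬m = no (λ (ℓ , p) → ¬m (path-start p))
  ... | yes m with u ≟ v
  ...   | yes refl = yes (0 , stop m)
  path? zero W l u v | yes m | no ne = ⊥-elim (n≮n 0 (≤-trans (count≥1 W u m) l))
  path? (suc f) W l u v | yes m | no ne =
    map′ (λ (w , e , ℓ , p) → suc ℓ , step m e p) from
      (any? (λ w → (u ~? w) ×-dec path? f (W ⊖ u) (s≤s⁻¹ (≤-trans (count-< (W ⊖ u) W (λ z → proj₁) u m (λ k → proj₂ k refl)) l)) w v))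
    where
    from : (∃ λ ℓ → Path W u v ℓ) → ∃ λ w → (u ~ w) × ∃ λ ℓ → Path (W ⊖ u) w v ℓ
    from (_ , stop _)     = ⊥-elim (ne refl)
    from (_ , step _ e p) = _ , e , _ , p

  walk? : ∀ W u v → Dec (Walk W u v)
  walk? W u v = map′ (λ (_ , p) → path→walk p) walk→path (path? (count W) W ≤-refl u v)

  C : VSet → V → VSet
  C X u = vset (Walk X u) (walk? X u)

  C⊆ : ∀ X u → C X u ⊆ X
  C⊆ X u z w = walk-end w

  C-closed : ∀ X u {w z} → w ∈ C X u → w ~ z → z ∈ X → z ∈ C X u
  C-closed X u p e m = walk-++ p (step (walk-end p) e (stop m))

  walk-in-C : ∀ {X u c a} → Walk X u c → Walk X c a → Walk (C X u) c a
  walk-in-C p (stop m)     = stop p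
  walk-in-C p (step m e q) = step p e (walk-in-C (walk-++ p (step m e (stop (walk-start q)))) q)

  Connected : VSet → Set
  Connected W = ∀ u v → u ∈ W → v ∈ W → Walk W u v

  C-connected : ∀ X u → Connected (C X u)
  C-connected X u a b p q = walk-++ (walk-rev (walk-in-C (stop (walk-start p)) p)) (walk-in-C (stop (walk-start p)) q)

  exit : ∀ {X u z} K → Walk X u z → u ∈ K →
         Walk (X ∩ K) u z ⊎ (∃ λ y → ∃ λ y′ → Walk (X ∩ K) u y × y ~ y′ × y′ ∈ X × ¬ y′ ∈ K)
  exit K (stop m) k = inj₁ (stop (m , k))
  exit K (step {w = w} m e p) k with mem? K w
  ... | no ¬k = inj₂ (_ , w , stop (m , k) , e , walk-start p , ¬k)
  ... | yes k′ with exit K p k′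
  ...   | inj₁ q = inj₁ (step (m , k) e q)
  ...   | inj₂ (y , y′ , q , r) = inj₂ (y , y′ , step (m , k) e q , r)

  -- From outside, `Z` can be entered only from `v`; the walk is cut at its first visit to `v`,
  -- before it could have entered `Z`.
  bypass : ∀ {X a v} Z → Walk X a v → ¬ a ∈ Z →
           (∀ y z → y ∈ X → ¬ y ∈ Z → y ≢ v → z ∈ Z → z ∈ X → y ~ z → ⊥) → Walk (X ∖ Z) a v
  bypass Z (stop m) ¬z h = stop (m , ¬z)
  bypass {v = v} Z (step {u} {w} m e p) ¬z h with u ≟ v
  ... | yes refl = stop (m , ¬z)
  ... | no ne with mem? Z w
  ...   | yes z  = ⊥-elim (h u w m ¬z ne z (walk-start p) e)
  ...   | no ¬z′ = step (m , ¬z) e (bypass Z p ¬z′ h)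

  -- Rooted connectivity and the accounting of degrees

  -- S and R stand for the neighbourhoods of two roots x and y outside W; the conditions say
  -- that W with x, y and the edge xy is 2-connected.
  record Conn (W S R : VSet) : Set where
    field
      connected : Connected W
      source    : ∃ λ s → s ∈ W × s ∈ S
      target    : ∃ λ r → r ∈ W × r ∈ R
      cut       : ∀ v u → v ∈ W → u ∈ W → u ≢ v → ∃ λ z → Walk (W ⊖ v) u z × (z ∈ S ⊎ z ∈ R)
  open Conn public

  record Lens (W S R : VSet) (ℓ : ℕ) : Set where
    constructor lens
    field
      {first last} : V
      first∈ : first ∈ S
      last∈  : last ∈ R
      path   : Path W first last ℓ

  BadPiece : VSet → VSet → VSet → Set
  BadPiece W S R = ∃ λ v → ∃ λ u → v ∈ W × u ∈ W × u ≢ v × (∀ z → Walk (W ⊖ v) u z → ¬ z ∈ S × ¬ z ∈ R)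

  -- A mere negation of `cut` would be of no use; the search over all pairs returns a concrete
  -- component of some `W ⊖ v` that hangs on `v` alone.
  classify : ∀ W S R → Connected W → (∃ λ s → s ∈ W × s ∈ S) → (∃ λ r → r ∈ W × r ∈ R) →
             Conn W S R ⊎ BadPiece W S R
  classify W S R c s r with any? (λ v → any? (λ u → mem? W v ×-dec mem? W u ×-dec ¬? (u ≟ v) ×-dec
                           all? (λ z → walk? (W ⊖ v) u z →-dec (¬? (mem? S z) ×-dec ¬? (mem? R z)))))
  ... | yes bad = inj₂ bad
  ... | no ¬bad = inj₁ (record { connected = c ; source = s ; target = r ; cut = h })
    where
    h : ∀ v u → v ∈ W → u ∈ W → u ≢ v → ∃ λ z → Walk (W ⊖ v) u z × (z ∈ S ⊎ z ∈ R)
    h v u mv mu ne with any? (λ z → walk? (W ⊖ v) u z ×-dec (mem? S z ⊎-dec mem? R z))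
    ... | yes p = p
    ... | no ¬p = ⊥-elim (¬bad (v , u , mv , mu , ne , λ z w → (λ s → ¬p (z , w , inj₁ s)) , (λ r → ¬p (z , w , inj₂ r))))

  deg-∪ : ∀ W A B w → (∀ z → w ~ z → z ∈ W → z ∈ A ⊎ z ∈ B) → deg W w ≤ deg A w + deg B w
  deg-∪ W A B w h = count-∪ (N w ∩ W) (N w ∩ A) (N w ∩ B) s
    where
    s : ∀ z → z ∈ (N w ∩ W) → z ∈ (N w ∩ A) ⊎ z ∈ (N w ∩ B)
    s z (e , m) with h z e m
    ... | inj₁ a = inj₁ (e , a)
    ... | inj₂ b = inj₂ (e , b)

  deg-∪₁ : ∀ W A c w → (∀ z → w ~ z → z ∈ W → z ∈ A ⊎ z ≡ c) → deg W w ≤ deg A w + [ N c ]ι w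
  deg-∪₁ W A c w h = count-∪₁ (N w ∩ W) (N w ∩ A) c (mem? (N c) w) s (λ (e , _) → ~-sym e)
    where
    s : ∀ z → z ∈ (N w ∩ W) → z ∈ (N w ∩ A) ⊎ z ≡ c
    s z (e , m) with h z e m
    ... | inj₁ a = inj₁ (e , a)
    ... | inj₂ b = inj₂ b

  deg-mono : ∀ W A w → (∀ z → w ~ z → z ∈ W → z ∈ A) → deg W w ≤ deg A w
  deg-mono W A w h = count-mono (N w ∩ W) (N w ∩ A) (λ z (e , m) → e , h z e m)

  deg≤count : ∀ A w → deg A w ≤ count A
  deg≤count A w = count-mono (N w ∩ A) A (λ z → proj₂)

  deg≡0 : ∀ A w → ¬ w ∈ N[ A ] → deg A w ≡ 0
  deg≡0 A w h = count-∅ (N w ∩ A) (λ z (e , m) → h (z , m , ~-sym e))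

  -- When `A` is contracted to one vertex, the edges from `w` to it become a single edge, recorded
  -- by `N[ A ]`; a vertex without such edges loses nothing.
  deg-contract : ∀ A w b → deg A w ≤ suc b → deg A w ≤ [ N[ A ] ]ι w + b
  deg-contract A w b l with mem? N[ A ] w
  ... | yes _ = l
  ... | no ¬m rewrite deg≡0 A w ¬m = z≤n

  deg-unique : ∀ A w → (∀ a b → a ∈ A → b ∈ A → w ~ a → w ~ b → a ≡ b) → deg A w ≤ [ N[ A ] ]ι w
  deg-unique A w h with mem? N[ A ] w
  ... | yes (a , m , e) = ≤-trans (count-single (N w ∩ A) a (yes e) (λ z (f , k) → h z a k m f (~-sym e)) (λ _ → e)) ≤-refl
  ... | no ¬m rewrite deg≡0 A w ¬m = z≤n

  Conn-flip : ∀ {W S R} → Conn W S R → Conn W R S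
  Conn-flip c = record { connected = connected c ; source = target c ; target = source c
                       ; cut = λ v u mv mu ne → flip⊎ (cut c v u mv mu ne) }
    where
    flip⊎ : ∀ {P : V → Set} {Q R : V → Set} → (∃ λ z → P z × (Q z ⊎ R z)) → ∃ λ z → P z × (R z ⊎ Q z)
    flip⊎ (z , p , inj₁ q) = z , p , inj₂ q
    flip⊎ (z , p , inj₂ q) = z , p , inj₁ q

  Lens-flip : ∀ {W S R} ℓ → Lens W S R ℓ → Lens W R S ℓ
  Lens-flip ℓ (lens s r p) = lens r s (path-rev p)

  Lens-prepend : ∀ {W S R K} A → A ⊆ W → A ⊆ S → K ⊆ W → Disjoint A K → ∀ ℓ → Lens K N[ A ] R ℓ → Lens W S R (suc ℓ)
  Lens-prepend A aw as kw d ℓ (lens (a , m , e) r p) =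
    lens (as a m) r (step (aw a m) e (path-mono (λ z k → kw z k , λ { refl → d z m k }) p))

  Lens-append : ∀ {W S R K B c r m} → K ⊆ W → B ⊆ W → Disjoint K B → Path B c r m → r ∈ R →
                ∀ ℓ → Lens K S (N c) ℓ → Lens W S R (suc m + ℓ)
  Lens-append {m = m} kw bw d q mr ℓ (lens s e p) =
    lens s mr (subst (Path _ _ _) (cong suc (+-comm ℓ m)) (path-concat kw bw d p (~-sym e) q))

  -- The component `K` is left only through `v`, so `v` replaces the second root: edges to `v`
  -- become membership in `N v`, and no degree is lost because `K` has no vertex in `R`. All paths
  -- through `K` continue along one fixed tail from `v` to `R`, a constant shift of lengths.
  module DeadEnd {W S R : VSet} (co : Conn W S R) {v u : V} (mv : v ∈ W) (mu : u ∈ W) (ne : u ≢ v)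
                 (noR : ∀ z → z ∈ C (W ⊖ v) u → ¬ z ∈ R) where

    K : VSet
    K = C (W ⊖ v) u

    K⊆W : K ⊆ W
    K⊆W z k = proj₁ (C⊆ (W ⊖ v) u z k)

    K∌v : ¬ v ∈ K
    K∌v k = proj₂ (C⊆ (W ⊖ v) u v k) refl

    u∈K : u ∈ K
    u∈K = stop (mu , ne)

    smaller : count K < count W
    smaller = count-< K W K⊆W v mv K∌v

    closed : ∀ {w z} → w ∈ K → w ~ z → z ∈ W → z ∈ K ⊎ z ≡ v
    closed {w} {z} k e m with z ≟ v
    ... | yes eq = inj₂ eq
    ... | no nv  = inj₁ (C-closed (W ⊖ v) u k e (m , nv))

    degK : ∀ w → w ∈ K → deg W w + [ S ]ι w + [ R ]ι w ≤ deg K w + [ S ]ι w + [ N v ]ι w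
    degK w k rewrite ι-no (mem? R w) (noR w k) = begin
      deg W w + [ S ]ι w + 0               ≡⟨ +-identityʳ _ ⟩
      deg W w + [ S ]ι w                   ≤⟨ +-monoˡ-≤ ([ S ]ι w) (deg-∪₁ W K v w (λ z e m → closed k e m)) ⟩
      deg K w + [ N v ]ι w + [ S ]ι w      ≡⟨ +-assoc (deg K w) _ _ ⟩
      deg K w + ([ N v ]ι w + [ S ]ι w)    ≡⟨ cong (deg K w +_) (+-comm ([ N v ]ι w) ([ S ]ι w)) ⟩
      deg K w + ([ S ]ι w + [ N v ]ι w)    ≡⟨ sym (+-assoc (deg K w) _ _) ⟩
      deg K w + [ S ]ι w + [ N v ]ι w      ∎
      where open ≤-Reasoning

    connK : Conn K S (N v)
    connK = record { connected = C-connected (W ⊖ v) u ; source = src ; target = tgt ; cut = ct }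
      where
      src : ∃ λ s → s ∈ K × s ∈ S
      src with cut co v u mv mu ne
      ... | z , w , inj₁ s = z , w , s
      ... | z , w , inj₂ r = ⊥-elim (noR z w r)
      tgt : ∃ λ r → r ∈ K × v ~ r
      tgt with exit K (connected co u v mu mv) u∈K
      ... | inj₁ w = ⊥-elim (K∌v (proj₂ (walk-end w)))
      ... | inj₂ (y , y′ , w , e , m , ¬k) with closed (proj₂ (walk-end w)) e m
      ...   | inj₁ k = ⊥-elim (¬k k)
      ...   | inj₂ refl = y , proj₂ (walk-end w) , ~-sym e
      ct : ∀ v′ u′ → v′ ∈ K → u′ ∈ K → u′ ≢ v′ → ∃ λ z → Walk (K ⊖ v′) u′ z × (z ∈ S ⊎ v ~ z)
      ct v′ u′ kv ku ne′ with cut co v′ u′ (K⊆W v′ kv) (K⊆W u′ ku) ne′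
      ... | z , w , sr with exit K w ku
      ...   | inj₁ w′ = z , walk-mono (λ { x ((_ , nx) , k) → k , nx }) w′ , fin sr
        where
        fin : z ∈ S ⊎ z ∈ R → z ∈ S ⊎ v ~ z
        fin (inj₁ s) = inj₁ s
        fin (inj₂ r) = ⊥-elim (noR z (proj₂ (walk-end w′)) r)
      ...   | inj₂ (y , y′ , w′ , e , (m , _) , ¬k) with closed (proj₂ (walk-end w′)) e m
      ...     | inj₁ k = ⊥-elim (¬k k)
      ...     | inj₂ refl = y , walk-mono (λ { x ((_ , nx) , k) → k , nx }) w′ , inj₂ (~-sym e)

    tail : ∃ λ r → ∃ λ m → r ∈ R × Path (W ∖ K) v r m
    tail with target co
    ... | r , mr , rr with walk→path (walk-rev (bypass K (connected co r v mr mv) (λ k → noR r k rr) h))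
      where
      h : ∀ y z → y ∈ W → ¬ y ∈ K → y ≢ v → z ∈ K → z ∈ W → y ~ z → ⊥
      h y z my ¬k ny kz _ e = ¬k (C-closed (W ⊖ v) u kz (~-sym e) (my , ny))
    ...   | m , q = r , m , rr , q

    lift : ∃ λ c → ∀ ℓ → Lens K S (N v) ℓ → Lens W S R (c + ℓ)
    lift with tail
    ... | r , m , rr , q = suc m , Lens-append K⊆W (λ z → proj₁) (λ z k (_ , ¬k) → ¬k k) q rr

  -- Two lengths that differ by 1 or 2

  -- Whichever of `s` and `s′` comes later on the path may serve as its start; the rest avoids the
  -- other one.
  last-of : ∀ {W s r ℓ} s′ → s ≢ s′ → Path W s r ℓ → Path (W ⊖ s′) s r ℓ ⊎ (∃ λ k → Path (W ⊖ s) s′ r k)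
  last-of s′ ne (stop m) = inj₁ (stop (m , ne))
  last-of s′ ne (step m e p) with path-avoid s′ p
  ... | inj₁ q = inj₁ (step (m , ne) e (path-mono (λ { y ((a , b) , c) → (a , c) , b }) q))
  ... | inj₂ q = inj₂ q

  -- Starting at the later of the two ends, the path can be taken as it is or with the edge `s s′`
  -- put in front.
  edge-span : ∀ {W S R r} s s′ → s ∈ S → s′ ∈ S → s′ ∈ W → s ~ s′ → r ∈ R → Walk W s r → Span (Lens W S R) 1
  edge-span {W} s s′ ms ms′ mw e mr w with walk→path w
  ... | ℓ , p with last-of s′ (~-irrefl e) p
  ...   | inj₁ q = Span-diff1 ℓ (lens ms mr p) (lens ms′ mr (step mw (~-sym e) q))
  ...   | inj₂ (k , q) = Span-diff1 k (lens ms′ mr (path-mono (λ z → proj₁) q)) (lens ms mr (step (walk-start w) e q))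

  cherry-span′ : ∀ {W S R r k} w a b → a ∈ S → b ∈ S → w ∈ W → b ∈ W → w ~ a → w ~ b → r ∈ R →
                 Path ((W ⊖ w) ⊖ b) a r k → Span (Lens W S R) 1
  cherry-span′ w a b ma mb mw mbw ea eb mr q =
    Span-diff2 _ (lens ma mr (path-mono (λ z m → proj₁ (proj₁ m)) q))
      (lens mb mr (step mbw (~-sym eb) (step (mw , ~-irrefl eb) ea (path-mono (λ { z ((x , y) , t) → (x , t) , y }) q))))

  -- As for an edge, but the detour from one end to the other goes through `w`, adds 2, and requires
  -- a path that avoids `w`.
  cherry-span : ∀ {W S R r} w s s′ → s ∈ S → s′ ∈ S → w ∈ W → s′ ∈ W → s ≢ s′ → w ~ s → w ~ s′ → r ∈ R →
                Walk (W ⊖ w) s r → Span (Lens W S R) 1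
  cherry-span w s s′ ms ms′ mw mw′ ne e e′ mr wk with walk→path wk
  ... | ℓ , p with last-of s′ ne p
  ...   | inj₁ q       = cherry-span′ w s s′ ms ms′ mw mw′ e e′ mr q
  ...   | inj₂ (k , q) = cherry-span′ w s′ s ms′ ms mw (proj₁ (walk-start wk)) e′ e mr q

  -- The exempt vertex c will be the second vertex of a 2-cut, which loses neighbours.
  TwoLengths : VSet → Set₁
  TwoLengths W = ∀ S R c → Conn W S R → (∀ v → v ∈ W → v ≢ c → 3 ≤ deg W v + [ S ]ι v + [ R ]ι v) →
                 (∃ λ v → v ∈ W × v ≢ c) → Span (Lens W S R) 1

  module _ (W S R : VSet) (IH : ∀ K → count K < count W → TwoLengths K) (c : V) (co : Conn W S R)
           (dg : ∀ v → v ∈ W → v ≢ c → 3 ≤ deg W v + [ S ]ι v + [ R ]ι v) where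

    two-dead : ∀ {v u} → v ∈ W → u ∈ W → u ≢ v → (∀ z → z ∈ C (W ⊖ v) u → ¬ z ∈ R) →
               (∃ λ w → w ∈ C (W ⊖ v) u × w ≢ c) → Span (Lens W S R) 1
    two-dead {v} mv mu ne noR normal with lift
      where open DeadEnd co mv mu ne noR
    ... | t , f = Span-map t f (IH K smaller S (N v) c connK (λ w k nc → ≤-trans (dg w (K⊆W w k) nc) (degK w k)) normal)
      where open DeadEnd co mv mu ne noR

    -- A vertex outside `S` has at most one neighbour in `SW`, so contracting all of `SW` into the
    -- first root costs it nothing: the one edge turns into membership in `N[ SW ]`.
    module Independent (indep : ∀ a b → a ∈ W → b ∈ W → a ∈ S → b ∈ S → a ~ b → ⊥)
                       (uniq : ∀ w a b → w ∈ W → ¬ w ∈ S → a ∈ (W ∩ S) → b ∈ (W ∩ S) → w ~ a → w ~ b → a ≡ b) where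

      W′ : VSet
      W′ = W ∖ S

      SW : VSet
      SW = W ∩ S

      closed : ∀ d {w z} → w ∈ C W′ d → w ~ z → z ∈ W → z ∈ C W′ d ⊎ z ∈ SW
      closed d {w} {z} k e m with mem? S z
      ... | yes s = inj₂ (m , s)
      ... | no ¬s = inj₁ (C-closed W′ d k e (m , ¬s))

      smaller : ∀ d → count (C W′ d) < count W
      smaller d with source co
      ... | s , ms , ss = count-< (C W′ d) W (λ z k → proj₁ (C⊆ W′ d z k)) s ms (λ k → proj₂ (C⊆ W′ d s k) ss)

      contract : ∀ d r → r ∈ C W′ d → r ∈ R → (∃ λ v → v ∈ C W′ d × v ≢ c) → Span (Lens W S R) 1
      contract d r mr rr normal =
        Span-map 1 (Lens-prepend SW (λ z → proj₁) (λ z → proj₂) D⊆ (λ z s k → proj₂ (C⊆ W′ d z k) (proj₂ s)))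
          (IH D (smaller d) N[ SW ] R c connD degD normal)
        where
        D : VSet
        D = C W′ d
        D⊆ : D ⊆ W
        D⊆ z k = proj₁ (C⊆ W′ d z k)
        leave : ∀ {X u z} → X ⊆ W → u ∈ D → Walk X u z → (z ∈ D × Walk (X ∩ D) u z) ⊎ (∃ λ y → Walk (X ∩ D) u y × y ∈ N[ SW ])
        leave s k w with exit D w k
        ... | inj₁ w′ = inj₁ (proj₂ (walk-end w′) , w′)
        ... | inj₂ (y , y′ , w′ , e , m , ¬k) with closed d (proj₂ (walk-end w′)) e (s y′ m)
        ...   | inj₁ k′ = ⊥-elim (¬k k′)
        ...   | inj₂ sw = inj₂ (y , w′ , (y′ , sw , ~-sym e))
        connD : Conn D N[ SW ] R
        connD = record { connected = C-connected W′ d ; source = src ; target = r , mr , rr ; cut = ct }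
          where
          src : ∃ λ s → s ∈ D × s ∈ N[ SW ]
          src with source co
          ... | s , ms , ss with leave (λ z m → m) mr (connected co r s (D⊆ r mr) ms)
          ...   | inj₁ (k , _) = ⊥-elim (proj₂ (C⊆ W′ d s k) ss)
          ...   | inj₂ (y , w , sy) = y , proj₂ (walk-end w) , sy
          ct : ∀ v u → v ∈ D → u ∈ D → u ≢ v → ∃ λ z → Walk (D ⊖ v) u z × (z ∈ N[ SW ] ⊎ z ∈ R)
          ct v u kv ku ne with cut co v u (D⊆ v kv) (D⊆ u ku) ne
          ... | z , w , sr with leave (λ z → proj₁) ku w
          ...   | inj₂ (y , w′ , sy) = y , walk-mono (λ { x ((_ , nx) , k) → k , nx }) w′ , inj₁ sy
          ...   | inj₁ (k , w′) with sr
          ...     | inj₁ s = ⊥-elim (proj₂ (C⊆ W′ d z k) s)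
          ...     | inj₂ rz = z , walk-mono (λ { x ((_ , nx) , k) → k , nx }) w′ , inj₂ rz
        degD : ∀ v → v ∈ D → v ≢ c → 3 ≤ deg D v + [ N[ SW ] ]ι v + [ R ]ι v
        degD v k nc with dg v (D⊆ v k) nc
        ... | l rewrite ι-no (mem? S v) (proj₂ (C⊆ W′ d v k)) | +-identityʳ (deg W v) =
          ≤-trans l (+-monoˡ-≤ ([ R ]ι v) (≤-trans (deg-∪ W D SW v (λ z e m → closed d k e m))
            (+-monoʳ-≤ (deg D v) (deg-unique SW v (λ a b ma mb → uniq v a b (D⊆ v k) (proj₂ (C⊆ W′ d v k)) ma mb)))))

      -- The component `L` misses `R`, so paths must come back to the core of entries: they start in
      -- `SW ⊖ r`, cross `L` and end at `r`, which lies in `R`. An edge from `L` to `SW` goes either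
      -- to `r`, the new second root, or to the contracted rest.
      return : ∀ l r → l ∈ W′ → r ∈ SW → r ∈ R → r ≢ c → r ~ l → (∀ z → z ∈ C W′ l → ¬ z ∈ R) → Span (Lens W S R) 1
      return l r ml mr rr nc e noR =
        Span-map 2 (λ ℓ x → Lens-prepend {K = L ∪ ⁅ r ⁆} (SW ⊖ r) (λ z m → proj₁ (proj₁ m)) (λ z m → proj₂ (proj₁ m)) Lr⊆
                        (λ { z ((_ , s) , ne) (inj₁ k) → proj₂ (C⊆ W′ l z k) s ; z (_ , ne) (inj₂ eq) → ne eq }) (suc ℓ)
                        (Lens-append {B = ⁅ r ⁆} (λ z → inj₁) (λ z → inj₂) (λ { z k refl → proj₂ (C⊆ W′ l z k) (proj₂ mr) }) (stop refl) rr ℓ x))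
          (IH L (smaller l) N[ SW ⊖ r ] (N r) c connL degL normal)
        where
        L : VSet
        L = C W′ l
        L⊆ : L ⊆ W
        L⊆ z k = proj₁ (C⊆ W′ l z k)
        Lr⊆ : (L ∪ ⁅ r ⁆) ⊆ W
        Lr⊆ z (inj₁ k)    = L⊆ z k
        Lr⊆ z (inj₂ refl) = proj₁ mr
        leave : ∀ {v u} → v ∈ W → u ∈ L → u ≢ v → ∃ λ y → ∃ λ y′ → Walk ((W ⊖ v) ∩ L) u y × y ~ y′ × y′ ∈ SW × y′ ≢ v
        leave {v} {u} mv k ne with cut co v u mv (L⊆ u k) ne
        ... | z , w , sr with exit L w k
        ...   | inj₁ w′ = ⊥-elim (fin sr)
          where
          fin : z ∈ S ⊎ z ∈ R → ⊥
          fin (inj₁ s)  = proj₂ (C⊆ W′ l z (proj₂ (walk-end w′))) s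
          fin (inj₂ rz) = noR z (proj₂ (walk-end w′)) rz
        ...   | inj₂ (y , y′ , w′ , e , (m , ne′) , ¬k) with closed l (proj₂ (walk-end w′)) e m
        ...     | inj₁ k′ = ⊥-elim (¬k k′)
        ...     | inj₂ sw = y , y′ , w′ , e , sw , ne′
        l≢r : l ≢ r
        l≢r refl = proj₂ ml (proj₂ mr)
        connL : Conn L N[ SW ⊖ r ] (N r)
        connL = record { connected = C-connected W′ l ; source = src ; target = l , stop ml , e ; cut = ct }
          where
          src : ∃ λ s → s ∈ L × s ∈ N[ SW ⊖ r ]
          src with leave (proj₁ mr) (stop ml) l≢r
          ... | y , y′ , w , e′ , sw , ne = y , proj₂ (walk-end w) , (y′ , (sw , ne) , ~-sym e′)
          ct : ∀ v u → v ∈ L → u ∈ L → u ≢ v → ∃ λ z → Walk (L ⊖ v) u z × (z ∈ N[ SW ⊖ r ] ⊎ r ~ z)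
          ct v u kv ku ne with leave (L⊆ v kv) ku ne
          ... | y , y′ , w , e′ , sw , _ = y , walk-mono (λ { x ((_ , nx) , k) → k , nx }) w , fin
            where
            fin : y ∈ N[ SW ⊖ r ] ⊎ r ~ y
            fin with y′ ≟ r
            ... | yes refl = inj₂ (~-sym e′)
            ... | no ne′   = inj₁ (y′ , (sw , ne′) , ~-sym e′)
        normal : ∃ λ v → v ∈ L × v ≢ c
        normal with l ≟ c
        ... | no ne = l , stop ml , ne
        -- `L` can be left towards a vertex of `SW` other than `r`. That exit does not start at `l`,
        -- whose only neighbour in `SW` is `r`.
        ... | yes refl with leave (proj₁ mr) (stop ml) l≢r
        ...   | y , y′ , w , e′ , sw , ne = y , proj₂ (walk-end w) , λ { refl → ne (uniq y y′ r (proj₁ ml) (proj₂ ml) sw mr e′ (~-sym e)) }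
        degL : ∀ v → v ∈ L → v ≢ c → 3 ≤ deg L v + [ N[ SW ⊖ r ] ]ι v + [ N r ]ι v
        degL v k nc with dg v (L⊆ v k) nc
        ... | h rewrite ι-no (mem? S v) (proj₂ (C⊆ W′ l v k)) | ι-no (mem? R v) (noR v k) = begin
          3                               ≤⟨ h ⟩
          deg W v + 0 + 0                 ≡⟨ trans (+-identityʳ _) (+-identityʳ _) ⟩
          deg W v                         ≤⟨ deg-∪ W L SW v (λ z e m → closed l k e m) ⟩
          deg L v + deg SW v              ≤⟨ +-monoʳ-≤ (deg L v) (deg-∪₁ SW (SW ⊖ r) r v dec) ⟩
          deg L v + (deg (SW ⊖ r) v + [ N r ]ι v)
            ≤⟨ +-monoʳ-≤ (deg L v) (+-monoˡ-≤ ([ N r ]ι v) (deg-unique (SW ⊖ r) v (λ a b ma mb → uniq v a b (L⊆ v k) (proj₂ (C⊆ W′ l v k)) (proj₁ ma) (proj₁ mb)))) ⟩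
          deg L v + ([ N[ SW ⊖ r ] ]ι v + [ N r ]ι v) ≡⟨ sym (+-assoc (deg L v) _ _) ⟩
          deg L v + [ N[ SW ⊖ r ] ]ι v + [ N r ]ι v ∎
          where
          open ≤-Reasoning
          dec : ∀ z → v ~ z → z ∈ SW → z ∈ (SW ⊖ r) ⊎ z ≡ r
          dec z _ m with z ≟ r
          ... | yes eq = inj₂ eq
          ... | no ne  = inj₁ (m , ne)

      independent-case : ∀ r → r ∈ W → r ∈ R → r ≢ c → Span (Lens W S R) 1
      independent-case r mr rr nc with mem? S r
      ... | no ¬s = contract r r (stop (mr , ¬s)) rr (r , stop (mr , ¬s) , nc)
      -- Of the three units of `r` at most two come from the roots, so one neighbour in `W` remains.
      ... | yes s with count-elem (N r ∩ W) (s≤s⁻¹ (s≤s⁻¹ (≤-trans (dg r mr nc) h)))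
        where
        h : deg W r + [ S ]ι r + [ R ]ι r ≤ suc (suc (deg W r))
        h = ≤-trans (+-mono-≤ (+-monoʳ-≤ (deg W r) (ι≤1 (mem? S r))) (ι≤1 (mem? R r)))
              (≤-reflexive (trans (+-comm _ 1) (cong suc (+-comm _ 1))))
      ...   | l , e , ml with any? (λ z → walk? W′ l z ×-dec mem? R z)
      ...     | no none = return l r (ml , λ sl → indep r l mr ml s sl e) (mr , s) rr nc e (λ z k rz → none (z , k , rz))
      ...     | yes (z , k , rz) with l ≟ c
      ...       | no ne = contract l z k rz (l , stop (walk-start k) , ne)
      ...       | yes refl with z ≟ c
      ...         | no nz = contract z z (stop (walk-end k)) rz (z , stop (walk-end k) , nz)
      -- Both `l` and `z` are the exempt vertex, so it lies in `R`; the vertex `r` and the edge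
      -- `r l` are paths of lengths 0 and 1.
      ...         | yes refl = Span-diff1 0 (lens s rr (stop mr)) (lens s rz (step mr e (stop (ml , λ eq → ~-irrefl e (sym eq)))))

    two-step : (∃ λ v → v ∈ W × v ≢ c) → Span (Lens W S R) 1
    two-step (v , mv , nv) with any? (λ r → mem? W r ×-dec mem? R r ×-dec ¬? (r ≟ c))
    ... | no none with target co
    ...   | r , mr , rr with r ≟ c
    ...     | no ne = ⊥-elim (none (r , mr , rr , ne))
    -- With `c` the only vertex of `W` in `R`, everything else is a dead end behind `c`.
    ...     | yes refl = two-dead mr mv nv
                           (λ z k rz → none (z , proj₁ (walk-end k) , rz , proj₂ (walk-end k)))
                           (v , stop (mv , nv) , nv)
    two-step normal | yes (r , mr , rr , nr)
      with any? (λ a → any? (λ b → mem? W a ×-dec mem? W b ×-dec mem? S a ×-dec mem? S b ×-dec (a ~? b)))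
    ... | yes (a , b , ma , mb , sa , sb , e) = edge-span a b sa sb mb e rr (connected co a r ma mr)
    ... | no noedge
      with any? (λ w → any? (λ a → any? (λ b → mem? W w ×-dec ¬? (mem? S w) ×-dec mem? (W ∩ S) a ×-dec mem? (W ∩ S) b
                  ×-dec (w ~? a) ×-dec (w ~? b) ×-dec ¬? (a ≟ b))))
    ...   | no nocherry = Independent.independent-case (λ a b ma mb sa sb e → noedge (a , b , ma , mb , sa , sb , e)) uniq r mr rr nr
      where
      uniq : ∀ w a b → w ∈ W → ¬ w ∈ S → a ∈ (W ∩ S) → b ∈ (W ∩ S) → w ~ a → w ~ b → a ≡ b
      uniq w a b mw ¬s ma mb ea eb with a ≟ b
      ... | yes eq = eq
      ... | no ne  = ⊥-elim (nocherry (w , a , b , mw , ¬s , ma , mb , ea , eb , ne))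
    ...   | yes (w , a , b , mw , _ , (ma , sa) , (mb , sb) , ea , eb , ne) = choose
      where
      cherry : ∀ a b → a ∈ W → b ∈ W → a ∈ S → b ∈ S → w ~ a → w ~ b → a ≢ b → a ≢ c → Span (Lens W S R) 1
      cherry a b ma mb sa sb ea eb ne nc with any? (λ z → walk? (W ⊖ w) a z ×-dec mem? R z)
      ... | yes (z , k , rz) = cherry-span w a b sa sb mw mb ne ea eb rz k
      ... | no none = two-dead mw ma (λ eq → ~-irrefl ea (sym eq)) (λ z k rz → none (z , k , rz))
                        (a , stop (ma , λ eq → ~-irrefl ea (sym eq)) , nc)
      choose : Span (Lens W S R) 1
      -- If the component behind `w` is a dead end, it must contain a vertex other than `c`; one of
      -- the two ends of the cherry is such a vertex.
      choose with a ≟ c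
      ... | no na    = cherry a b ma mb sa sb ea eb ne na
      ... | yes refl = cherry b a mb ma sb sa eb ea (λ eq → ne (sym eq)) (λ eq → ne (sym eq))

  two-lengths-fuel : ∀ f W → count W ≤ f → TwoLengths W
  two-lengths-fuel f W l S R c co dg (v , m , nv) with f
  ... | zero  = ⊥-elim (n≮n 0 (≤-trans (count≥1 W v m) l))
  ... | suc f = two-step W S R (λ K lt → two-lengths-fuel f K (s≤s⁻¹ (≤-trans lt l))) c co dg (v , m , nv)

  two-lengths : ∀ W → TwoLengths W
  two-lengths W = two-lengths-fuel (count W) W ≤-refl

  Lens-mono : ∀ {A W S R} → A ⊆ W → ∀ ℓ → Lens A S R ℓ → Lens W S R ℓ
  Lens-mono s ℓ (lens a b p) = lens a b (path-mono s p)

  -- A piece that hangs on `v` and meets neither root must contain `c`. Deleting it removes the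
  -- exempt vertex, and only `v` loses neighbours, so `v` becomes exempt instead. The two vertices
  -- of `S` survive all deletions and leave one that is not exempt.
  two-lengths-prune : ∀ f W → count W ≤ f → ∀ S R c → Connected W → ∀ s s′ r → s ∈ W → s′ ∈ W → r ∈ W →
    s ∈ S → s′ ∈ S → s ≢ s′ → r ∈ R →
    (∀ v u → v ∈ W → u ∈ W → u ≢ v → ∃ λ z → Walk (W ⊖ v) u z × (z ∈ S ⊎ z ∈ R ⊎ z ≡ c)) →
    (∀ v → v ∈ W → v ≢ c → 3 ≤ deg W v + [ S ]ι v + [ R ]ι v) → Span (Lens W S R) 1
  two-lengths-prune f W l S R c co s s′ r ms ms′ mr ss ss′ ne rr ct dg
    with classify W S R co (s , ms , ss) (r , mr , rr)
  ... | inj₁ cn = two-lengths W S R c cn dg normal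
    where
    normal : ∃ λ v → v ∈ W × v ≢ c
    normal with s ≟ c
    ... | no nc    = s , ms , nc
    ... | yes refl = s′ , ms′ , λ eq → ne (sym eq)
  two-lengths-prune zero W l S R c co s s′ r ms ms′ mr ss ss′ ne rr ct dg | inj₂ _ =
    ⊥-elim (n≮n 0 (≤-trans (count≥1 W s ms) l))
  two-lengths-prune (suc f) W l S R c co s s′ r ms ms′ mr ss ss′ ne rr ct dg | inj₂ (v , u , mv , mu , nuv , bad) =
    Span-map 0 (Lens-mono (λ z → proj₁))
      (two-lengths-prune f W₁ (s≤s⁻¹ (≤-trans (count-< W₁ W (λ z → proj₁) u mu (λ m → proj₂ m (stop (mu , nuv)))) l))
        S R v co₁ s s′ r (ms , λ k → proj₁ (bad s k) ss) (ms′ , λ k → proj₁ (bad s′ k) ss′) (mr , λ k → proj₂ (bad r k) rr)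
        ss ss′ ne rr ct₁ dg₁)
    where
    Z : VSet
    Z = C (W ⊖ v) u
    W₁ : VSet
    W₁ = W ∖ Z
    c∈Z : c ∈ Z
    c∈Z with ct v u mv mu nuv
    ... | z , w , inj₁ sz        = ⊥-elim (proj₁ (bad z w) sz)
    ... | z , w , inj₂ (inj₁ rz) = ⊥-elim (proj₂ (bad z w) rz)
    ... | z , w , inj₂ (inj₂ refl) = w
    outside : ∀ y z → y ∈ W → ¬ y ∈ Z → y ≢ v → z ∈ Z → z ∈ W → y ~ z → ⊥
    outside y z my ¬k ny kz _ e = ¬k (C-closed (W ⊖ v) u kz (~-sym e) (my , ny))
    to-v : ∀ a → a ∈ W₁ → Walk W₁ a v
    to-v a (m , ¬k) = bypass Z (co a v m mv) ¬k outside
    co₁ : Connected W₁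
    co₁ a b ma mb = walk-++ (to-v a ma) (walk-rev (to-v b mb))
    ct₁ : ∀ v′ u′ → v′ ∈ W₁ → u′ ∈ W₁ → u′ ≢ v′ → ∃ λ z → Walk (W₁ ⊖ v′) u′ z × (z ∈ S ⊎ z ∈ R ⊎ z ≡ v)
    ct₁ v′ u′ mv′ mu′ ne′ with ct v′ u′ (proj₁ mv′) (proj₁ mu′) ne′
    ... | z , w , t with exit W₁ w mu′
    ...   | inj₁ w′ = z , walk-mono (λ { x ((_ , nx) , k) → k , nx }) w′ , fin t
      where
      fin : z ∈ S ⊎ z ∈ R ⊎ z ≡ c → z ∈ S ⊎ z ∈ R ⊎ z ≡ v
      fin (inj₁ x) = inj₁ x
      fin (inj₂ (inj₁ x)) = inj₂ (inj₁ x)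
      fin (inj₂ (inj₂ refl)) = ⊥-elim (proj₂ (proj₂ (walk-end w′)) c∈Z)
    ...   | inj₂ (y , y′ , w′ , e , (my′ , _) , ¬m) = y , walk-mono (λ { x ((_ , nx) , k) → k , nx }) w′ , inj₂ (inj₂ eq)
      where
      y∈ : y ∈ W₁
      y∈ = proj₂ (walk-end w′)
      eq : y ≡ v
      eq with y ≟ v | mem? Z y′
      ... | yes q | _     = q
      ... | no nq | no ¬k = ⊥-elim (¬m (my′ , ¬k))
      ... | no nq | yes k = ⊥-elim (outside y y′ (proj₁ y∈) (proj₂ y∈) nq k my′ e)
    dg₁ : ∀ w → w ∈ W₁ → w ≢ v → 3 ≤ deg W₁ w + [ S ]ι w + [ R ]ι w
    dg₁ w (m , ¬k) nv = ≤-trans (dg w m (λ { refl → ¬k c∈Z }))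
      (+-monoˡ-≤ ([ R ]ι w) (+-monoˡ-≤ ([ S ]ι w) (deg-mono W W₁ w (λ z e mz → mz , λ kz → outside w z m ¬k nv kz mz e))))

  -- Complete bipartite cores

  Complete : VSet → VSet → Set
  Complete A T = ∀ a t → a ∈ A → t ∈ T → a ~ t

  Complete-disjoint : ∀ A T → Complete A T → Disjoint A T
  Complete-disjoint A T co z a t = ~-irrefl (co z z a t) refl

  -- Built from the end: set `t` and some `a` aside, take a path with two edges fewer to another
  -- vertex of `T`, then append `a` and `t`. Both ends lie in `T`, hence one vertex more of `T` than
  -- of `A`.
  core-path : ∀ j A T t → Complete A T → j ≤ count A → suc j ≤ count T → t ∈ T → ∃ λ u → u ∈ T × Path (A ∪ T) u t (j + j)
  core-path zero    A T t co la lt mt = t , mt , stop (inj₂ mt)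
  core-path (suc j) A T t co la lt mt
    with count-elem A (≤-trans (s≤s z≤n) la) | count-two T (≤-trans (s≤s (s≤s z≤n)) lt) t
  ... | a , ma | t₂ , mt₂ , ne
    with core-path j (A ⊖ a) (T ⊖ t) t₂ (λ x y mx my → co x y (proj₁ mx) (proj₁ my))
           (s≤s⁻¹ (≤-trans la (count-⊖ A a))) (s≤s⁻¹ (≤-trans lt (count-⊖ T t))) (mt₂ , ne)
  ... | u , (mu , _) , p = u , mu , subst (Path (A ∪ T) u t) (cong suc (trans (+-comm (j + j) 1) (sym (+-suc j j))))
        (path-concat {B = ⁅ a ⁆ ∪ ⁅ t ⁆} s₁ s₂ d p (~-sym (co a t₂ ma mt₂))
          (step (inj₁ refl) (co a t ma mt) (stop (inj₂ refl , λ { refl → dj t ma mt }))))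
    where
    dj : Disjoint A T
    dj = Complete-disjoint A T co
    s₁ : ((A ⊖ a) ∪ (T ⊖ t)) ⊆ (A ∪ T)
    s₁ z (inj₁ (m , _)) = inj₁ m
    s₁ z (inj₂ (m , _)) = inj₂ m
    s₂ : (⁅ a ⁆ ∪ ⁅ t ⁆) ⊆ (A ∪ T)
    s₂ z (inj₁ refl) = inj₁ ma
    s₂ z (inj₂ refl) = inj₂ mt
    d : Disjoint ((A ⊖ a) ∪ (T ⊖ t)) (⁅ a ⁆ ∪ ⁅ t ⁆)
    d z (inj₁ (m , ne)) (inj₁ eq)   = ne eq
    d z (inj₁ (m , ne)) (inj₂ refl) = dj z m mt
    d z (inj₂ (m , ne)) (inj₁ refl) = dj z ma m
    d z (inj₂ (m , ne)) (inj₂ eq)   = ne eq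

  core-path-A : ∀ j A T a → Complete A T → suc j ≤ count A → suc j ≤ count T → a ∈ A →
                ∃ λ u → u ∈ T × Path (A ∪ T) u a (suc (j + j))
  core-path-A j A T a co la lt ma with count-elem T (≤-trans (s≤s z≤n) lt)
  ... | t , mt with core-path j (A ⊖ a) T t (λ x y mx my → co x y (proj₁ mx) my) (s≤s⁻¹ (≤-trans la (count-⊖ A a))) lt mt
  ...   | u , mu , p = u , mu , subst (Path (A ∪ T) u a) (cong suc (+-identityʳ (j + j)))
          (path-concat {B = ⁅ a ⁆} s₁ (λ { z refl → inj₁ ma }) d p (~-sym (co a t ma mt)) (stop refl))
    where
    s₁ : ((A ⊖ a) ∪ T) ⊆ (A ∪ T)
    s₁ z (inj₁ (m , _)) = inj₁ m
    s₁ z (inj₂ m)       = inj₂ m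
    d : Disjoint ((A ⊖ a) ∪ T) ⁅ a ⁆
    d z (inj₁ (m , ne)) eq   = ne eq
    d z (inj₂ m)        refl = Complete-disjoint A T co z ma m

  Evens : ℕ → ℕ → Set
  Evens J b = ∃ λ j → j ≤ J × b ≡ j + j

  Evens-span : ∀ J → Span (Evens J) (J + J)
  Evens-span J = alt 0 J ≤-refl (λ i l → i , l , refl)

  -- What a contracted head `H` must deliver: for every entry `u` of the remaining problem the same
  -- `J + 1` lengths. This independence of `u` is what makes the lengths of the two stages a full
  -- sumset.
  Heads : VSet → VSet → VSet → ℕ → ℕ → Set
  Heads H S S′ h J = ∀ u → u ∈ S′ → ∀ j → j ≤ J → ∃ λ s → ∃ λ z → s ∈ S × z ~ u × Path H s z (h + (j + j))

  Heads-T : ∀ {S} A T J → T ⊆ S → Complete A T → J ≤ count A → suc J ≤ count T → Heads (A ∪ T) S N[ T ] 0 J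
  Heads-T A T J ts co la lt u (t , mt , e) j l with core-path j A T t co (≤-trans l la) (≤-trans (s≤s l) lt) mt
  ... | s , ms , p = s , t , ts s ms , e , p

  Heads-A : ∀ {S} A T J → T ⊆ S → Complete A T → suc J ≤ count A → suc J ≤ count T → Heads (A ∪ T) S N[ A ] 1 J
  Heads-A A T J ts co la lt u (a , ma , e) j l with core-path-A j A T a co (≤-trans (s≤s l) la) (≤-trans (s≤s l) lt) ma
  ... | s , ms , p = s , a , ts s ms , e , p

  head-span : ∀ {H K S S′ Y h J e} → Heads H S S′ h J → Disjoint H K → Span (Lens K S′ Y) e → Span (Lens (H ∪ K) S Y) (J + J + e)
  head-span {H} {K} {S} {S′} {Y} {h} {J} hd d sp =
    Span-map {L = λ ℓ → Lens (H ∪ K) S Y (suc h + ℓ)} (suc h) (λ ℓ x → x) (Span-+ f (Evens-span J) sp)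
    where
    f : ∀ a b → Evens J a → Lens K S′ Y b → Lens (H ∪ K) S Y (suc h + (a + b))
    f a b (j , l , refl) (lens su ry p) with hd _ su j l
    ... | s , z , ms , e , q = lens ms ry (subst (Path _ _ _) (cong suc (+-assoc h (j + j) b)) (path-concat (λ z → inj₁) (λ z → inj₂) d q e p))

  Deg : VSet → VSet → VSet → ℕ → Set
  Deg W S R e = ∀ v → v ∈ W → suc (suc e) ≤ deg W v + [ S ]ι v + [ R ]ι v

  Main : VSet → Set₁
  Main W = ∀ e S R → Conn W S R → Deg W S R e → Span (Lens W S R) e

  Conn-span0 : ∀ {W S R} → Conn W S R → Span (Lens W S R) 0
  Conn-span0 co with source co | target co
  ... | s , ms , ss | r , mr , rr with walk→path (connected co s r ms mr)
  ...   | ℓ , p = Span-0 ℓ (lens ss rr p)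

  -- Once `d` reaches `e`, the truncated difference is 0 and any one path will do; the span then
  -- comes entirely from the part that caused the loss.
  region : ∀ K → Main K → ∀ e d S R → Conn K S R →
           (∀ v → v ∈ K → suc (suc e) ≤ deg K v + [ S ]ι v + [ R ]ι v + d) → Span (Lens K S R) (e ∸ d)
  region K main e d S R co dg with e ∸ d in eq
  ... | zero  = Conn-span0 co
  ... | suc m = main (suc m) S R co (λ v mv → +-cancelʳ-≤ d _ _ (≤-trans (≤-reflexive (cong (λ x → suc (suc x)) h)) (dg v mv)))
    where
    h : suc m + d ≡ e
    h = trans (cong (_+ d) (sym eq)) (m∸n+n≡m {e} {d} (<⇒≤ (m∸n≢0⇒n<m (λ z → 0≢1+n (trans (sym z) eq)))))

  -- Paths whose lengths span e

  exit-to : ∀ {X u z} K → Walk X u z → u ∈ K → ¬ z ∈ K →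
            ∃ λ y → ∃ λ y′ → Walk (X ∩ K) u y × y ∈ K × y ~ y′ × y′ ∈ X × ¬ y′ ∈ K
  exit-to K w k ¬k with exit K w k
  ... | inj₁ w′ = ⊥-elim (¬k (proj₂ (walk-end w′)))
  ... | inj₂ (y , y′ , w′ , r) = y , y′ , w′ , proj₂ (walk-end w′) , r

  restrict : ∀ W K {v u y} → Walk ((W ⊖ v) ∩ K) u y → Walk (K ⊖ v) u y
  restrict W K = walk-mono (λ { x ((_ , nx) , k) → k , nx })

  Lens-join : ∀ {W S R A B a x y} → A ⊆ W → B ⊆ W → Disjoint A B → a ∈ W → ¬ a ∈ A → ¬ a ∈ B →
              Lens A S (N a) x → Lens B (N a) R y → Lens W S R (2 + (x + y))
  Lens-join {W} {A = A} {B} {a} {x} {y} aw bw d ma ¬a ¬b (lens s e p) (lens e′ r q) =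
    lens s r (subst (Path _ _ _) (cong suc (+-suc x y))
      (path-concat {B = ⁅ a ⁆ ∪ B} aw sub dis p (~-sym e) (step (inj₁ refl) e′ (path-mono (λ z b → inj₂ b , λ { refl → ¬b b }) q))))
    where
    sub : (⁅ a ⁆ ∪ B) ⊆ W
    sub z (inj₁ refl) = ma
    sub z (inj₂ b)    = bw z b
    dis : Disjoint A (⁅ a ⁆ ∪ B)
    dis z m (inj₁ refl) = ¬a m
    dis z m (inj₂ b)    = d z m b

  record TwoConn (W S R : VSet) : Set where
    field
      nocut : ∀ v u u′ → v ∈ W → u ∈ (W ⊖ v) → u′ ∈ (W ⊖ v) → Walk (W ⊖ v) u u′
      toS   : ∀ v u → v ∈ W → u ∈ (W ⊖ v) → ∃ λ s → Walk (W ⊖ v) u s × s ∈ S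
      toR   : ∀ v u → v ∈ W → u ∈ (W ⊖ v) → ∃ λ r → Walk (W ⊖ v) u r × r ∈ R
  open TwoConn public

  TwoConn-flip : ∀ {W S R} → TwoConn W S R → TwoConn W R S
  TwoConn-flip t = record { nocut = nocut t ; toS = toR t ; toR = toS t }

  -- Dead ends and cut vertices of `W`

  module Reduce (W : VSet) (IH : ∀ K → count K < count W → Main K) (e : ℕ) (2≤e : 2 ≤ e) where

    dead : ∀ {S R} → Conn W S R → Deg W S R e → ∀ {v u} → v ∈ W → u ∈ W → u ≢ v →
           (∀ z → z ∈ C (W ⊖ v) u → ¬ z ∈ R) → Span (Lens W S R) e
    dead {S} {R} co dg {v} mv mu ne noR with lift
      where open DeadEnd co mv mu ne noR
    ... | t , f = Span-map t f (IH K smaller e S (N v) connK (λ w k → ≤-trans (dg w (K⊆W w k)) (degK w k)))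
      where open DeadEnd co mv mu ne noR

    Deg-flip : ∀ {S R} → Deg W S R e → Deg W R S e
    Deg-flip {S} {R} dg v m = ≤-trans (dg v m) (≤-reflexive (trans (+-assoc (deg W v) _ _)
      (trans (cong (deg W v +_) (+-comm ([ S ]ι v) ([ R ]ι v))) (sym (+-assoc (deg W v) _ _)))))

    piece-conn : ∀ {a u} X → Connected W → a ∈ W → u ∈ (W ⊖ a) →
                 (∀ v u → v ∈ W → u ∈ (W ⊖ v) → ∃ λ s → Walk (W ⊖ v) u s × s ∈ X) → Conn (C (W ⊖ a) u) X (N a)
    piece-conn {a} {u} X co ma mu toX = record { connected = C-connected (W ⊖ a) u ; source = toX a u ma mu ; target = tgt ; cut = ct }
      where
      K : VSet
      K = C (W ⊖ a) u
      sub : ∀ z → z ∈ K → z ∈ W × z ≢ a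
      sub = C⊆ (W ⊖ a) u
      is-a : ∀ {y y′} → y ∈ K → y ~ y′ → y′ ∈ W → ¬ y′ ∈ K → y′ ≡ a
      is-a {y} {y′} k e m ¬k with y′ ≟ a
      ... | yes eq = eq
      ... | no ne  = ⊥-elim (¬k (C-closed (W ⊖ a) u k e (m , ne)))
      tgt : ∃ λ r → r ∈ K × a ~ r
      tgt with exit-to K (co u a (proj₁ mu) ma) (stop mu) (λ k → proj₂ (sub a k) refl)
      ... | y , y′ , w , k , e , m , ¬k with is-a k e m ¬k
      ...   | refl = y , k , ~-sym e
      ct : ∀ v u′ → v ∈ K → u′ ∈ K → u′ ≢ v → ∃ λ z → Walk (K ⊖ v) u′ z × (z ∈ X ⊎ a ~ z)
      ct v u′ kv ku ne with toX v u′ (proj₁ (sub v kv)) (proj₁ (sub u′ ku) , ne)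
      ... | s , w , sx with exit K w ku
      ...   | inj₁ w′ = s , restrict W K w′ , inj₁ sx
      ...   | inj₂ (y , y′ , w′ , e , (m , _) , ¬k) with is-a (proj₂ (walk-end w′)) e m ¬k
      ...     | refl = y , restrict W K w′ , inj₂ (~-sym e)

    -- Every component of `W ⊖ a` sees both roots. Going from `S` to `a` through one of them loses
    -- the edge to the second root, which leaves `e ∸ 1`. From `a` to `R` through another one an
    -- edge is lost too, but degree 3 remains and two lengths restore the missing unit.
    cut-vertex : ∀ {S R} → Conn W S R → Deg W S R e →
      (∀ v u → v ∈ W → u ∈ (W ⊖ v) → ∃ λ s → Walk (W ⊖ v) u s × s ∈ S) →
      (∀ v u → v ∈ W → u ∈ (W ⊖ v) → ∃ λ r → Walk (W ⊖ v) u r × r ∈ R) →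
      ∀ a u u′ → a ∈ W → u ∈ (W ⊖ a) → u′ ∈ (W ⊖ a) → ¬ Walk (W ⊖ a) u u′ → Span (Lens W S R) e
    cut-vertex {S} {R} co dg tS tR a u u′ ma mu mu′ ¬w =
      Span-≤ (≤-reflexive (sym (m∸n+n≡m (≤-trans (s≤s z≤n) 2≤e))))
        (Span-map {L = λ ℓ → Lens W S R (2 + ℓ)} 2 (λ ℓ x → x) (Span-+ (λ x y p q → Lens-join sub₁ sub₂ dj ma a∉₁ a∉₂ p q) sp₁ sp₂))
      where
      K₁ K₂ : VSet
      K₁ = C (W ⊖ a) u
      K₂ = C (W ⊖ a) u′
      sub₁ : K₁ ⊆ W
      sub₁ z k = proj₁ (walk-end k)
      sub₂ : K₂ ⊆ W
      sub₂ z k = proj₁ (walk-end k)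
      a∉₁ : ¬ a ∈ K₁
      a∉₁ k = proj₂ (walk-end k) refl
      a∉₂ : ¬ a ∈ K₂
      a∉₂ k = proj₂ (walk-end k) refl
      dj : Disjoint K₁ K₂
      dj z k k′ = ¬w (walk-++ k (walk-rev k′))
      degC : ∀ x w → w ∈ C (W ⊖ a) x → deg W w ≤ deg (C (W ⊖ a) x) w + [ N a ]ι w
      degC x w k = deg-∪₁ W (C (W ⊖ a) x) a w h
        where
        h : ∀ z → w ~ z → z ∈ W → z ∈ C (W ⊖ a) x ⊎ z ≡ a
        h z e m with z ≟ a
        ... | yes eq = inj₂ eq
        ... | no ne  = inj₁ (C-closed (W ⊖ a) x k e (m , ne))
      sp₁ : Span (Lens K₁ S (N a)) (e ∸ 1)
      sp₁ = region K₁ (IH K₁ (count-< K₁ W sub₁ a ma a∉₁)) e 1 S (N a) (piece-conn S (connected co) ma mu tS) h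
        where
        h : ∀ v → v ∈ K₁ → suc (suc e) ≤ deg K₁ v + [ S ]ι v + [ N a ]ι v + 1
        h v k = begin
          suc (suc e)                            ≤⟨ dg v (sub₁ v k) ⟩
          deg W v + [ S ]ι v + [ R ]ι v          ≤⟨ +-mono-≤ (+-monoˡ-≤ ([ S ]ι v) (degC u v k)) (ι≤1 (mem? R v)) ⟩
          deg K₁ v + [ N a ]ι v + [ S ]ι v + 1   ≡⟨ cong (_+ 1) (trans (+-assoc (deg K₁ v) _ _) (trans (cong (deg K₁ v +_) (+-comm ([ N a ]ι v) _)) (sym (+-assoc (deg K₁ v) _ _)))) ⟩
          deg K₁ v + [ S ]ι v + [ N a ]ι v + 1   ∎
          where open ≤-Reasoning
      sp₂ : Span (Lens K₂ (N a) R) 1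
      sp₂ = two-lengths K₂ (N a) R a (Conn-flip (piece-conn R (connected co) ma mu′ tR)) h (u′ , stop mu′ , proj₂ mu′)
        where
        h : ∀ v → v ∈ K₂ → v ≢ a → 3 ≤ deg K₂ v + [ N a ]ι v + [ R ]ι v
        h v k _ = +-cancelʳ-≤ 1 3 _ (begin
          4                                      ≤⟨ s≤s (s≤s 2≤e) ⟩
          suc (suc e)                            ≤⟨ dg v (sub₂ v k) ⟩
          deg W v + [ S ]ι v + [ R ]ι v          ≤⟨ +-monoˡ-≤ ([ R ]ι v) (+-mono-≤ (degC u′ v k) (ι≤1 (mem? S v))) ⟩
          deg K₂ v + [ N a ]ι v + 1 + [ R ]ι v   ≡⟨ trans (+-assoc (deg K₂ v + [ N a ]ι v) 1 _) (trans (cong (deg K₂ v + [ N a ]ι v +_) (+-comm 1 _)) (sym (+-assoc (deg K₂ v + [ N a ]ι v) _ 1))) ⟩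
          deg K₂ v + [ N a ]ι v + [ R ]ι v + 1   ∎)
          where open ≤-Reasoning

    reach : ∀ {S R} → Conn W S R → Deg W S R e →
      Span (Lens W S R) e ⊎ (∀ v u → v ∈ W → u ∈ (W ⊖ v) → ∃ λ r → Walk (W ⊖ v) u r × r ∈ R)
    reach {S} {R} co dg with any? (λ v → any? (λ u → mem? W v ×-dec mem? (W ⊖ v) u ×-dec all? (λ z → walk? (W ⊖ v) u z →-dec ¬? (mem? R z))))
    ... | yes (v , u , mv , (mu , ne) , noR) = inj₁ (dead co dg mv mu ne noR)
    ... | no none = inj₂ f
      where
      f : ∀ v u → v ∈ W → u ∈ (W ⊖ v) → ∃ λ r → Walk (W ⊖ v) u r × r ∈ R
      f v u mv mu with any? (λ z → walk? (W ⊖ v) u z ×-dec mem? R z)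
      ... | yes p = p
      ... | no ¬p = ⊥-elim (none (v , u , mv , mu , λ z w r → ¬p (z , w , r)))

    two-conn : ∀ {S R} → Conn W S R → Deg W S R e → Span (Lens W S R) e ⊎ TwoConn W S R
    two-conn {S} {R} co dg with reach co dg | reach (Conn-flip co) (Deg-flip {S} {R} dg)
    ... | inj₁ sp | _       = inj₁ sp
    ... | inj₂ _  | inj₁ sp = inj₁ (Span-map 0 Lens-flip sp)
    ... | inj₂ tR | inj₂ tS
      with any? (λ v → any? (λ u → any? (λ u′ → mem? W v ×-dec mem? (W ⊖ v) u ×-dec mem? (W ⊖ v) u′ ×-dec ¬? (walk? (W ⊖ v) u u′))))
    ...   | yes (v , u , u′ , mv , mu , mu′ , ¬w) = inj₁ (cut-vertex co dg tS tR v u u′ mv mu mu′ ¬w)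
    ...   | no none = inj₂ (record { nocut = nc ; toS = tS ; toR = tR })
      where
      nc : ∀ v u u′ → v ∈ W → u ∈ (W ⊖ v) → u′ ∈ (W ⊖ v) → Walk (W ⊖ v) u u′
      nc v u u′ mv mu mu′ with walk? (W ⊖ v) u u′
      ... | yes w = w
      ... | no ¬w = ⊥-elim (none (v , u , u′ , mv , mu , mu′ , ¬w))

  Lens-prepend-path : ∀ {W S R K B c s m} → K ⊆ W → B ⊆ W → Disjoint K B → Path B s c m → s ∈ S →
                ∀ ℓ → Lens K (N c) R ℓ → Lens W S R (suc m + ℓ)
  Lens-prepend-path kw bw d q ms ℓ x = Lens-flip _ (Lens-append kw bw d (path-rev q) ms ℓ (Lens-flip _ x))

  count-≥2 : ∀ A a b → a ∈ A → b ∈ A → a ≢ b → 2 ≤ count A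
  count-≥2 A a b ma mb ne = ≤-trans (s≤s (count≥1 (A ⊖ a) b (mb , λ eq → ne (sym eq))))
    (count-< (A ⊖ a) A (λ z → proj₁) a ma (λ k → proj₂ k refl))

  -- Locally maximal cores

  -- The common neighbourhood, within `W`, of `A` and the first root.
  common : VSet → VSet → VSet → VSet
  common W S A = vset (λ z → z ∈ W × z ∈ S × (∀ a → a ∈ A → a ~ z))
                      (λ z → mem? W z ×-dec mem? S z ×-dec all? (λ a → mem? A a →-dec (a ~? z)))

  -- The root x and A form one part of the core, common W S A the other.
  record MaxCore (W S : VSet) : Set₁ where
    field
      A    : VSet
      A⊆   : A ⊆ W
      size : suc (count A) ≤ count (common W S A)
      max  : ∀ w → w ∈ W → ¬ w ∈ A → deg (common W S A) w ≤ suc (count A)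

  -- A vertex that violates `max` joins `A`, and `T` shrinks to its neighbours there; there are
  -- enough of them to keep `size`. Vertices of `T` may join as well, so `max` also bounds the edges
  -- inside `T`.
  grow : ∀ f W S A → A ⊆ W → suc (count A) ≤ count (common W S A) → count W ≤ f + count A → MaxCore W S
  grow f W S A A⊆ sz l with any? (λ w → mem? W w ×-dec ¬? (mem? A w) ×-dec (suc (suc (count A)) ≤? deg (common W S A) w))
  ... | no none = record { A = A ; A⊆ = A⊆ ; size = sz ; max = λ w mw ¬a → s≤s⁻¹ (≰⇒> (λ x → none (w , mw , ¬a , x))) }
  grow zero W S A A⊆ sz l | yes (w , mw , ¬a , _) = ⊥-elim (<-irrefl refl (≤-trans (count-< A W A⊆ w mw ¬a) l))
  grow (suc f) W S A A⊆ sz l | yes (w , mw , ¬a , big) =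
    grow f W S (A ∪ ⁅ w ⁆) sub (≤-trans (s≤s up) (≤-trans big (count-mono (N w ∩ common W S A) (common W S (A ∪ ⁅ w ⁆)) inc)))
      (≤-trans l (≤-trans (≤-reflexive (sym (+-suc f (count A)))) (+-monoʳ-≤ f (count-< A (A ∪ ⁅ w ⁆) (λ z → inj₁) w (inj₂ refl) ¬a))))
    where
    sub : (A ∪ ⁅ w ⁆) ⊆ W
    sub z (inj₁ a)    = A⊆ z a
    sub z (inj₂ refl) = mw
    up : count (A ∪ ⁅ w ⁆) ≤ suc (count A)
    up = ≤-trans (count-∪₁ (A ∪ ⁅ w ⁆) A w (yes refl) (λ z m → m) (λ _ → refl {x = w})) (≤-reflexive (+-comm (count A) 1))
    inc : (N w ∩ common W S A) ⊆ common W S (A ∪ ⁅ w ⁆)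
    inc z (e , mz , sz , h) = mz , sz , λ { a (inj₁ m) → h a m ; a (inj₂ refl) → e }

  ∅ : VSet
  ∅ = vset (λ _ → ⊥) (λ _ → no (λ ()))

  max-core : ∀ W S → (∃ λ s → s ∈ W × s ∈ S) → MaxCore W S
  max-core W S (s , ms , ss) = grow (count W) W S ∅ (λ z ())
    (≤-trans (≤-reflexive (cong suc (count-∅ ∅ (λ z ())))) (count≥1 (common W S ∅) s (ms , ss , λ a ()))) (m≤m+n (count W) (count ∅))

  ZeroOne : ℕ → Set
  ZeroOne b = b ≡ 0 ⊎ b ≡ 1

  ZeroOne-span : Span ZeroOne 1
  ZeroOne-span = Span-diff1 0 (inj₁ refl) (inj₂ refl)

  -- What the first root leaves unsettled: the second root sees only the core, and there either only
  -- `T`, which has the least size that `size` allows, or only `A`.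
  record Escape (W S R : VSet) : Set₁ where
    field
      core : MaxCore W S
    open MaxCore core public
    T : VSet
    T = common W S A
    field
      where-R : ((∀ r → r ∈ W → r ∈ R → r ∈ T) × count T ≤ suc (count A)) ⊎ (∀ r → r ∈ W → r ∈ R → r ∈ A)

  -- Pieces that hang on a core or on a 2-cut

  module Reduced (W : VSet) (IH : ∀ K → count K < count W → Main K) (e : ℕ) (2≤e : 2 ≤ e)
                 (S R : VSet) (co : Conn W S R) (dg : Deg W S R e) (tc : TwoConn W S R) where

    -- `K` is attached to `a`, to `c` and to the first root. Passing through `K` to `a` loses the
    -- edge to `c`; two lengths from `a` to `R` outside `K` make up for it. There degree 3 survives
    -- except at `c`, whose neighbours in `K` are gone.
    module TwoCut (K : VSet) (K⊆ : K ⊆ W) (conK : Connected K) (a c : V) (ma : a ∈ W) (mc : c ∈ W) (a≢c : a ≢ c)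
                  (¬a : ¬ a ∈ K) (¬c : ¬ c ∈ K)
                  (closed : ∀ w z → w ∈ K → w ~ z → z ∈ W → z ∈ K ⊎ z ≡ a ⊎ z ≡ c)
                  (noR : ∀ z → z ∈ K → ¬ z ∈ R) (s₀ : V) (ks : s₀ ∈ K) (ss : s₀ ∈ S) where

      c≢a : c ≢ a
      c≢a eq = a≢c (sym eq)

      touches-a : ∃ λ y → y ∈ K × a ~ y
      touches-a with exit-to K (nocut tc c s₀ a mc (K⊆ s₀ ks , λ { refl → ¬c ks }) (ma , a≢c)) ks ¬a
      ... | y , y′ , w , k , f , (m , ne) , ¬k with closed y y′ k f m
      ...   | inj₁ k′          = ⊥-elim (¬k k′)
      ...   | inj₂ (inj₁ refl) = y , k , ~-sym f
      ...   | inj₂ (inj₂ eq)   = ⊥-elim (ne eq)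

      away : ∀ y z → y ∈ (W ⊖ a) → ¬ y ∈ K → y ≢ c → z ∈ K → z ∈ (W ⊖ a) → y ~ z → ⊥
      away y z (my , na) ¬k nc kz _ f with closed z y kz (~-sym f) my
      ... | inj₁ k         = ¬k k
      ... | inj₂ (inj₁ eq) = na eq
      ... | inj₂ (inj₂ eq) = nc eq

      to-c : ∀ y → y ∈ (W ⊖ a) → ¬ y ∈ K → Walk ((W ⊖ a) ∖ K) y c
      to-c y my ¬k = bypass K (nocut tc a y c ma my (mc , c≢a)) ¬k away

      degK : ∀ w → w ∈ K → suc (suc e) ≤ deg K w + [ S ]ι w + [ N a ]ι w + [ N c ]ι w
      degK w k with dg w (K⊆ w k)
      ... | l rewrite ι-no (mem? R w) (noR w k) = begin
        suc (suc e)                                ≤⟨ l ⟩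
        deg W w + [ S ]ι w + 0                     ≡⟨ +-identityʳ _ ⟩
        deg W w + [ S ]ι w                         ≤⟨ +-monoˡ-≤ ([ S ]ι w) (deg-∪₁ W (K ∪ ⁅ a ⁆) c w h) ⟩
        deg (K ∪ ⁅ a ⁆) w + [ N c ]ι w + [ S ]ι w  ≤⟨ +-monoˡ-≤ ([ S ]ι w) (+-monoˡ-≤ ([ N c ]ι w) (deg-∪₁ (K ∪ ⁅ a ⁆) K a w (λ z _ m → m))) ⟩
        deg K w + [ N a ]ι w + [ N c ]ι w + [ S ]ι w ≡⟨ rearr (deg K w) ([ N a ]ι w) ([ N c ]ι w) ([ S ]ι w) ⟩
        deg K w + [ S ]ι w + [ N a ]ι w + [ N c ]ι w ∎
        where
        open ≤-Reasoning
        h : ∀ z → w ~ z → z ∈ W → z ∈ (K ∪ ⁅ a ⁆) ⊎ z ≡ c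
        h z f m with closed w z k f m
        ... | inj₁ k′        = inj₁ (inj₁ k′)
        ... | inj₂ (inj₁ eq) = inj₁ (inj₂ eq)
        ... | inj₂ (inj₂ eq) = inj₂ eq
        rearr : ∀ x p q s → x + p + q + s ≡ x + s + p + q
        rearr x p q s = trans (+-comm (x + p + q) s) (trans (cong (s +_) (+-assoc x p q)) (trans (sym (+-assoc s x (p + q)))
          (trans (sym (+-assoc (s + x) p q)) (cong (λ t → t + p + q) (+-comm s x)))))

      smallerK : count K < count W
      smallerK = count-< K W K⊆ a ma ¬a

      via-a : Conn K S (N a) → ∀ t t′ → t ∈ W → t′ ∈ W → ¬ t ∈ K → ¬ t′ ∈ K → a ~ t → a ~ t′ → t ≢ t′ → Span (Lens W S R) e
      via-a coK t t′ mt mt′ ¬t ¬t′ f f′ ne =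
        Span-≤ (≤-reflexive (sym (m∸n+n≡m (≤-trans (s≤s z≤n) 2≤e))))
          (Span-map {L = λ ℓ → Lens W S R (2 + ℓ)} 2 (λ ℓ x → x)
            (Span-+ (λ x y p q → Lens-join K⊆ (λ z m → proj₁ (proj₁ m)) (λ z k m → proj₂ (proj₁ m) k) ma ¬a (λ m → proj₂ m refl) p q) sp₁ sp₂))
        where
        sp₁ : Span (Lens K S (N a)) (e ∸ 1)
        sp₁ = region K (IH K smallerK) e 1 S (N a) coK
                (λ v k → ≤-trans (degK v k) (+-monoʳ-≤ _ (ι≤1 (mem? (N c) v))))
        M : VSet
        M = (W ∖ K) ⊖ a
        conM : Connected M
        conM u v (( mu , ¬u) , nu) ((mv , ¬v) , nv) = walk-mono (λ { z ((x , y) , k) → (x , k) , y })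
          (walk-++ (to-c u (mu , nu) ¬u) (walk-rev (to-c v (mv , nv) ¬v)))
        -- Without `K`, a piece may be stranded whose way out led through `K`. Such a piece contains
        -- `c`, since away from `a` nothing but `c` borders on `K`; this is what the pruning asks
        -- for.
        ctM : ∀ v u → v ∈ M → u ∈ M → u ≢ v → ∃ λ z → Walk (M ⊖ v) u z × (z ∈ N a ⊎ z ∈ R ⊎ z ≡ c)
        ctM v u mv mu ne with toR tc v u (proj₁ (proj₁ mv)) (proj₁ (proj₁ mu) , ne)
        ... | r , w , rr with exit M w mu
        ...   | inj₁ w′ = r , restrict W M w′ , inj₂ (inj₁ rr)
        ...   | inj₂ (y , y′ , w′ , g , (my′ , _) , ¬m) = y , restrict W M w′ , fin
          where
          y∈ : y ∈ M
          y∈ = proj₂ (walk-end w′)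
          fin : a ~ y ⊎ y ∈ R ⊎ y ≡ c
          fin with y′ ≟ a
          ... | yes refl = inj₁ (~-sym g)
          ... | no ny with mem? K y′
          ...   | no ¬k = ⊥-elim (¬m ((my′ , ¬k) , ny))
          ...   | yes k with closed y′ y k (~-sym g) (proj₁ (proj₁ y∈))
          ...     | inj₁ ky        = ⊥-elim (proj₂ (proj₁ y∈) ky)
          ...     | inj₂ (inj₁ eq) = ⊥-elim (proj₂ y∈ eq)
          ...     | inj₂ (inj₂ eq) = inj₂ (inj₂ eq)
        dgM : ∀ v → v ∈ M → v ≢ c → 3 ≤ deg M v + [ N a ]ι v + [ R ]ι v
        dgM v ((mv , ¬v) , nv) nc = +-cancelʳ-≤ 1 3 _ (begin
          4                                      ≤⟨ s≤s (s≤s 2≤e) ⟩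
          suc (suc e)                            ≤⟨ dg v mv ⟩
          deg W v + [ S ]ι v + [ R ]ι v          ≤⟨ +-monoˡ-≤ ([ R ]ι v) (+-mono-≤ (deg-∪₁ W M a v h) (ι≤1 (mem? S v))) ⟩
          deg M v + [ N a ]ι v + 1 + [ R ]ι v    ≡⟨ trans (+-assoc (deg M v + [ N a ]ι v) 1 _) (trans (cong (deg M v + [ N a ]ι v +_) (+-comm 1 _)) (sym (+-assoc (deg M v + [ N a ]ι v) _ 1))) ⟩
          deg M v + [ N a ]ι v + [ R ]ι v + 1    ∎)
          where
          open ≤-Reasoning
          h : ∀ z → v ~ z → z ∈ W → z ∈ M ⊎ z ≡ a
          h z g m with z ≟ a
          ... | yes eq = inj₂ eq
          ... | no nz  = inj₁ ((m , λ k → away v z (mv , nv) ¬v nc k (m , nz) g) , nz)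
        sp₂ : Span (Lens M (N a) R) 1
        sp₂ with toR tc a c ma (mc , c≢a)
        ... | r , w , rr = two-lengths-prune (count M) M ≤-refl (N a) R c conM t t′ r
                ((mt , ¬t) , λ eq → ~-irrefl f (sym eq)) ((mt′ , ¬t′) , λ eq → ~-irrefl f′ (sym eq))
                ((proj₁ (walk-end w) , λ k → noR r k rr) , proj₂ (walk-end w)) f f′ ne rr ctM dgM

      -- The part of K cut off by v and c provides all the lengths: x reaches v inside K,
      -- and c reaches R outside K.
      inner : ∀ v u → v ∈ K → u ∈ K → u ≢ v → (∀ z → Walk (K ⊖ v) u z → ¬ z ∈ S × ¬ a ~ z) → Span (Lens W S R) e
      inner v u kv ku ne bad with walk→path headw | toR tc a c ma (mc , c≢a)
        where
        headw : Walk (K ∖ C (K ⊖ v) u) s₀ v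
        headw = bypass (C (K ⊖ v) u) (conK s₀ v ks kv) (λ k → proj₁ (bad s₀ k) ss)
                  (λ y z ky ¬k ny kz _ f → ¬k (C-closed (K ⊖ v) u kz (~-sym f) (ky , ny)))
      ... | m₁ , p₁ | r , w , rr with walk→path (walk-rev (to-c r (walk-end w) (λ k → noR r k rr)))
      ...   | m₂ , p₂ = Span-map (suc m₂) (Lens-append {K = K} K⊆ (λ z m → proj₁ (proj₁ m)) (λ z k m → proj₂ m k) p₂ rr)
                          (Span-map (suc m₁) (Lens-prepend-path (λ z k → proj₁ (walk-end k)) (λ z → proj₁) (λ z k m → proj₂ m k) p₁ ss)
                            (IH K₃ (≤-trans (s≤s (count-mono K₃ K K₃⊆)) smallerK) e (N v) (N c) con₃ deg₃))
        where
        K₃ : VSet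
        K₃ = C (K ⊖ v) u
        K₃⊆ : K₃ ⊆ K
        K₃⊆ z k = proj₁ (walk-end k)
        closed₃ : ∀ w z → w ∈ K₃ → w ~ z → z ∈ W → z ∈ K₃ ⊎ z ≡ v ⊎ z ≡ c
        closed₃ w z k f m with closed w z (K₃⊆ w k) f m | z ≟ v
        ... | _                | yes eq = inj₂ (inj₁ eq)
        ... | inj₁ k′          | no nv  = inj₁ (C-closed (K ⊖ v) u k f (k′ , nv))
        ... | inj₂ (inj₁ refl) | no nv  = ⊥-elim (proj₂ (bad w k) (~-sym f))
        ... | inj₂ (inj₂ eq)   | no nv  = inj₂ (inj₂ eq)
        a∉ : ¬ a ∈ K₃
        a∉ k = ¬a (K₃⊆ a k)
        con₃ : Conn K₃ (N v) (N c)
        con₃ = record { connected = C-connected (K ⊖ v) u ; source = src ; target = tgt ; cut = ct }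
          where
          src : ∃ λ y → y ∈ K₃ × v ~ y
          src with exit-to K₃ (nocut tc c u a mc (K⊆ u ku , λ { refl → ¬c ku }) (ma , a≢c)) (stop (ku , ne)) a∉
          ... | y , y′ , w , k , f , (m , nc) , ¬k with closed₃ y y′ k f m
          ...   | inj₁ k′          = ⊥-elim (¬k k′)
          ...   | inj₂ (inj₁ refl) = y , k , ~-sym f
          ...   | inj₂ (inj₂ eq)   = ⊥-elim (nc eq)
          tgt : ∃ λ y → y ∈ K₃ × c ~ y
          tgt with exit-to K₃ (nocut tc v u a (K⊆ v kv) (K⊆ u ku , ne) (ma , λ { refl → ¬a kv })) (stop (ku , ne)) a∉
          ... | y , y′ , w , k , f , (m , nv) , ¬k with closed₃ y y′ k f m
          ...   | inj₁ k′          = ⊥-elim (¬k k′)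
          ...   | inj₂ (inj₁ eq)   = ⊥-elim (nv eq)
          ...   | inj₂ (inj₂ refl) = y , k , ~-sym f
          ct : ∀ v′ u′ → v′ ∈ K₃ → u′ ∈ K₃ → u′ ≢ v′ → ∃ λ z → Walk (K₃ ⊖ v′) u′ z × (v ~ z ⊎ c ~ z)
          ct v′ u′ kv′ ku′ ne′ with exit-to K₃ (nocut tc v′ u′ a (K⊆ v′ (K₃⊆ v′ kv′)) (K⊆ u′ (K₃⊆ u′ ku′) , ne′)
                                                  (ma , λ { refl → a∉ kv′ })) ku′ a∉
          ... | y , y′ , w , k , f , (m , nc) , ¬k with closed₃ y y′ k f m
          ...   | inj₁ k′          = ⊥-elim (¬k k′)
          ...   | inj₂ (inj₁ refl) = y , restrict W K₃ w , inj₁ (~-sym f)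
          ...   | inj₂ (inj₂ refl) = y , restrict W K₃ w , inj₂ (~-sym f)
        deg₃ : Deg K₃ (N v) (N c) e
        deg₃ w k with dg w (K⊆ w (K₃⊆ w k))
        ... | l rewrite ι-no (mem? R w) (noR w (K₃⊆ w k)) | ι-no (mem? S w) (proj₁ (bad w k)) = begin
          suc (suc e)                        ≤⟨ l ⟩
          deg W w + 0 + 0                    ≡⟨ trans (+-identityʳ _) (+-identityʳ _) ⟩
          deg W w                            ≤⟨ deg-∪₁ W (K₃ ∪ ⁅ v ⁆) c w h ⟩
          deg (K₃ ∪ ⁅ v ⁆) w + [ N c ]ι w    ≤⟨ +-monoˡ-≤ ([ N c ]ι w) (deg-∪₁ (K₃ ∪ ⁅ v ⁆) K₃ v w (λ z _ m → m)) ⟩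
          deg K₃ w + [ N v ]ι w + [ N c ]ι w ∎
          where
          open ≤-Reasoning
          h : ∀ z → w ~ z → z ∈ W → z ∈ (K₃ ∪ ⁅ v ⁆) ⊎ z ≡ c
          h z f m with closed₃ w z k f m
          ... | inj₁ k′        = inj₁ (inj₁ k′)
          ... | inj₂ (inj₁ eq) = inj₁ (inj₂ eq)
          ... | inj₂ (inj₂ eq) = inj₂ eq

      two-cut : ∀ t t′ → t ∈ W → t′ ∈ W → ¬ t ∈ K → ¬ t′ ∈ K → a ~ t → a ~ t′ → t ≢ t′ → Span (Lens W S R) e
      two-cut with classify K S (N a) conK (s₀ , ks , ss) touches-a
      ... | inj₁ coK = via-a coK
      ... | inj₂ (v , u , kv , ku , ne , bad) = λ _ _ _ _ _ _ _ _ _ → inner v u kv ku ne bad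

    module Core (A T : VSet) (A⊆ : A ⊆ W) (T⊆ : T ⊆ W) (T⊆S : T ⊆ S) (full : Complete A T) (A≤T : count A ≤ count T) where

      H : VSet
      H = A ∪ T

      -- A head that ends in `A` varies by `q + q`. A neighbour of `A` has at most `suc q` edges to
      -- `A` and the root and keeps one of them. A vertex that sees the root only loses that edge,
      -- which `q + q` covers if `A` has two vertices; otherwise such vertices have to be excluded,
      -- hence the last hypothesis.
      exit-A : ∀ K Y → Disjoint H K → count K < count W → K ⊆ W → 1 ≤ count A → Conn K N[ A ] Y →
        (∀ w → w ∈ K → deg W w + [ S ]ι w + [ R ]ι w ≤ deg K w + [ Y ]ι w + (deg A w + [ S ]ι w)) →
        (∀ w → w ∈ K → deg A w + [ S ]ι w ≤ count A) → 2 ≤ count A ⊎ (∀ w → w ∈ K → ¬ w ∈ S) →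
        Span (Lens (H ∪ K) S Y) e
      exit-A K Y dj lt K⊆ 1≤ coK dI bd cond =
        Span-≤ (m≤n+m∸n e (q + q)) (head-span {h = 1} (Heads-A {S} A T q T⊆S full qA (≤-trans qA A≤T)) dj
          (region K (IH K lt) e (q + q) N[ A ] Y coK h))
        where
        q : ℕ
        q = count A ∸ 1
        q≡ : suc q ≡ count A
        q≡ = m+[n∸m]≡n 1≤
        qA : suc q ≤ count A
        qA = ≤-reflexive q≡
        [S]≤ : ∀ w → w ∈ K → 2 ≤ count A ⊎ (∀ w → w ∈ K → ¬ w ∈ S) → [ S ]ι w ≤ q + q
        [S]≤ w k (inj₂ noS) = ≤-trans (≤-reflexive (ι-no (mem? S w) (noS w k))) z≤n
        [S]≤ w k (inj₁ 2≤)  = ≤-trans (ι≤1 (mem? S w)) (≤-trans (s≤s⁻¹ (≤-trans 2≤ (≤-reflexive (sym q≡)))) (m≤m+n q q))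
        key : ∀ w → w ∈ K → deg A w + [ S ]ι w ≤ [ N[ A ] ]ι w + (q + q)
        key w k with mem? N[ A ] w
        ... | yes _ = ≤-trans (bd w k) (≤-trans (≤-reflexive (sym q≡)) (s≤s (m≤m+n q q)))
        ... | no ¬m rewrite deg≡0 A w ¬m = [S]≤ w k cond
        h : ∀ w → w ∈ K → suc (suc e) ≤ deg K w + [ N[ A ] ]ι w + [ Y ]ι w + (q + q)
        h w k = begin
          suc (suc e)                                       ≤⟨ dg w (K⊆ w k) ⟩
          deg W w + [ S ]ι w + [ R ]ι w                     ≤⟨ dI w k ⟩
          deg K w + [ Y ]ι w + (deg A w + [ S ]ι w)         ≤⟨ +-monoʳ-≤ (deg K w + [ Y ]ι w) (key w k) ⟩
          deg K w + [ Y ]ι w + ([ N[ A ] ]ι w + (q + q))    ≡⟨ sym (+-assoc (deg K w + [ Y ]ι w) _ _) ⟩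
          deg K w + [ Y ]ι w + [ N[ A ] ]ι w + (q + q)      ≡⟨ cong (_+ (q + q)) (trans (+-assoc (deg K w) _ _) (trans (cong (deg K w +_) (+-comm ([ Y ]ι w) _)) (sym (+-assoc (deg K w) _ _)))) ⟩
          deg K w + [ N[ A ] ]ι w + [ Y ]ι w + (q + q)      ∎
          where open ≤-Reasoning

      module _ (K : VSet) (K⊆ : K ⊆ W) (conK : Connected K) (djA : Disjoint A K) (djT : Disjoint T K)
               (bd : ∀ w → w ∈ K → deg A w + [ S ]ι w ≤ count A) where

        djH : Disjoint H K
        djH z (inj₁ a) k = djA z a k
        djH z (inj₂ t) k = djT z t k

        HK⊆ : (H ∪ K) ⊆ W
        HK⊆ z (inj₁ (inj₁ a)) = A⊆ z a
        HK⊆ z (inj₁ (inj₂ t)) = T⊆ z t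
        HK⊆ z (inj₂ k)        = K⊆ z k

        -- No single vertex separates `K` from `T`, so `K` borders on two different vertices of `A`;
        -- this is the size that `exit-A` needs.
        to-R : (∀ w z → w ∈ K → w ~ z → z ∈ W → z ∈ K ⊎ z ∈ A) → (∃ λ r → r ∈ K × r ∈ R) →
               (∃ λ o → o ∈ T) → Span (Lens W S R) e
        to-R closed (r , kr , rr) (o , mo) with exit-to K (connected co r o (K⊆ r kr) (T⊆ o mo)) kr (λ k → djT o mo k)
        ... | y , y′ , w , k , f , m , ¬k with closed y y′ k f m
        ...   | inj₁ k′ = ⊥-elim (¬k k′)
        ...   | inj₂ a with exit-to K (nocut tc y′ r o m (K⊆ r kr , λ { refl → ¬k kr }) (T⊆ o mo , λ { refl → Complete-disjoint A T full o a mo })) kr (λ k → djT o mo k)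
        ...     | x , x′ , w′ , kx , f′ , (mx , nx) , ¬kx with closed x x′ kx f′ mx
        ...       | inj₁ k′ = ⊥-elim (¬kx k′)
        ...       | inj₂ a′ = Span-map 0 (Lens-mono HK⊆)
                      (exit-A K R djH (count-< K W K⊆ o (T⊆ o mo) (λ k → djT o mo k)) K⊆ (count≥1 A y′ a) coK dI bd
                        (inj₁ (count-≥2 A x′ y′ a′ a nx)))
          where
          coK : Conn K N[ A ] R
          coK = record { connected = conK ; source = y , k , (y′ , a , ~-sym f) ; target = r , kr , rr ; cut = ct }
            where
            ct : ∀ v u → v ∈ K → u ∈ K → u ≢ v → ∃ λ z → Walk (K ⊖ v) u z × (z ∈ N[ A ] ⊎ z ∈ R)
            ct v u kv ku ne with toR tc v u (K⊆ v kv) (K⊆ u ku , ne)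
            ... | r′ , w , rr′ with exit K w ku
            ...   | inj₁ w′ = r′ , restrict W K w′ , inj₂ rr′
            ...   | inj₂ (z , z′ , w′ , g , (mz , _) , ¬z) with closed z z′ (proj₂ (walk-end w′)) g mz
            ...     | inj₁ k′ = ⊥-elim (¬z k′)
            ...     | inj₂ az = z , restrict W K w′ , inj₁ (z′ , az , ~-sym g)
          dI : ∀ w → w ∈ K → deg W w + [ S ]ι w + [ R ]ι w ≤ deg K w + [ R ]ι w + (deg A w + [ S ]ι w)
          dI w kw = begin
            deg W w + [ S ]ι w + [ R ]ι w               ≤⟨ +-monoˡ-≤ ([ R ]ι w) (+-monoˡ-≤ ([ S ]ι w) (deg-∪ W K A w (λ z f m → closed w z kw f m))) ⟩
            deg K w + deg A w + [ S ]ι w + [ R ]ι w     ≡⟨ +-comm (deg K w + deg A w + [ S ]ι w) _ ⟩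
            [ R ]ι w + (deg K w + deg A w + [ S ]ι w)   ≡⟨ cong ([ R ]ι w +_) (+-assoc (deg K w) _ _) ⟩
            [ R ]ι w + (deg K w + (deg A w + [ S ]ι w)) ≡⟨ sym (+-assoc ([ R ]ι w) (deg K w) _) ⟩
            [ R ]ι w + deg K w + (deg A w + [ S ]ι w)   ≡⟨ cong (_+ (deg A w + [ S ]ι w)) (+-comm ([ R ]ι w) (deg K w)) ⟩
            deg K w + [ R ]ι w + (deg A w + [ S ]ι w)   ∎
            where open ≤-Reasoning

        -- `K` is attached to `A` and to `c`: it is crossed from `A` to `c`, and a path from `c` to
        -- `R` is appended. The accounting breaks down only if `K` meets `S` and `A` is a single
        -- vertex, which then forms a 2-cut with `c`.
        module Trouble (c : V) (mc : c ∈ W) (¬c : ¬ c ∈ K) (c∉A : ¬ c ∈ A)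
          (closed : ∀ w z → w ∈ K → w ~ z → z ∈ W → z ∈ K ⊎ z ∈ A ⊎ z ≡ c)
          (noR : ∀ z → z ∈ K → ¬ z ∈ R) (y₀ : V) (ky : y₀ ∈ K) (ey : c ~ y₀)
          (o : V) (mo : o ∈ W) (¬o : ¬ o ∈ K) (o≢c : o ≢ c) where

          y₀≢c : y₀ ≢ c
          y₀≢c refl = ¬c ky

          touches-A : ∃ λ y → ∃ λ a → y ∈ K × a ∈ A × a ~ y
          touches-A with exit-to K (nocut tc c y₀ o mc (K⊆ y₀ ky , y₀≢c) (mo , o≢c)) ky ¬o
          ... | y , y′ , w , k , f , (m , nc) , ¬k with closed y y′ k f m
          ...   | inj₁ k′        = ⊥-elim (¬k k′)
          ...   | inj₂ (inj₁ a)  = y , y′ , k , a , ~-sym f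
          ...   | inj₂ (inj₂ eq) = ⊥-elim (nc eq)

          coK : Conn K N[ A ] (N c)
          coK = record { connected = conK ; source = src touches-A ; target = y₀ , ky , ey ; cut = ct }
            where
            src : (∃ λ y → ∃ λ a → y ∈ K × a ∈ A × a ~ y) → ∃ λ y → y ∈ K × y ∈ N[ A ]
            src (y , a , k , ma , f) = y , k , (a , ma , f)
            ct : ∀ v u → v ∈ K → u ∈ K → u ≢ v → ∃ λ z → Walk (K ⊖ v) u z × (z ∈ N[ A ] ⊎ c ~ z)
            ct v u kv ku ne with exit-to K (nocut tc v u c (K⊆ v kv) (K⊆ u ku , ne) (mc , λ { refl → ¬c kv })) ku ¬c
            ... | y , y′ , w , k , f , (m , _) , ¬k with closed y y′ k f m
            ...   | inj₁ k′          = ⊥-elim (¬k k′)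
            ...   | inj₂ (inj₁ a)    = y , restrict W K w , inj₁ (y′ , a , ~-sym f)
            ...   | inj₂ (inj₂ refl) = y , restrict W K w , inj₂ (~-sym f)

          dI : ∀ w → w ∈ K → deg W w + [ S ]ι w + [ R ]ι w ≤ deg K w + [ N c ]ι w + (deg A w + [ S ]ι w)
          dI w kw rewrite ι-no (mem? R w) (noR w kw) = begin
            deg W w + [ S ]ι w + 0                      ≡⟨ +-identityʳ _ ⟩
            deg W w + [ S ]ι w                          ≤⟨ +-monoˡ-≤ ([ S ]ι w) (deg-∪₁ W (K ∪ A) c w h) ⟩
            deg (K ∪ A) w + [ N c ]ι w + [ S ]ι w       ≤⟨ +-monoˡ-≤ ([ S ]ι w) (+-monoˡ-≤ ([ N c ]ι w) (deg-∪ (K ∪ A) K A w (λ z _ m → m))) ⟩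
            deg K w + deg A w + [ N c ]ι w + [ S ]ι w   ≡⟨ +-assoc (deg K w + deg A w) _ _ ⟩
            deg K w + deg A w + ([ N c ]ι w + [ S ]ι w) ≡⟨ +-interchange (deg K w) (deg A w) ([ N c ]ι w) ([ S ]ι w) ⟩
            deg K w + [ N c ]ι w + (deg A w + [ S ]ι w) ∎
            where
            open ≤-Reasoning
            h : ∀ z → w ~ z → z ∈ W → z ∈ (K ∪ A) ⊎ z ≡ c
            h z f m with closed w z kw f m
            ... | inj₁ k         = inj₁ (inj₁ k)
            ... | inj₂ (inj₁ a)  = inj₁ (inj₂ a)
            ... | inj₂ (inj₂ eq) = inj₂ eq

          through-A : ∀ B {r m} → B ⊆ W → Disjoint (H ∪ K) B → Path B c r m → r ∈ R →
                      2 ≤ count A ⊎ (∀ w → w ∈ K → ¬ w ∈ S) → Span (Lens W S R) e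
          through-A B {m = m} B⊆ djB pB rr h with touches-A
          ... | _ , a , _ , ma , _ = Span-map (suc m) (Lens-append {K = H ∪ K} HK⊆ B⊆ djB pB rr)
                (exit-A K (N c) djH (count-< K W K⊆ c mc ¬c) K⊆ (count≥1 A a ma) coK dI bd h)

          trouble : ∀ B {r m} → B ⊆ W → Disjoint (H ∪ K) B → Path B c r m → r ∈ R →
            (∀ w → w ∈ K → ¬ w ∈ S) ⊎ (∀ a → a ∈ A → ∃ λ t → ∃ λ t′ → t ∈ W × t′ ∈ W × ¬ t ∈ K × ¬ t′ ∈ K × a ~ t × a ~ t′ × t ≢ t′) →
            Span (Lens W S R) e
          trouble B B⊆ djB pB rr (inj₁ noS) = through-A B B⊆ djB pB rr (inj₂ noS)
          trouble B B⊆ djB pB rr (inj₂ two) with any? (λ s → mem? K s ×-dec mem? S s) | 2 ≤? count A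
          ... | no noS | _      = through-A B B⊆ djB pB rr (inj₂ (λ w k s → noS (w , k , s)))
          ... | yes _  | yes 2≤ = through-A B B⊆ djB pB rr (inj₁ 2≤)
          ... | yes (s , ks , ss) | no ¬2 with touches-A
          ...   | _ , a , _ , ma , _ with two a ma
          ...     | t , t′ , mt , mt′ , ¬t , ¬t′ , f , f′ , ne =
            TwoCut.two-cut K K⊆ conK a c (A⊆ a ma) mc (λ { refl → c∉A ma }) (λ k → djA a ma k) ¬c cl noR s ks ss
              t t′ mt mt′ ¬t ¬t′ f f′ ne
            where
            cl : ∀ w z → w ∈ K → w ~ z → z ∈ W → z ∈ K ⊎ z ≡ a ⊎ z ≡ c
            cl w z k g m with closed w z k g m | z ≟ a
            ... | inj₁ k′        | _      = inj₁ k′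
            ... | inj₂ (inj₂ eq) | _      = inj₂ (inj₂ eq)
            ... | inj₂ (inj₁ az) | yes eq = inj₂ (inj₁ eq)
            ... | inj₂ (inj₁ az) | no na  = ⊥-elim (¬2 (count-≥2 A z a az ma na))

    module _ (A T : VSet) (A⊆ : A ⊆ W) (T⊆ : T ⊆ W) (T⊆S : T ⊆ S) (full : Complete A T) (A≤T : count A ≤ count T)
             (D S′ Y : VSet) (D⊆ : D ⊆ W) (conD : Connected D) (djA : Disjoint A D) (djT : Disjoint T D)
             (closed : ∀ w z → w ∈ D → w ~ z → z ∈ W → z ∈ D ⊎ z ∈ A ⊎ (w ∈ S′ ⊎ w ∈ Y))
             (R⊆Y : ∀ z → z ∈ D → z ∈ R → z ∈ Y)
             (bd : ∀ w → w ∈ D → deg A w + [ S ]ι w ≤ count A)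
             (o : V) (mo : o ∈ W) (¬o : ¬ o ∈ D) (X : VSet) (X⊆ : X ⊆ W) (djX : Disjoint (A ∪ T) X)
             (X∩D : ∀ z → z ∈ X → z ∈ D → z ∈ Y) (g r : V) (gD : g ∈ D) (wX : Walk X g r) (rr : r ∈ R)
             (two : (∀ w → w ∈ D → ¬ w ∈ S) ⊎
                    (∀ a → a ∈ A → ∃ λ t → ∃ λ t′ → t ∈ W × t′ ∈ W × ¬ t ∈ D × ¬ t′ ∈ D × a ~ t × a ~ t′ × t ≢ t′)) where

      -- A piece of `D` behind `v` that meets neither `S′` nor `Y` has only `A` and `v` as
      -- neighbours in `W`, so `v` plays the part of `c`. The way from `v` to `R` runs through `D`
      -- to `g` and on through `X`, and misses the piece because `X` meets `D` only in `Y`.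
      bad-piece : BadPiece D S′ Y → Span (Lens W S R) e
      bad-piece (v , u , dv , du , ne , bad) with walk→path tail
        where
        K : VSet
        K = C (D ⊖ v) u
        B : VSet
        B = (D ∖ K) ∪ X
        tail : Walk B v r
        tail = walk-++ (walk-mono (λ z → inj₁) (walk-rev (bypass K (conD g v gD dv) (λ k → proj₂ (bad g k) (X∩D g (walk-start wX) gD))
                  (λ y z dy ¬k ny kz _ f → ¬k (C-closed (D ⊖ v) u kz (~-sym f) (dy , ny)))))) (walk-mono (λ z → inj₂) wX)
      ... | m , p = Core.Trouble.trouble A T A⊆ T⊆ T⊆S full A≤T K (λ z k → D⊆ z (KD z k)) (C-connected (D ⊖ v) u)
                      (λ z a k → djA z a (KD z k)) (λ z t k → djT z t (KD z k)) (λ w k → bd w (KD w k))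
                      v (D⊆ v dv) (λ k → proj₂ (walk-end k) refl) (λ a → djA v a dv) cl (λ z k rz → proj₂ (bad z k) (R⊆Y z (KD z k) rz))
                      (proj₁ touch) (proj₁ (proj₂ touch)) (proj₂ (proj₂ touch))
                      o mo (λ k → ¬o (KD o k)) (λ { refl → ¬o dv }) B B⊆ djB p rr (two′ two)
        where
        K : VSet
        K = C (D ⊖ v) u
        KD : K ⊆ D
        KD z k = proj₁ (walk-end k)
        B : VSet
        B = (D ∖ K) ∪ X
        B⊆ : B ⊆ W
        B⊆ z (inj₁ (d , _)) = D⊆ z d
        B⊆ z (inj₂ x)       = X⊆ z x
        djB : Disjoint ((A ∪ T) ∪ K) B
        djB z (inj₁ (inj₁ a)) (inj₁ (d , _)) = djA z a d
        djB z (inj₁ (inj₂ t)) (inj₁ (d , _)) = djT z t d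
        djB z (inj₂ k)        (inj₁ (_ , n)) = n k
        djB z (inj₁ h)        (inj₂ x)       = djX z h x
        djB z (inj₂ k)        (inj₂ x)       = proj₂ (bad z k) (X∩D z x (KD z k))
        cl : ∀ w z → w ∈ K → w ~ z → z ∈ W → z ∈ K ⊎ z ∈ A ⊎ z ≡ v
        cl w z k f m with closed w z (KD w k) f m | z ≟ v
        ... | _                     | yes eq = inj₂ (inj₂ eq)
        ... | inj₁ d                | no nv  = inj₁ (C-closed (D ⊖ v) u k f (d , nv))
        ... | inj₂ (inj₁ a)         | no nv  = inj₂ (inj₁ a)
        ... | inj₂ (inj₂ (inj₁ s))  | no nv  = ⊥-elim (proj₁ (bad w k) s)
        ... | inj₂ (inj₂ (inj₂ y))  | no nv  = ⊥-elim (proj₂ (bad w k) y)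
        touch : ∃ λ y → y ∈ K × v ~ y
        touch with exit-to K (conD u v du dv) (stop (du , ne)) (λ k → proj₂ (walk-end k) refl)
        ... | y , y′ , w , k , f , m′ , ¬k with y′ ≟ v
        ...   | yes refl = y , k , ~-sym f
        ...   | no nv    = ⊥-elim (¬k (C-closed (D ⊖ v) u k f (m′ , nv)))
        two′ : (∀ w → w ∈ D → ¬ w ∈ S) ⊎
               (∀ a → a ∈ A → ∃ λ t → ∃ λ t′ → t ∈ W × t′ ∈ W × ¬ t ∈ D × ¬ t′ ∈ D × a ~ t × a ~ t′ × t ≢ t′) →
               (∀ w → w ∈ K → ¬ w ∈ S) ⊎
               (∀ a → a ∈ A → ∃ λ t → ∃ λ t′ → t ∈ W × t′ ∈ W × ¬ t ∈ K × ¬ t′ ∈ K × a ~ t × a ~ t′ × t ≢ t′)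
        two′ (inj₁ h) = inj₁ (λ w k → h w (KD w k))
        two′ (inj₂ h) = inj₂ (λ a ma → let (t , t′ , mt , mt′ , ¬t , ¬t′ , rest) = h a ma in
                                         t , t′ , mt , mt′ , (λ k → ¬t (KD t k)) , (λ k → ¬t′ (KD t′ k)) , rest)

    -- One root with its maximal core

    module WithCore (core : MaxCore W S) where
      open MaxCore core

      T : VSet
      T = common W S A

      q : ℕ
      q = count A

      T⊆ : T ⊆ W
      T⊆ z = proj₁

      T⊆S : T ⊆ S
      T⊆S z m = proj₁ (proj₂ m)

      full : Complete A T
      full a t ma mt = proj₂ (proj₂ mt) a ma

      dAT : Disjoint A T
      dAT = Complete-disjoint A T full

      W′ : VSet
      W′ = (W ∖ A) ∖ T

      -- A vertex of `S` outside the core misses some vertex of `A`, since otherwise it would belong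
      -- to `T`; this compensates for its edge to the root.
      bound : ∀ w → w ∈ W′ → deg A w + [ S ]ι w ≤ count A
      bound w ((mw , ¬a) , ¬t) with mem? S w
      ... | no _  = ≤-trans (≤-reflexive (+-identityʳ _)) (deg≤count A w)
      ... | yes s with any? (λ a → mem? A a ×-dec ¬? (a ~? w))
      ...   | no none = ⊥-elim (¬t (mw , s , adjall))
        where
        adjall : ∀ a → a ∈ A → a ~ w
        adjall a ma with a ~? w
        ... | yes f = f
        ... | no ¬f = ⊥-elim (none (a , ma , ¬f))
      ...   | yes (a , ma , ¬f) = ≤-trans (≤-reflexive (+-comm _ 1))
                (count-< (N w ∩ A) A (λ z → proj₂) a ma (λ m → ¬f (~-sym (proj₁ m))))

      module Comp (d : V) (md : d ∈ W′) where
        D : VSet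
        D = C W′ d

        D⊆ : D ⊆ W
        D⊆ z k = proj₁ (proj₁ (walk-end k))

        djA : Disjoint A D
        djA z a k = proj₂ (proj₁ (walk-end k)) a

        djT : Disjoint T D
        djT z t k = proj₂ (walk-end k) t

        djH : Disjoint (A ∪ T) D
        djH z (inj₁ a) k = djA z a k
        djH z (inj₂ t) k = djT z t k

        closed : ∀ w z → w ∈ D → w ~ z → z ∈ W → z ∈ D ⊎ z ∈ A ⊎ z ∈ T
        closed w z k f m with mem? A z | mem? T z
        ... | yes a | _     = inj₂ (inj₁ a)
        ... | no ¬a | yes t = inj₂ (inj₂ t)
        ... | no ¬a | no ¬t = inj₁ (C-closed W′ d k f ((m , ¬a) , ¬t))

        bd : ∀ w → w ∈ D → deg A w + [ S ]ι w ≤ count A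
        bd w k = bound w (walk-end k)

        degT : ∀ w → w ∈ D → deg T w ≤ suc q
        degT w k = max w (D⊆ w k) (proj₂ (proj₁ (walk-end k)))

        degD : ∀ w → w ∈ D → deg W w ≤ deg D w + deg A w + deg T w
        degD w k = ≤-trans (deg-∪ W (D ∪ A) T w h) (+-monoˡ-≤ (deg T w) (deg-∪ (D ∪ A) D A w (λ z _ m → m)))
          where
          h : ∀ z → w ~ z → z ∈ W → z ∈ (D ∪ A) ⊎ z ∈ T
          h z f m with closed w z k f m
          ... | inj₁ x        = inj₁ (inj₁ x)
          ... | inj₂ (inj₁ x) = inj₁ (inj₂ x)
          ... | inj₂ (inj₂ x) = inj₂ x

        two : ∀ a → a ∈ A → ∃ λ t → ∃ λ t′ → t ∈ W × t′ ∈ W × ¬ t ∈ D × ¬ t′ ∈ D × a ~ t × a ~ t′ × t ≢ t′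
        two a ma with count-elem T (≤-trans (s≤s z≤n) size)
        ... | t , mt with count-two T (≤-trans (s≤s (count≥1 A a ma)) size) t
        ...   | t′ , mt′ , ne = t , t′ , T⊆ t mt , T⊆ t′ mt′ , djT t mt , djT t′ mt′ , full a t ma mt , full a t′ ma mt′ , λ eq → ne (sym eq)

        smaller : count D < count W
        smaller with count-elem T (≤-trans (s≤s z≤n) size)
        ... | t , mt = count-< D W D⊆ t (T⊆ t mt) (djT t mt)

      A≤T : count A ≤ count T
      A≤T = ≤-trans (n≤1+n _) size

      -- By `bound` and `max` a vertex of `D` has at most `q + suc q` edges to the root and the
      -- core. Contraction keeps one of them, and the head varies by exactly the `q + q` that is
      -- lost.
      meets-R : ∀ r → r ∈ W′ → r ∈ R → Span (Lens W S R) e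
      meets-R r mr rr with count-elem T (≤-trans (s≤s z≤n) size) | any? (λ z → walk? W′ r z ×-dec mem? N[ T ] z)
      ... | o , mo | no none = Core.to-R A T A⊆ T⊆ T⊆S full A≤T D D⊆ (C-connected W′ r) djA djT bd cl (r , stop mr , rr) (o , mo)
        where
        open Comp r mr
        cl : ∀ w z → w ∈ D → w ~ z → z ∈ W → z ∈ D ⊎ z ∈ A
        cl w z k f m with closed w z k f m
        ... | inj₁ x        = inj₁ x
        ... | inj₂ (inj₁ x) = inj₂ x
        ... | inj₂ (inj₂ t) = ⊥-elim (none (w , k , (z , t , ~-sym f)))
      ... | o , mo | yes (s , ks , ns) with classify D N[ T ] R (C-connected W′ r) (s , ks , ns) (r , stop mr , rr)
        where open Comp r mr
      ...   | inj₂ bad = bad-piece A T A⊆ T⊆ T⊆S full A≤T D N[ T ] R D⊆ (C-connected W′ r) djA djT cl (λ z _ m → m) bd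
                           o (T⊆ o mo) (djT o mo) ⁅ r ⁆ (λ { z refl → proj₁ (proj₁ mr) }) (λ { z h refl → djH z h (stop mr) })
                           (λ { z refl _ → rr }) r r (stop mr) (stop refl) rr (inj₂ two) bad
        where
        open Comp r mr
        cl : ∀ w z → w ∈ D → w ~ z → z ∈ W → z ∈ D ⊎ z ∈ A ⊎ (w ∈ N[ T ] ⊎ w ∈ R)
        cl w z k f m with closed w z k f m
        ... | inj₁ x        = inj₁ x
        ... | inj₂ (inj₁ x) = inj₂ (inj₁ x)
        ... | inj₂ (inj₂ t) = inj₂ (inj₂ (inj₁ (z , t , ~-sym f)))
      ...   | inj₁ coD = Span-≤ (m≤n+m∸n e (q + q)) (Span-map 0 (Lens-mono HD⊆)
                           (head-span {h = 0} (Heads-T {S} A T q T⊆S full ≤-refl size) djH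
                             (region D (IH D smaller) e (q + q) N[ T ] R coD dI)))
        where
        open Comp r mr
        HD⊆ : ((A ∪ T) ∪ D) ⊆ W
        HD⊆ z (inj₁ (inj₁ a)) = A⊆ z a
        HD⊆ z (inj₁ (inj₂ t)) = T⊆ z t
        HD⊆ z (inj₂ k)        = D⊆ z k
        dI : ∀ w → w ∈ D → suc (suc e) ≤ deg D w + [ N[ T ] ]ι w + [ R ]ι w + (q + q)
        dI w k = begin
          suc (suc e)                                      ≤⟨ dg w (D⊆ w k) ⟩
          deg W w + [ S ]ι w + [ R ]ι w                    ≤⟨ +-monoˡ-≤ ([ R ]ι w) (+-monoˡ-≤ ([ S ]ι w) (degD w k)) ⟩
          deg D w + deg A w + deg T w + [ S ]ι w + [ R ]ι w
            ≡⟨ solve 5 (λ d a t s r → d :+ a :+ t :+ s :+ r := d :+ (a :+ s) :+ t :+ r) refl (deg D w) (deg A w) (deg T w) ([ S ]ι w) ([ R ]ι w) ⟩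
          deg D w + (deg A w + [ S ]ι w) + deg T w + [ R ]ι w
            ≤⟨ +-monoˡ-≤ ([ R ]ι w) (+-mono-≤ (+-monoʳ-≤ (deg D w) (bd w k)) (deg-contract T w q (degT w k))) ⟩
          deg D w + q + ([ N[ T ] ]ι w + q) + [ R ]ι w
            ≡⟨ solve 4 (λ d n r q → d :+ q :+ (n :+ q) :+ r := d :+ n :+ r :+ (q :+ q)) refl (deg D w) ([ N[ T ] ]ι w) ([ R ]ι w) q ⟩
          deg D w + [ N[ T ] ]ι w + [ R ]ι w + (q + q)     ∎
          where open ≤-Reasoning

      module AtT (noR′ : ∀ r → r ∈ W′ → ¬ r ∈ R) (t : V) (mt : t ∈ T) (rt : t ∈ R) (big : q + q < e) where

        T₁ : VSet
        T₁ = T ⊖ t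

        A≤T₁ : count A ≤ count T₁
        A≤T₁ = s≤s⁻¹ (≤-trans size (count-⊖ T t))

        full₁ : Complete A T₁
        full₁ a z ma (mz , _) = full a z ma mz

        -- All edges of `t` within `W` stay in the core, so its degree forces `suc q` neighbours in
        -- `T`, and `max` at `t` itself allows no more; hence `e` is at most `q + q + 1`. An edge
        -- inside `T` breaks the bipartition and supplies the odd lengths.
        module Inside (cl : ∀ z → t ~ z → z ∈ W → z ∈ A ⊎ z ∈ T) where

          e≤deg : e ≤ q + deg T t
          e≤deg = s≤s⁻¹ (s≤s⁻¹ (begin
            suc (suc e)                      ≤⟨ dg t (T⊆ t mt) ⟩
            deg W t + [ S ]ι t + [ R ]ι t    ≤⟨ +-mono-≤ (+-mono-≤ (deg-∪ W A T t cl) (ι≤1 (mem? S t))) (ι≤1 (mem? R t)) ⟩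
            deg A t + deg T t + 1 + 1        ≡⟨ trans (+-comm _ 1) (cong suc (+-comm _ 1)) ⟩
            suc (suc (deg A t + deg T t))    ≤⟨ s≤s (s≤s (+-monoˡ-≤ (deg T t) (deg≤count A t))) ⟩
            suc (suc (q + deg T t))          ∎))
            where open ≤-Reasoning

          many : suc q ≤ deg T t
          many = +-cancelˡ-≤ q (suc q) _ (≤-trans (≤-reflexive (+-suc q q)) (≤-trans big e≤deg))

          e≤ : e ≤ q + q + 1
          e≤ = ≤-trans e≤deg (≤-trans (+-monoʳ-≤ q (max t (T⊆ t mt) (λ a → dAT t a mt)))
                 (≤-reflexive (trans (+-suc q q) (+-comm 1 (q + q)))))

          T₁-big : suc q ≤ count T₁
          T₁-big = ≤-trans many (count-mono (N t ∩ T) T₁ (λ z (g , m) → m , λ eq → ~-irrefl g (sym eq)))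
          AT⊆ : (A ∪ T) ⊆ W
          AT⊆ z (inj₁ a) = A⊆ z a
          AT⊆ z (inj₂ x) = T⊆ z x
          AT₁⊆ : (A ∪ T₁) ⊆ W
          AT₁⊆ z (inj₁ a)       = A⊆ z a
          AT₁⊆ z (inj₂ (x , _)) = T⊆ z x
          lengths : ∀ t′ → t ~ t′ → t′ ∈ T → ∀ a b → Evens q a → ZeroOne b → Lens W S R (a + b)
          lengths t′ f mt′ _ _ (j , l , refl) (inj₁ refl) with core-path j A T t full l (≤-trans (s≤s l) size) mt
          ... | u , mu , p = lens (T⊆S u mu) rt (subst (Path _ _ _) (sym (+-identityʳ (j + j))) (path-mono AT⊆ p))
          lengths t′ f mt′ _ _ (j , l , refl) (inj₂ refl) with core-path j A T₁ t′ full₁ l (≤-trans (s≤s l) T₁-big) (mt′ , λ eq → ~-irrefl f (sym eq))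
          ... | u , mu , p = lens (T⊆S u (proj₁ mu)) rt (subst (Path _ _ _) (sym (+-suc (j + j) 0))
                  (path-concat {B = ⁅ t ⁆} AT₁⊆ (λ { z refl → T⊆ t mt }) (λ { z (inj₁ a) refl → dAT z a mt ; z (inj₂ (_ , ne)) eq → ne eq })
                    p (~-sym f) (stop refl)))

          inside : Span (Lens W S R) e
          inside with count-elem (N t ∩ T) (≤-trans (s≤s z≤n) many)
          ... | t′ , f , mt′ = Span-≤ e≤ (Span-+ (lengths t′ f mt′) (Evens-span q) ZeroOne-span)

        -- The component behind `l` misses `R`, but `t` lies in `R`: `t` is taken out of the core
        -- and becomes the second root of that component.
        module Leave (l : V) (ml : l ∈ W′) (tl : t ~ l) where
          open Comp l ml

          noR : ∀ z → z ∈ D → ¬ z ∈ R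
          noR z k = noR′ z (walk-end k)

          t∉D : ¬ t ∈ D
          t∉D k = djT t mt k

          split : ∀ w z → w ~ z → z ∈ T → w ∈ N[ T₁ ] ⊎ t ~ w
          split w z f m with z ≟ t
          ... | yes refl = inj₂ (~-sym f)
          ... | no ne    = inj₁ (z , (m , ne) , ~-sym f)

          conn : 2 ≤ count T → Span (Lens W S R) e ⊎ Conn D N[ T₁ ] (N t)
          conn 2≤T with count-two T 2≤T t | any? (λ z → walk? W′ l z ×-dec mem? N[ T₁ ] z)
          ... | o , mo , ne | no none = inj₁ (Core.Trouble.trouble A T₁ A⊆ (λ z m → T⊆ z (proj₁ m)) (λ z m → T⊆S z (proj₁ m)) full₁ A≤T₁
                D D⊆ (C-connected W′ l) djA (λ z m k → djT z (proj₁ m) k) bd t (T⊆ t mt) t∉D (λ a → dAT t a mt) cl noR l (stop ml) tl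
                o (T⊆ o mo) (djT o mo) ne ⁅ t ⁆ (λ { z refl → T⊆ t mt }) dj (stop refl) rt (inj₂ two))
            where
            cl : ∀ w z → w ∈ D → w ~ z → z ∈ W → z ∈ D ⊎ z ∈ A ⊎ z ≡ t
            cl w z k f m with closed w z k f m | z ≟ t
            ... | _             | yes eq = inj₂ (inj₂ eq)
            ... | inj₁ x        | no _   = inj₁ x
            ... | inj₂ (inj₁ x) | no _   = inj₂ (inj₁ x)
            ... | inj₂ (inj₂ x) | no nz  = ⊥-elim (none (w , k , (z , (x , nz) , ~-sym f)))
            dj : Disjoint ((A ∪ T₁) ∪ D) ⁅ t ⁆
            dj z (inj₁ (inj₁ a))        refl = dAT z a mt
            dj z (inj₁ (inj₂ (_ , nz))) refl = nz refl
            dj z (inj₂ k)               refl = t∉D k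
          ... | o , mo , ne | yes (s , ks , ns) with classify D N[ T₁ ] (N t) (C-connected W′ l) (s , ks , ns) (l , stop ml , tl)
          ...   | inj₁ c = inj₂ c
          ...   | inj₂ bad = inj₁ (bad-piece A T₁ A⊆ (λ z m → T⊆ z (proj₁ m)) (λ z m → T⊆S z (proj₁ m)) full₁ A≤T₁
                    D N[ T₁ ] (N t) D⊆ (C-connected W′ l) djA (λ z m k → djT z (proj₁ m) k) cl (λ z k rz → ⊥-elim (noR z k rz)) bd
                    o (T⊆ o mo) (djT o mo) X X⊆ djX X∩D l t (stop ml) (step (inj₁ refl) (~-sym tl) (stop (inj₂ refl))) rt (inj₂ two) bad)
            where
            cl : ∀ w z → w ∈ D → w ~ z → z ∈ W → z ∈ D ⊎ z ∈ A ⊎ (w ∈ N[ T₁ ] ⊎ t ~ w)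
            cl w z k f m with closed w z k f m
            ... | inj₁ x        = inj₁ x
            ... | inj₂ (inj₁ x) = inj₂ (inj₁ x)
            ... | inj₂ (inj₂ x) = inj₂ (inj₂ (split w z f x))
            X : VSet
            X = ⁅ l ⁆ ∪ ⁅ t ⁆
            X⊆ : X ⊆ W
            X⊆ z (inj₁ refl) = proj₁ (proj₁ ml)
            X⊆ z (inj₂ refl) = T⊆ t mt
            djX : Disjoint (A ∪ T₁) X
            djX z (inj₁ a)        (inj₁ refl) = djA z a (stop ml)
            djX z (inj₂ (x , _))  (inj₁ refl) = djT z x (stop ml)
            djX z (inj₁ a)        (inj₂ refl) = dAT z a mt
            djX z (inj₂ (_ , nz)) (inj₂ refl) = nz refl
            X∩D : ∀ z → z ∈ X → z ∈ D → t ~ z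
            X∩D z (inj₁ refl) k = tl
            X∩D z (inj₂ refl) k = ⊥-elim (t∉D k)

          degL : ∀ b → (∀ w → w ∈ D → deg T w ≤ [ N[ T₁ ] ]ι w + [ N t ]ι w + b) →
                 ∀ w → w ∈ D → suc (suc e) ≤ deg D w + [ N[ T₁ ] ]ι w + [ N t ]ι w + (q + b)
          degL b h w k with dg w (D⊆ w k)
          ... | x rewrite ι-no (mem? R w) (noR w k) = begin
            suc (suc e)                                      ≤⟨ x ⟩
            deg W w + [ S ]ι w + 0                           ≡⟨ +-identityʳ _ ⟩
            deg W w + [ S ]ι w                               ≤⟨ +-monoˡ-≤ ([ S ]ι w) (degD w k) ⟩
            deg D w + deg A w + deg T w + [ S ]ι w
              ≡⟨ solve 4 (λ d a t s → d :+ a :+ t :+ s := d :+ (a :+ s) :+ t) refl (deg D w) (deg A w) (deg T w) ([ S ]ι w) ⟩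
            deg D w + (deg A w + [ S ]ι w) + deg T w         ≤⟨ +-mono-≤ (+-monoʳ-≤ (deg D w) (bd w k)) (h w k) ⟩
            deg D w + q + ([ N[ T₁ ] ]ι w + [ N t ]ι w + b)
              ≡⟨ solve 5 (λ d q n t b → d :+ q :+ (n :+ t :+ b) := d :+ n :+ t :+ (q :+ b)) refl (deg D w) q ([ N[ T₁ ] ]ι w) ([ N t ]ι w) b ⟩
            deg D w + [ N[ T₁ ] ]ι w + [ N t ]ι w + (q + b)  ∎
            where open ≤-Reasoning

          degT-split : ∀ w → deg T w ≤ deg T₁ w + [ N t ]ι w
          degT-split w = deg-∪₁ T T₁ t w h
            where
            h : ∀ z → w ~ z → z ∈ T → z ∈ T₁ ⊎ z ≡ t
            h z _ m with z ≟ t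
            ... | yes eq = inj₂ eq
            ... | no ne  = inj₁ (m , ne)

          -- Even without `t` the part `T₁` has `suc q` vertices, so core paths can still use all of
          -- `A`.
          wide : suc (suc q) ≤ count T → Span (Lens W S R) e
          wide big-T with conn (≤-trans (s≤s (s≤s z≤n)) big-T)
          ... | inj₁ sp = sp
          ... | inj₂ c = Span-≤ (m≤n+m∸n e (q + q)) (Span-map 1 (Lens-append {K = (A ∪ T₁) ∪ D} {B = ⁅ t ⁆} sub (λ { z refl → T⊆ t mt }) dj (stop refl) rt)
                  (head-span {h = 0} (Heads-T {S} A T₁ q (λ z m → T⊆S z (proj₁ m)) full₁ ≤-refl (s≤s⁻¹ (≤-trans big-T (count-⊖ T t)))) djH₁
                    (region D (IH D smaller) e (q + q) N[ T₁ ] (N t) c (degL q h))))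
            where
            djH₁ : Disjoint (A ∪ T₁) D
            djH₁ z (inj₁ a)       k = djA z a k
            djH₁ z (inj₂ (x , _)) k = djT z x k
            sub : ((A ∪ T₁) ∪ D) ⊆ W
            sub z (inj₁ (inj₁ a))       = A⊆ z a
            sub z (inj₁ (inj₂ (x , _))) = T⊆ z x
            sub z (inj₂ k)              = D⊆ z k
            dj : Disjoint ((A ∪ T₁) ∪ D) ⁅ t ⁆
            dj z (inj₁ (inj₁ a))        refl = dAT z a mt
            dj z (inj₁ (inj₂ (_ , nz))) refl = nz refl
            dj z (inj₂ k)               refl = t∉D k
            h : ∀ w → w ∈ D → deg T w ≤ [ N[ T₁ ] ]ι w + [ N t ]ι w + q
            h w k with mem? N[ T₁ ] w | degT-split w
            ... | yes _ | _ = ≤-trans (degT w k) (s≤s (m≤n+m q ([ N t ]ι w)))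
            ... | no ¬m | l rewrite deg≡0 T₁ w ¬m = ≤-trans l (m≤m+n _ q)

          -- Without `t` core paths must spare a vertex of `A`, say `a`: the head varies by `p + p`
          -- with `q` equal to `suc p`, while the loss is `q + p`. The missing unit comes from the
          -- end, as a path may stop at `t` or go on to `a`.
          tight : count T ≤ suc q → ∀ a → a ∈ A → a ∈ R → Span (Lens W S R) e
          tight small-T a ma ra with conn (≤-trans (s≤s (count≥1 A a ma)) size)
          ... | inj₁ sp = sp
          ... | inj₂ c = Span-≤ e≤ (Span-map {L = λ x → Lens W S R (suc x)} 1 (λ _ x → x) (Span-+ tails
                  (head-span {h = 0} (Heads-T {S} A₁ T₁ p (λ z m → T⊆S z (proj₁ m)) (λ x y mx my → full₁ x y (proj₁ mx) my) ≤-refl p<T₁) djH₁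
                    (region D (IH D smaller) e (q + p) N[ T₁ ] (N t) c (degL p h))) ZeroOne-span))
            where
            A₁ : VSet
            A₁ = A ⊖ a
            p : ℕ
            p = count A₁
            p<q : suc p ≤ q
            p<q = count-< A₁ A (λ z → proj₁) a ma (λ m → proj₂ m refl)
            q≤p : q ≤ suc p
            q≤p = count-⊖ A a
            p<T₁ : suc p ≤ count T₁
            p<T₁ = ≤-trans p<q A≤T₁
            e≤ : e ≤ (p + p + (e ∸ (q + p))) + 1
            e≤ = ≤-trans (m≤n+m∸n e (q + p)) (≤-trans (+-monoˡ-≤ (e ∸ (q + p)) (+-monoˡ-≤ p q≤p)) (≤-reflexive (+-comm 1 _)))
            djH₁ : Disjoint (A₁ ∪ T₁) D
            djH₁ z (inj₁ (x , _)) k = djA z x k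
            djH₁ z (inj₂ (x , _)) k = djT z x k
            sub : ((A₁ ∪ T₁) ∪ D) ⊆ W
            sub z (inj₁ (inj₁ (x , _))) = A⊆ z x
            sub z (inj₁ (inj₂ (x , _))) = T⊆ z x
            sub z (inj₂ k)              = D⊆ z k
            djt : ∀ z → z ∈ ((A₁ ∪ T₁) ∪ D) → z ≢ t
            djt z (inj₁ (inj₁ (x , _)))  refl = dAT z x mt
            djt z (inj₁ (inj₂ (_ , nz))) refl = nz refl
            djt z (inj₂ k)               refl = t∉D k
            dja : ∀ z → z ∈ ((A₁ ∪ T₁) ∪ D) → z ≢ a
            dja z (inj₁ (inj₁ (_ , nz))) refl = nz refl
            dja z (inj₁ (inj₂ (x , _)))  refl = dAT z ma x
            dja z (inj₂ k)               refl = djA z ma k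
            tails : ∀ x b → Lens ((A₁ ∪ T₁) ∪ D) S (N t) x → ZeroOne b → Lens W S R (suc (x + b))
            tails x _ L (inj₁ refl) = subst (λ y → Lens W S R (suc y)) (+-comm 0 x)
              (Lens-append {B = ⁅ t ⁆} sub (λ { z refl → T⊆ t mt }) djt (stop refl) rt x L)
            tails x _ L (inj₂ refl) = subst (λ y → Lens W S R (suc y)) (+-comm 1 x)
              (Lens-append {B = ⁅ t ⁆ ∪ ⁅ a ⁆} sub (λ { z (inj₁ refl) → T⊆ t mt ; z (inj₂ refl) → A⊆ a ma })
                (λ { z m (inj₁ eq) → djt z m eq ; z m (inj₂ eq) → dja z m eq })
                (step (inj₁ refl) (~-sym (full a t ma mt)) (stop (inj₂ refl , λ { refl → dAT t ma mt }))) ra x L)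
            h : ∀ w → w ∈ D → deg T w ≤ [ N[ T₁ ] ]ι w + [ N t ]ι w + p
            h w k = ≤-trans (degT-split w) (≤-trans (+-monoˡ-≤ ([ N t ]ι w) (deg-contract T₁ w p
                      (≤-trans (deg≤count T₁ w) (≤-trans (s≤s⁻¹ (≤-trans (count-< T₁ T (λ z → proj₁) t mt (λ m → proj₂ m refl)) small-T)) q≤p))))
                      (≤-reflexive (solve 3 (λ n p t → n :+ p :+ t := n :+ t :+ p) refl ([ N[ T₁ ] ]ι w) p ([ N t ]ι w))))

      analyse : Span (Lens W S R) e ⊎ Escape W S R
      analyse with any? (λ r → mem? W′ r ×-dec mem? R r)
      ... | yes (r , mr , rr) = inj₁ (meets-R r mr rr)
      ... | no none with any? (λ t → mem? T t ×-dec mem? R t)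
      ...   | no noT = inj₂ (record { core = core ; where-R = inj₂ inA })
        where
        inA : ∀ r → r ∈ W → r ∈ R → r ∈ A
        inA r mr rr with mem? A r | mem? T r
        ... | yes a | _     = a
        ... | no ¬a | yes m = ⊥-elim (noT (r , m , rr))
        ... | no ¬a | no ¬m = ⊥-elim (none (r , ((mr , ¬a) , ¬m) , rr))
      ...   | yes (t , mt , rt) with e ≤? q + q
      ...     | yes e≤ = inj₁ (Span-≤ e≤ (Span-map 0 direct (Evens-span q)))
        where
        direct : ∀ ℓ → Evens q ℓ → Lens W S R ℓ
        direct _ (j , l , refl) with core-path j A T t full l (≤-trans (s≤s l) size) mt
        ... | u , mu , p = lens (T⊆S u mu) rt (path-mono (λ { z (inj₁ a) → A⊆ z a ; z (inj₂ m) → T⊆ z m }) p)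
      ...     | no e≰ with any? (λ l → mem? W′ l ×-dec (t ~? l))
      ...       | no nol = inj₁ (AtT.Inside.inside (λ r mr rr → none (r , mr , rr)) t mt rt (≰⇒> e≰) cl)
        where
        cl : ∀ z → t ~ z → z ∈ W → z ∈ A ⊎ z ∈ T
        cl z f m with mem? A z | mem? T z
        ... | yes a | _     = inj₁ a
        ... | no ¬a | yes x = inj₂ x
        ... | no ¬a | no ¬x = ⊥-elim (nol (z , ((m , ¬a) , ¬x) , f))
      ...       | yes (l , ml , tl) with suc (suc q) ≤? count T
      ...         | yes big-T = inj₁ (AtT.Leave.wide (λ r mr rr → none (r , mr , rr)) t mt rt (≰⇒> e≰) l ml tl big-T)
      ...         | no small-T with any? (λ a → mem? A a ×-dec mem? R a)
      ...           | yes (a , ma , ra) = inj₁ (AtT.Leave.tight (λ r mr rr → none (r , mr , rr)) t mt rt (≰⇒> e≰) l ml tl (s≤s⁻¹ (≰⇒> small-T)) a ma ra)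
      ...           | no noA = inj₂ (record { core = core ; where-R = inj₁ (inT , s≤s⁻¹ (≰⇒> small-T)) })
        where
        inT : ∀ r → r ∈ W → r ∈ R → r ∈ T
        inT r mr rr with mem? A r | mem? T r
        ... | yes a | _     = ⊥-elim (noA (r , a , rr))
        ... | no ¬a | yes m = m
        ... | no ¬a | no ¬m = ⊥-elim (none (r , ((mr , ¬a) , ¬m) , rr))

    -- Both roots with the same neighbours

    -- S, R and T coincide on W, and ∣T∣ is minimal.  One vertex a of A is spared: as t is used
    -- to reach y, the core paths cannot use all of A anyway.
    module Shared (core : MaxCore W S) (R⊆T : ∀ r → r ∈ W → r ∈ R → r ∈ common W S (MaxCore.A core))
                  (S⊆T : ∀ s → s ∈ W → s ∈ S → s ∈ common W S (MaxCore.A core))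
                  (small-T : count (common W S (MaxCore.A core)) ≤ suc (count (MaxCore.A core)))
                  (t : V) (mt : t ∈ W) (rt : t ∈ R) where
      open MaxCore core
      open WithCore core

      tT : t ∈ T
      tT = R⊆T t mt rt

      T₁ : VSet
      T₁ = T ⊖ t

      -- With `A` empty, `t` would be the only vertex of `W` in `S`. Another vertex of `W` could not
      -- reach `S` without `t`, and `t` alone has too small a degree.
      A-nonempty : ∃ λ a → a ∈ A
      A-nonempty with any? (mem? A)
      ... | yes a = a
      ... | no none with any? (mem? (W ⊖ t))
      ...   | yes (u , mu) with toS tc t u mt mu
      ...     | s , w , ss = ⊥-elim (<-irrefl refl (≤-trans (count-≥2 T s t (S⊆T s (proj₁ (walk-end w)) ss) tT (proj₂ (walk-end w)))
                               (≤-trans small-T (≤-reflexive (cong suc (count-∅ A (λ z m → none (z , m))))))))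
      A-nonempty | no none | no alone = ⊥-elim (<-irrefl refl (≤-trans (s≤s (s≤s (≤-trans (s≤s z≤n) 2≤e))) (≤-trans (dg t mt) h)))
        where
        h : deg W t + [ S ]ι t + [ R ]ι t ≤ 2
        h = +-mono-≤ (+-mono-≤ (≤-reflexive (count-∅ (N t ∩ W) (λ z (f , m) → alone (z , m , λ eq → ~-irrefl f (sym eq))))) (ι≤1 (mem? S t))) (ι≤1 (mem? R t))

      module _ (a : V) (ma : a ∈ A) where

        A₁ : VSet
        A₁ = A ⊖ a

        -- The spared `a` goes back to the outside vertices. It is adjacent to all of `T`, so its
        -- component borders both on the head and on `t`.
        Z : VSet
        Z = W′ ∪ ⁅ a ⁆

        D : VSet
        D = C Z a

        aZ : a ∈ Z
        aZ = inj₂ refl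

        p : ℕ
        p = count A₁

        p<q : suc p ≤ q
        p<q = count-< A₁ A (λ z → proj₁) a ma (λ m → proj₂ m refl)

        q≤p : q ≤ suc p
        q≤p = count-⊖ A a

        q≤T₁ : q ≤ count T₁
        q≤T₁ = s≤s⁻¹ (≤-trans size (count-⊖ T t))

        T₁≤ : count T₁ ≤ suc p
        T₁≤ = ≤-trans (s≤s⁻¹ (≤-trans (count-< T₁ T (λ z → proj₁) t tT (λ m → proj₂ m refl)) small-T)) q≤p

        Z⊆ : Z ⊆ W
        Z⊆ z (inj₁ ((m , _) , _)) = m
        Z⊆ z (inj₂ refl)          = A⊆ a ma

        djA : Disjoint A₁ D
        djA z (m , ne) k with walk-end k
        ... | inj₁ ((_ , ¬a) , _) = ¬a m
        ... | inj₂ eq             = ne eq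

        djT : Disjoint T D
        djT z m k with walk-end k
        ... | inj₁ (_ , ¬t) = ¬t m
        ... | inj₂ refl     = dAT z ma m

        djH : Disjoint (A₁ ∪ T₁) D
        djH z (inj₁ m)       k = djA z m k
        djH z (inj₂ (m , _)) k = djT z m k

        D⊆ : D ⊆ W
        D⊆ z k = Z⊆ z (walk-end k)

        noS : ∀ z → z ∈ D → ¬ z ∈ S
        noS z k s = djT z (S⊆T z (D⊆ z k) s) k

        noR : ∀ z → z ∈ D → ¬ z ∈ R
        noR z k r = djT z (R⊆T z (D⊆ z k) r) k

        full₁ : Complete A₁ T₁
        full₁ x y mx my = full x y (proj₁ mx) (proj₁ my)

        closed : ∀ w z → w ∈ D → w ~ z → z ∈ W → (z ∈ D ⊎ z ∈ A₁) ⊎ z ∈ T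
        closed w z k f m with mem? A z | mem? T z | z ≟ a
        ... | _     | _     | yes refl = inj₁ (inj₁ (C-closed Z a k f (inj₂ refl)))
        ... | yes x | _     | no ne    = inj₁ (inj₂ (x , ne))
        ... | no ¬x | yes y | no ne    = inj₂ y
        ... | no ¬x | no ¬y | no ne    = inj₁ (inj₁ (C-closed Z a k f (inj₁ ((m , ¬x) , ¬y))))

        closed′ : ∀ w z → w ∈ D → w ~ z → z ∈ W → z ∈ D ⊎ z ∈ A₁ ⊎ (w ∈ N[ T₁ ] ⊎ t ~ w)
        closed′ w z k f m with closed w z k f m | z ≟ t
        ... | inj₁ (inj₁ x) | _        = inj₁ x
        ... | inj₁ (inj₂ x) | _        = inj₂ (inj₁ x)
        ... | inj₂ x        | yes refl = inj₂ (inj₂ (inj₂ (~-sym f)))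
        ... | inj₂ x        | no ne    = inj₂ (inj₂ (inj₁ (z , (x , ne) , ~-sym f)))

        other : ∃ λ t′ → t′ ∈ T × t′ ≢ t
        other = count-two T (≤-trans (s≤s (count≥1 A a ma)) size) t

        dI : ∀ w → w ∈ D → suc (suc e) ≤ deg D w + [ N[ T₁ ] ]ι w + [ N t ]ι w + (p + p)
        dI w k with dg w (D⊆ w k)
        ... | x rewrite ι-no (mem? R w) (noR w k) | ι-no (mem? S w) (noS w k) = begin
          suc (suc e)                             ≤⟨ x ⟩
          deg W w + 0 + 0                         ≡⟨ trans (+-identityʳ _) (+-identityʳ _) ⟩
          deg W w                                 ≤⟨ deg-∪ W (D ∪ A₁) T w (λ z f m → closed w z k f m) ⟩
          deg (D ∪ A₁) w + deg T w                ≤⟨ +-mono-≤ (deg-∪ (D ∪ A₁) D A₁ w (λ z _ m → m)) (deg-∪₁ T T₁ t w h) ⟩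
          deg D w + deg A₁ w + (deg T₁ w + [ N t ]ι w)
            ≤⟨ +-mono-≤ (+-monoʳ-≤ (deg D w) (deg≤count A₁ w)) (+-monoˡ-≤ ([ N t ]ι w) (deg-contract T₁ w p (≤-trans (deg≤count T₁ w) T₁≤))) ⟩
          deg D w + p + ([ N[ T₁ ] ]ι w + p + [ N t ]ι w)
            ≡⟨ solve 4 (λ d p n t → d :+ p :+ (n :+ p :+ t) := d :+ n :+ t :+ (p :+ p)) refl (deg D w) p ([ N[ T₁ ] ]ι w) ([ N t ]ι w) ⟩
          deg D w + [ N[ T₁ ] ]ι w + [ N t ]ι w + (p + p) ∎
          where
          open ≤-Reasoning
          h : ∀ z → w ~ z → z ∈ T → z ∈ T₁ ⊎ z ≡ t
          h z _ m with z ≟ t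
          ... | yes eq = inj₂ eq
          ... | no ne  = inj₁ (m , ne)

        shared′ : Span (Lens W S R) e
        shared′ with other
        ... | o , mo , ne with classify D N[ T₁ ] (N t) (C-connected Z a) (a , stop aZ , (o , (mo , ne) , ~-sym (full a o ma mo))) (a , stop aZ , ~-sym (full a t ma tT))
        ...   | inj₂ bad = bad-piece A₁ T₁ (λ z m → A⊆ z (proj₁ m)) (λ z m → T⊆ z (proj₁ m)) (λ z m → T⊆S z (proj₁ m)) full₁
                  (≤-trans (n≤1+n p) (≤-trans p<q q≤T₁)) D N[ T₁ ] (N t) D⊆ (C-connected Z a) djA (λ z m k → djT z (proj₁ m) k) closed′
                  (λ z k r → ⊥-elim (noR z k r)) bd o (T⊆ o mo) (djT o mo) X X⊆ djX X∩D a t (stop aZ)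
                  (step (inj₁ refl) (full a t ma tT) (stop (inj₂ refl))) rt (inj₁ noS) bad
          where
          bd : ∀ w → w ∈ D → deg A₁ w + [ S ]ι w ≤ p
          bd w k rewrite ι-no (mem? S w) (noS w k) = ≤-trans (≤-reflexive (+-identityʳ _)) (deg≤count A₁ w)
          X : VSet
          X = ⁅ a ⁆ ∪ ⁅ t ⁆
          X⊆ : X ⊆ W
          X⊆ z (inj₁ refl) = A⊆ a ma
          X⊆ z (inj₂ refl) = mt
          djX : Disjoint (A₁ ∪ T₁) X
          djX z (inj₁ (_ , nz)) (inj₁ eq)   = nz eq
          djX z (inj₂ (x , _))  (inj₁ refl) = dAT z ma x
          djX z (inj₁ (x , _))  (inj₂ refl) = dAT z x tT
          djX z (inj₂ (_ , nz)) (inj₂ eq)   = nz eq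
          X∩D : ∀ z → z ∈ X → z ∈ D → t ~ z
          X∩D z (inj₁ refl) k = ~-sym (full a t ma tT)
          X∩D z (inj₂ refl) k = ⊥-elim (djT t tT k)
        ...   | inj₁ c = Span-≤ (m≤n+m∸n e (p + p)) (Span-map 1 (Lens-append {K = (A₁ ∪ T₁) ∪ D} {B = ⁅ t ⁆} sub (λ { z refl → mt }) dj (stop refl) rt)
                  (head-span {h = 0} (Heads-T {S} A₁ T₁ p (λ z m → T⊆S z (proj₁ m)) full₁ ≤-refl (≤-trans p<q q≤T₁)) djH
                    (region D (IH D (count-< D W D⊆ t mt (djT t tT))) e (p + p) N[ T₁ ] (N t) c dI)))
          where
          sub : ((A₁ ∪ T₁) ∪ D) ⊆ W
          sub z (inj₁ (inj₁ (x , _))) = A⊆ z x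
          sub z (inj₁ (inj₂ (x , _))) = T⊆ z x
          sub z (inj₂ k)              = D⊆ z k
          dj : Disjoint ((A₁ ∪ T₁) ∪ D) ⁅ t ⁆
          dj z (inj₁ (inj₁ (x , _)))  refl = dAT z x tT
          dj z (inj₁ (inj₂ (_ , nz))) refl = nz refl
          dj z (inj₂ k)               refl = djT z tT k

      shared : Span (Lens W S R) e
      shared with A-nonempty
      ... | a , ma = shared′ a ma

    -- The part T of either core lies in S resp. R, so all combinations but one are contradictory.
    conclude : Escape W S R → Escape W R S → Span (Lens W S R) e
    conclude x y = go (Escape.where-R x) (Escape.where-R y)
      where
      module X = Escape x
      module Y = Escape y
      go : ((∀ r → r ∈ W → r ∈ R → r ∈ X.T) × count X.T ≤ suc (count X.A)) ⊎ (∀ r → r ∈ W → r ∈ R → r ∈ X.A) →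
           ((∀ s → s ∈ W → s ∈ S → s ∈ Y.T) × count Y.T ≤ suc (count Y.A)) ⊎ (∀ s → s ∈ W → s ∈ S → s ∈ Y.A) →
           Span (Lens W S R) e
      go (inj₁ (RT , small)) (inj₁ (ST , _)) with target co
      ... | t , mt , rt = Shared.shared X.core RT (λ s ms ss → RT s ms (proj₁ (proj₂ (ST s ms ss)))) small t mt rt
      -- A vertex of `Y.T` lies in `R`, hence in `X.T` and in `S`, hence in `Y.A`; it would be
      -- adjacent to itself.
      go (inj₁ (RT , _)) (inj₂ SA) with count-elem Y.T (≤-trans (s≤s z≤n) Y.size)
      ... | t , (mw , mr , f) = ⊥-elim (~-irrefl (f t (SA t mw (proj₁ (proj₂ (RT t mw mr))))) refl)
      go (inj₂ RA) (inj₁ (ST , _)) with count-elem X.T (≤-trans (s≤s z≤n) X.size)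
      ... | t , (mw , ms , f) = ⊥-elim (~-irrefl (f t (RA t mw (proj₁ (proj₂ (ST t mw ms))))) refl)
      go (inj₂ RA) (inj₂ SA) = ⊥-elim (<-irrefl refl (begin-strict
        count X.A  <⟨ X.size ⟩
        count X.T  ≤⟨ count-mono X.T Y.A (λ z (mw , ms , _) → SA z mw ms) ⟩
        count Y.A  <⟨ Y.size ⟩
        count Y.T  ≤⟨ count-mono Y.T X.A (λ z (mw , mr , _) → RA z mw mr) ⟩
        count X.A  ∎))
        where open ≤-Reasoning

  -- The induction on `W`

  main-step : ∀ W → (∀ K → count K < count W → Main K) → Main W
  main-step W IH zero    S R co dg = Conn-span0 co
  main-step W IH (suc zero) S R co dg with source co
  ... | s , ms , ss with count-elem (N s ∩ W) (s≤s⁻¹ (s≤s⁻¹ (≤-trans (dg s ms) h)))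
    where
    h : deg W s + [ S ]ι s + [ R ]ι s ≤ suc (suc (deg W s))
    h = ≤-trans (+-mono-≤ (+-monoʳ-≤ (deg W s) (ι≤1 (mem? S s))) (ι≤1 (mem? R s)))
          (≤-reflexive (trans (+-comm _ 1) (cong suc (+-comm _ 1))))
  -- Any vertex may be declared exempt here; for `s`, its neighbour `v` is the required second
  -- vertex.
  ...   | v , f , mv = two-lengths W S R s co (λ v m _ → dg v m) (v , mv , λ eq → ~-irrefl f (sym eq))
  main-step W IH e@(suc (suc _)) S R co dg with Reduce.two-conn W IH e (s≤s (s≤s z≤n)) co dg
  ... | inj₁ sp = sp
  ... | inj₂ tc with Reduced.WithCore.analyse W IH e 2≤e S R co dg tc (max-core W S (source co))
                   | Reduced.WithCore.analyse W IH e 2≤e R S (Conn-flip co) (Reduce.Deg-flip W IH e 2≤e {S} {R} dg) (TwoConn-flip tc) (max-core W R (target co))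
    where
    2≤e : 2 ≤ e
    2≤e = s≤s (s≤s z≤n)
  ...   | inj₁ sp | _       = sp
  ...   | inj₂ _  | inj₁ sp = Span-map 0 Lens-flip sp
  ...   | inj₂ x  | inj₂ y  = Reduced.conclude W IH e (s≤s (s≤s z≤n)) S R co dg tc x y

  main-fuel : ∀ f W → count W ≤ f → Main W
  main-fuel f W l e S R co dg = main-step W (λ K lt → rec f l K lt) e S R co dg
    where
    rec : ∀ f → count W ≤ f → ∀ K → count K < count W → Main K
    rec zero    l K lt = ⊥-elim (n≮0 (≤-trans lt l))
    rec (suc f) l K lt = main-fuel f K (s≤s⁻¹ (≤-trans lt l))

  main : ∀ W → Main W
  main W = main-fuel (count W) W ≤-refl

  -- Paths of both parities

  parity : ℕ → Bool
  parity zero    = false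
  parity (suc m) = not (parity m)

  Proper : VSet → (V → Bool) → Set
  Proper W col = ∀ u v → u ∈ W → v ∈ W → u ~ v → col v ≡ not (col u)

  Proper-mono : ∀ A B {col} → A ⊆ B → Proper B col → Proper A col
  Proper-mono A B s h u v mu mv = h u v (s u mu) (s v mv)

  not-xor : ∀ a b → not a xor b ≡ a xor not b
  not-xor a b = trans (sym (Bool.not-distribˡ-xor a b)) (Bool.not-distribʳ-xor a b)

  ≢not⇒≡ : ∀ {a b} → a ≢ not b → a ≡ b
  ≢not⇒≡ {b = b} ne = trans (Bool.¬-not ne) (Bool.not-involutive b)

  path-colour : ∀ {W col u v ℓ} → Proper W col → Path W u v ℓ → col v ≡ col u xor parity ℓ
  path-colour {col = col} {u} h (stop m) = sym (Bool.xor-identityʳ (col u))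
  path-colour {W} {col} {u} h (step {w = w} {ℓ = ℓ} m e p) =
    trans (path-colour (Proper-mono (W ⊖ u) W (λ z → proj₁) h) p)
      (trans (cong (_xor parity ℓ) (h u w m (proj₁ (path-start p)) e)) (not-xor (col u) (parity ℓ)))

  agree : ∀ {K c c′ y z} → Proper K c → Proper K c′ → Walk K y z → c y ≡ c′ y → c z ≡ c′ z
  agree h h′ (stop m) eq = eq
  agree h h′ (step {u} {w} m e p) eq =
    agree h h′ p (trans (h u w m (walk-start p) e) (trans (cong not eq) (sym (h′ u w m (walk-start p) e))))

  Entries : Set₁
  Entries = Bool → VSet

  -- entering at a vertex of S i costs parity i
  record PLens (W : VSet) (S : Entries) (R : VSet) (b : Bool) : Set where
    constructor plens
    field
      {len}  : ℕ
      side   : Bool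
      route  : Lens W (S side) R len
      total  : side xor parity len ≡ b

  -- A certificate that all paths have one parity: the colour starts at the cost of the entry,
  -- alternates along edges and is the same at all exits.
  record Colouring (W : VSet) (S : Entries) (R : VSet) : Set where
    field
      col     : V → Bool
      proper  : Proper W col
      entries : ∀ i s → s ∈ W → s ∈ S i → col s ≡ i
      exits   : Bool
      exits≡  : ∀ r → r ∈ W → r ∈ R → col r ≡ exits

  Both : VSet → Entries → VSet → Set
  Both W S R = ∀ b → PLens W S R b

  ⋃ : Entries → VSet
  ⋃ S = S false ∪ S true

  ⋃-in : ∀ (S : Entries) i z → z ∈ S i → z ∈ ⋃ S
  ⋃-in S false z m = inj₁ m
  ⋃-in S true  z m = inj₂ m

  ⋃-out : ∀ (S : Entries) z → z ∈ ⋃ S → ∃ λ i → z ∈ S i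
  ⋃-out S z (inj₁ m) = false , m
  ⋃-out S z (inj₂ m) = true , m

  sequence⊎ : ∀ {m} {P : Set} {Q : Fin m → Set} → (∀ z → P ⊎ Q z) → P ⊎ (∀ z → Q z)
  sequence⊎ {zero}  f = inj₂ (λ ())
  sequence⊎ {suc m} f with f zero | sequence⊎ (λ z → f (suc z))
  ... | inj₁ p | _      = inj₁ p
  ... | inj₂ _ | inj₁ p = inj₁ p
  ... | inj₂ q | inj₂ h = inj₂ (λ { zero → q ; (suc z) → h z })

  two-parities : ∀ {W S R} b b′ → b ≢ b′ → PLens W S R b → PLens W S R b′ → Both W S R
  two-parities false false ne p q b = ⊥-elim (ne refl)
  two-parities true  true  ne p q b = ⊥-elim (ne refl)
  two-parities false true  ne p q false = p
  two-parities false true  ne p q true  = q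
  two-parities true  false ne p q false = q
  two-parities true  false ne p q true  = p

  parity-+ : ∀ a b → parity (a + b) ≡ parity a xor parity b
  parity-+ zero    b = refl
  parity-+ (suc a) b = trans (cong not (parity-+ a b)) (Bool.not-distribˡ-xor (parity a) (parity b))

  xor-cancelʳ : ∀ a b → (a xor b) xor b ≡ a
  xor-cancelʳ a b = trans (Bool.xor-assoc a b b) (trans (cong (a xor_) (Bool.xor-same b)) (Bool.xor-identityʳ a))

  -- The vertex s is merged into the root.  A component of W − s that misses R is left through s.
  module Contract (W : VSet) (S : Entries) (R : VSet)
              (IH : ∀ K → count K < count W → ∀ S R → Conn K (⋃ S) R → Both K S R ⊎ Colouring K S R)
              (co : Conn W (⋃ S) R) (i : Bool) (s : V) (ms : s ∈ W) (si : s ∈ S i) where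

    record Piece (z : V) : Set where
      field
        col    : V → Bool
        proper : Proper (C (W ⊖ s) z) col
        entries : ∀ j x → x ∈ C (W ⊖ s) z → x ∈ S j → col x ≡ j
        near   : ∀ x → x ∈ C (W ⊖ s) z → s ~ x → col x ≡ not i

    -- Entering by way of `s` takes one more edge, so the neighbours of `s` become entries of the
    -- opposite cost.
    S⁺ : Entries
    S⁺ j = vset (λ z → z ∈ S j ⊎ (j ≡ not i × s ~ z)) (λ z → mem? (S j) z ⊎-dec ((j Bool.≟ not i) ×-dec (s ~? z)))

    module _ (z : V) (mz : z ∈ (W ⊖ s)) where
      D : VSet
      D = C (W ⊖ s) z

      D⊆ : D ⊆ W
      D⊆ x k = proj₁ (walk-end k)

      D∌s : ¬ s ∈ D
      D∌s k = proj₂ (walk-end k) refl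

      smaller : count D < count W
      smaller = count-< D W D⊆ s ms D∌s

      is-s : ∀ {y y′} → y ∈ D → y ~ y′ → y′ ∈ W → ¬ y′ ∈ D → y′ ≡ s
      is-s {y} {y′} k e m ¬k with y′ ≟ s
      ... | yes eq = eq
      ... | no ne  = ⊥-elim (¬k (C-closed (W ⊖ s) z k e (m , ne)))

      near-s : ∃ λ y → y ∈ D × s ~ y
      near-s with exit-to D (connected co z s (proj₁ mz) ms) (stop mz) D∌s
      ... | y , y′ , w , k , e , m , ¬k with is-s k e m ¬k
      ...   | refl = y , k , ~-sym e

      meets : ∀ r → r ∈ D → r ∈ R → Both W S R ⊎ Piece z
      meets r kr rr with IH D smaller S⁺ R coD
        where
        coD : Conn D (⋃ S⁺) R
        coD = record { connected = C-connected (W ⊖ s) z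
                     ; source = proj₁ near-s , proj₁ (proj₂ near-s) , ⋃-in S⁺ (not i) _ (inj₂ (refl , proj₂ (proj₂ near-s)))
                     ; target = r , kr , rr ; cut = ct }
          where
          ct : ∀ v u → v ∈ D → u ∈ D → u ≢ v → ∃ λ x → Walk (D ⊖ v) u x × (x ∈ ⋃ S⁺ ⊎ x ∈ R)
          ct v u kv ku ne with cut co v u (D⊆ v kv) (D⊆ u ku) ne
          ... | x , w , sr with exit D w ku
          ...   | inj₂ (y , y′ , w′ , e , (m , _) , ¬k) with is-s (proj₂ (walk-end w′)) e m ¬k
          ...     | refl = y , restrict W D w′ , inj₁ (⋃-in S⁺ (not i) y (inj₂ (refl , ~-sym e)))
          ct v u kv ku ne | x , w , inj₂ rx | inj₁ w′ = x , restrict W D w′ , inj₂ rx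
          ct v u kv ku ne | x , w , inj₁ sx | inj₁ w′ with ⋃-out S x sx
          ...     | j , m = x , restrict W D w′ , inj₁ (⋃-in S⁺ j x (inj₁ m))
      ... | inj₂ c = inj₂ (record { col = Colouring.col c ; proper = Colouring.proper c
                                  ; entries = λ j x k m → Colouring.entries c j x k (inj₁ m)
                                  ; near = λ x k e → Colouring.entries c (not i) x k (inj₂ (refl , e)) })
      ... | inj₁ b = inj₁ (λ x → up (b x))
        where
        up : ∀ {x} → PLens D S⁺ R x → PLens W S R x
        up (plens j (lens (inj₁ m) r p) eq) = plens j (lens m r (path-mono D⊆ p)) eq
        up (plens {ℓ} j (lens (inj₂ (refl , e)) r p) eq) =
          plens i (lens si r (step ms e (path-mono (λ x k → D⊆ x k , λ { refl → D∌s k }) p)))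
            (trans (sym (not-xor i (parity ℓ))) eq)

      -- One may start at `s` directly, or enter the component and come out at `s`; both continue
      -- along the same tail. Unless the exits of the component have the colour `not i` that fits
      -- `s`, the two ways differ in parity.
      misses : (∀ r → r ∈ D → ¬ r ∈ R) → Both W S R ⊎ Piece z
      misses noR with DeadEnd.tail co ms (proj₁ mz) (proj₂ mz) noR | IH D smaller S (N s) (DeadEnd.connK co ms (proj₁ mz) (proj₂ mz) noR)
      ... | r , m , rr , q | inj₁ b = inj₁ (λ x → up x (b (x xor parity (suc m))))
        where
        up : ∀ x → PLens D S (N s) (x xor parity (suc m)) → PLens W S R x
        up x (plens {ℓ} j L eq) = plens j (Lens-append D⊆ (λ y → proj₁) (λ y k h → proj₂ h k) q rr ℓ L)
          (trans (cong (j xor_) (trans (cong parity (+-comm (suc m) ℓ)) (parity-+ ℓ (suc m))))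
            (trans (sym (Bool.xor-assoc j (parity ℓ) (parity (suc m)))) (trans (cong (_xor parity (suc m)) eq) (xor-cancelʳ x (parity (suc m))))))
      ... | r , m , rr , q | inj₂ c with near-s
      ...   | y , ky , ey with Colouring.exits c Bool.≟ not i
      ...     | yes eq = inj₂ (record { col = Colouring.col c ; proper = Colouring.proper c ; entries = Colouring.entries c
                                      ; near = λ x k e → trans (Colouring.exits≡ c x k e) eq })
      ...     | no ne with source (DeadEnd.connK co ms (proj₁ mz) (proj₂ mz) noR)
      ...       | u , ku , su with ⋃-out S u su | walk→path (C-connected (W ⊖ s) z u y ku ky)
      ...         | j , mj | ℓ , p = inj₁ (two-parities _ _ (Bool.not-¬ refl) (plens i (lens si rr (path-mono (λ x → proj₁) q)) refl)
                      (plens j (Lens-append D⊆ (λ x → proj₁) (λ x k h → proj₂ h k) q rr ℓ (lens mj ey p)) tot))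
        where
        y-colour : j xor parity ℓ ≡ i
        y-colour = trans (trans (cong (_xor parity ℓ) (sym (Colouring.entries c j u ku mj))) (sym (path-colour (Colouring.proper c) p)))
                     (trans (Colouring.exits≡ c y ky ey) (≢not⇒≡ ne))
        tot : j xor parity (suc m + ℓ) ≡ not (i xor parity m)
        tot = trans (cong (j xor_) (trans (cong parity (+-comm (suc m) ℓ)) (parity-+ ℓ (suc m))))
                (trans (sym (Bool.xor-assoc j (parity ℓ) (parity (suc m)))) (trans (cong (_xor not (parity m)) y-colour) (sym (Bool.not-distribʳ-xor i (parity m)))))

    piece : ∀ z → Both W S R ⊎ (z ∈ (W ⊖ s) → Piece z)
    piece z with mem? (W ⊖ s) z
    ... | no ¬m = inj₂ (λ m → ⊥-elim (¬m m))
    ... | yes m with any? (λ r → walk? (W ⊖ s) z r ×-dec mem? R r)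
    ...   | yes (r , k , rr) with meets z m r k rr
    ...     | inj₁ b = inj₁ b
    ...     | inj₂ p = inj₂ (λ _ → p)
    piece z | yes m | no none with misses z m (λ r k rr → none (r , k , rr))
    ...     | inj₁ b = inj₁ b
    ...     | inj₂ p = inj₂ (λ _ → p)

    -- There is one colouring per vertex, not per component, and each vertex is coloured by its own.
    -- Two colourings of one component agree at a neighbour of `s`, hence throughout, which makes
    -- the patchwork proper.
    module Glue (pc : ∀ z → z ∈ (W ⊖ s) → Piece z) (s∉ : ¬ s ∈ S (not i)) where

      col : V → Bool
      col z with z ≟ s
      ... | yes _ = i
      ... | no ne with mem? W z
      ...   | yes m = Piece.col (pc z (m , ne)) z
      ...   | no _  = false

      col-s : col s ≡ i
      col-s with s ≟ s
      ... | yes _ = refl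
      ... | no ne = ⊥-elim (ne refl)

      col-z : ∀ z → z ∈ (W ⊖ s) → ∃ λ m → col z ≡ Piece.col (pc z m) z
      col-z z (m , ne) with z ≟ s
      ... | yes eq = ⊥-elim (ne eq)
      ... | no ne′ with mem? W z
      ...   | yes m′ = (m′ , ne′) , refl
      ...   | no ¬m  = ⊥-elim (¬m m)

      proper : Proper W col
      proper u v mu mv e = by (u ≟ s) (v ≟ s)
        where
        by : Dec (u ≡ s) → Dec (v ≡ s) → col v ≡ not (col u)
        by (yes refl) (yes refl) = ⊥-elim (~-irrefl e refl)
        by (yes refl) (no nv) with col-z v (mv , nv)
        ... | m , eq = trans eq (trans (Piece.near (pc v m) v (stop m) e) (cong not (sym col-s)))
        by (no nu) (yes refl) with col-z u (mu , nu)
        ... | m , eq = trans col-s (trans (sym (Bool.not-involutive i)) (cong not (sym (trans eq (Piece.near (pc u m) u (stop m) (~-sym e))))))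
        by (no nu) (no nv) with col-z u (mu , nu) | col-z v (mv , nv)
        ... | m , eq | m′ , eq′ with near-s v m′
        ...   | y , ky , ey = trans eq′ (trans (agree (Piece.proper (pc v m′)) (Proper-mono (C (W ⊖ s) v) (C (W ⊖ s) u) vu (Piece.proper (pc u m)))
                                (C-connected (W ⊖ s) v y v ky (stop m′))
                                (trans (Piece.near (pc v m′) y ky ey) (sym (Piece.near (pc u m) y (vu y ky) ey))))
                              (trans (Piece.proper (pc u m) u v (stop m) (vu v (stop m′)) e) (cong not (sym eq))))
          where
          vu : C (W ⊖ s) v ⊆ C (W ⊖ s) u
          vu x k = step m e k

      entries : ∀ j x → x ∈ W → x ∈ S j → col x ≡ j
      entries j x mx sx = by (x ≟ s)
        where
        by : Dec (x ≡ s) → col x ≡ j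
        by (yes refl) = trans col-s (sym (≢not⇒≡ (λ { refl → s∉ sx })))
        by (no ne) with col-z x (mx , ne)
        ... | m , eq = trans eq (Piece.entries (pc x m) j x (stop m) sx)

      reach : ∀ r → r ∈ W → r ∈ R → PLens W S R (col r)
      reach r mr rr with walk→path (connected co s r ms mr)
      ... | ℓ , p = plens i (lens si rr p) (trans (cong (_xor parity ℓ) (sym col-s)) (sym (path-colour proper p)))

      -- A path from `s` to an exit has the colour of that exit as its parity, so exits of different
      -- colours give both parities.
      glue : Both W S R ⊎ Colouring W S R
      glue with target co
      ... | r , mr , rr with any? (λ x → mem? W x ×-dec mem? R x ×-dec ¬? (col r Bool.≟ col x))
      ...   | yes (x , mx , rx , ne) = inj₁ (two-parities (col r) (col x) ne (reach r mr rr) (reach x mx rx))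
      ...   | no none = inj₂ (record { col = col ; proper = proper ; entries = entries ; exits = col r ; exits≡ = same })
        where
        same : ∀ x → x ∈ W → x ∈ R → col x ≡ col r
        same x mx rx with col r Bool.≟ col x
        ... | yes eq = sym eq
        ... | no ne  = ⊥-elim (none (x , mx , rx , ne))

    result : Both W S R ⊎ Colouring W S R
    result with mem? (S (not i)) s
    ... | no s∉ with sequence⊎ piece
    ...   | inj₁ b  = inj₁ b
    ...   | inj₂ pc = Glue.glue pc s∉
    result | yes s∈ with target co
    ...   | r , mr , rr with walk→path (connected co s r ms mr)
    ...     | ℓ , p = inj₁ (two-parities _ _ (Bool.not-¬ refl) (plens i (lens si rr p) refl) (plens (not i) (lens s∈ rr p) (sym (Bool.not-distribˡ-xor i (parity ℓ)))))

  both-or-colouring-fuel : ∀ f W → count W ≤ f → ∀ S R → Conn W (⋃ S) R → Both W S R ⊎ Colouring W S R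
  both-or-colouring-fuel f W l S R co with source co
  ... | s , ms , ss with ⋃-out S s ss
  ...   | i , si = Contract.result W S R (rec f l) co i s ms si
    where
    rec : ∀ f → count W ≤ f → ∀ K → count K < count W → ∀ S R → Conn K (⋃ S) R → Both K S R ⊎ Colouring K S R
    rec zero    l K lt = ⊥-elim (n≮0 (≤-trans lt l))
    rec (suc f) l K lt = both-or-colouring-fuel f K (s≤s⁻¹ (≤-trans lt l))

  both-or-colouring : ∀ W S R → Conn W (⋃ S) R → Both W S R ⊎ Colouring W S R
  both-or-colouring W = both-or-colouring-fuel (count W) W ≤-refl

  -- Cycles through a 2-cut

  vertex : ∀ {W u v ℓ} → Path W u v ℓ → Fin (suc ℓ) → V
  vertex {u = u} p          zero    = u
  vertex         (step _ _ p) (suc i) = vertex p i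

  vertex∈ : ∀ {W u v ℓ} (p : Path W u v ℓ) i → vertex p i ∈ W
  vertex∈ p            zero    = path-start p
  vertex∈ (step _ _ p) (suc i) = proj₁ (vertex∈ p i)

  vertex-injective : ∀ {W u v ℓ} (p : Path W u v ℓ) {i j} → vertex p i ≡ vertex p j → i ≡ j
  vertex-injective p            {zero}  {zero}  eq = refl
  vertex-injective (step _ _ p) {zero}  {suc j} eq = ⊥-elim (proj₂ (vertex∈ p j) (sym eq))
  vertex-injective (step _ _ p) {suc i} {zero}  eq = ⊥-elim (proj₂ (vertex∈ p i) eq)
  vertex-injective (step _ _ p) {suc i} {suc j} eq = cong suc (vertex-injective p eq)

  vertex-adj : ∀ {W u v ℓ} (p : Path W u v ℓ) i j → suc (toℕ i) ≡ toℕ j → vertex p i ~ vertex p j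
  vertex-adj (step _ e p) zero    (suc zero)    eq = e
  vertex-adj (step _ e (step _ _ p)) zero (suc (suc j)) ()
  vertex-adj (step _ _ p) (suc i) (suc j)       eq = vertex-adj p i j (suc-injective eq)

  vertex-last : ∀ {W u v ℓ} (p : Path W u v ℓ) i → toℕ i ≡ ℓ → vertex p i ≡ v
  vertex-last (stop _)     zero    eq = refl
  vertex-last (step _ _ p) (suc i) eq = vertex-last p i (suc-injective eq)

  vertex-first : ∀ {W u v ℓ} (p : Path W u v ℓ) i → toℕ i ≡ 0 → vertex p i ≡ u
  vertex-first p zero eq = refl

  path→cycle : ∀ {W u v ℓ} → Path W u v ℓ → v ~ u → 2 ≤ ℓ → HasCycleOfLength G (suc ℓ)
  path→cycle p e l = s≤s l , vertex p , vertex-injective p , vertex-adj p , closing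
    where
    closing : ∀ i j → suc (toℕ i) ≡ suc _ → toℕ j ≡ 0 → vertex p i ~ vertex p j
    closing i j eq eq′ rewrite vertex-last p i (suc-injective eq) | vertex-first p j eq′ = e

  full : VSet
  full = vset (λ _ → ⊤) (λ _ → yes tt)

  path-restrict : ∀ {X u v ℓ} K → Path X u v ℓ → u ∈ K → (∀ {w z} → w ∈ K → w ~ z → z ∈ X → z ∈ K) → Path (X ∩ K) u v ℓ
  path-restrict K (stop m)     k cl = stop (m , k)
  path-restrict K (step m e p) k cl = step (m , k) e
    (path-mono (λ { z ((a , b) , c) → (a , c) , b }) (path-restrict K p (cl k e (proj₁ (path-start p))) (λ kw f mz → cl kw f (proj₁ mz))))

  module TwoConnected (kc : KConnected G 2) where

    nocut-full : ∀ v u u′ → u ≢ v → u′ ≢ v → Walk (full ⊖ v) u u′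
    nocut-full v u u′ nu nu′ = conv nu (proj₂ kc ⁅ v ⁆ˢ (≤-reflexive (cong suc (∣⁅x⁆∣≡1 v))) u u′ (out nu) (out nu′))
      where
      out : ∀ {z} → z ≢ v → z ∉ˢ ⁅ v ⁆ˢ
      out ne m = ne (x∈⁅y⁆⇒x≡y v m)
      conv : ∀ {a b} → a ≢ v → WalkAvoiding G ⁅ v ⁆ˢ a b → Walk (full ⊖ v) a b
      conv ne stop = stop (tt , ne)
      conv ne (step {w = w} e w∉ p) = step (tt , ne) e (conv (λ { refl → w∉ (x∈⁅x⁆ v) }) p)

    module Separation (x y : V) (x≢y : x ≢ y) where

      F : VSet
      F = (full ⊖ x) ⊖ y

      y≢x : y ≢ x
      y≢x eq = x≢y (sym eq)

      module _ (u : V) (mu : u ∈ F) where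
        K : VSet
        K = C F u

        boundary : ∀ {w z} → w ∈ K → w ~ z → ¬ z ∈ K → z ≡ x ⊎ z ≡ y
        boundary {w} {z} k e ¬k with z ≟ x | z ≟ y
        ... | yes eq | _      = inj₁ eq
        ... | no _   | yes eq = inj₂ eq
        ... | no nx  | no ny  = ⊥-elim (¬k (C-closed F u k e ((tt , nx) , ny)))

        x∉ : ¬ x ∈ K
        x∉ k = proj₂ (proj₁ (walk-end k)) refl

        y∉ : ¬ y ∈ K
        y∉ k = proj₂ (walk-end k) refl

        conn-K : Conn K (N x) (N y)
        conn-K = record { connected = C-connected F u ; source = src ; target = tgt ; cut = ct }
          where
          src : ∃ λ s → s ∈ K × x ~ s
          src with exit-to K (nocut-full y u x (proj₂ mu) x≢y) (stop mu) x∉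
          ... | w , w′ , _ , k , e , (_ , ne) , ¬k with boundary k e ¬k
          ...   | inj₁ refl = w , k , ~-sym e
          ...   | inj₂ eq   = ⊥-elim (ne eq)
          tgt : ∃ λ s → s ∈ K × y ~ s
          tgt with exit-to K (nocut-full x u y (proj₂ (proj₁ mu)) y≢x) (stop mu) y∉
          ... | w , w′ , _ , k , e , (_ , ne) , ¬k with boundary k e ¬k
          ...   | inj₁ eq   = ⊥-elim (ne eq)
          ...   | inj₂ refl = w , k , ~-sym e
          ct : ∀ v z → v ∈ K → z ∈ K → z ≢ v → ∃ λ s → Walk (K ⊖ v) z s × (x ~ s ⊎ y ~ s)
          ct v z kv kz ne with exit-to K (nocut-full v z x ne (λ { refl → x∉ kv })) kz x∉
          ... | w , w′ , p , k , e , _ , ¬k with boundary k e ¬k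
          ...   | inj₁ refl = w , restrict full K p , inj₁ (~-sym e)
          ...   | inj₂ refl = w , restrict full K p , inj₂ (~-sym e)

        deg-K : ∀ w → w ∈ K → deg full w ≤ deg K w + [ N x ]ι w + [ N y ]ι w
        deg-K w k = ≤-trans (deg-∪₁ full (K ∪ ⁅ x ⁆) y w h) (+-monoˡ-≤ ([ N y ]ι w) (deg-∪₁ (K ∪ ⁅ x ⁆) K x w (λ z _ m → m)))
          where
          h : ∀ z → w ~ z → z ∈ full → z ∈ (K ∪ ⁅ x ⁆) ⊎ z ≡ y
          h z e _ with mem? K z
          ... | yes kz = inj₁ (inj₁ kz)
          ... | no ¬k with boundary k e ¬k
          ...   | inj₁ eq = inj₁ (inj₂ eq)
          ...   | inj₂ eq = inj₂ eq

      close-edge : ∀ {A ℓ} → A ⊆ F → x ~ y → Lens A (N x) (N y) ℓ → HasCycleOfLength G (3 + ℓ)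
      close-edge {A} {ℓ} A⊆ e (lens {u} {v} eu ev p) = path→cycle walk-round (~-sym e) (s≤s (s≤s z≤n))
        where
        walk-round : Path full x y (2 + ℓ)
        walk-round = step tt eu (path-mono (λ { z (inj₁ a) → tt , proj₂ (proj₁ (A⊆ z a)) ; z (inj₂ refl) → tt , y≢x })
          (subst (Path (A ∪ ⁅ y ⁆) u y) (cong suc (+-identityʳ ℓ))
            (path-concat {B = ⁅ y ⁆} (λ z → inj₁) (λ z → inj₂) (λ { z a refl → proj₂ (A⊆ z a) refl }) p (~-sym ev) (stop refl))))

      -- Four edges join the ends of the two interior paths to `x` and `y`.
      close-path : ∀ {A B k ℓ} → A ⊆ F → B ⊆ F → Disjoint A B → Lens A (N x) (N y) k → Lens B (N x) (N y) ℓ →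
                   HasCycleOfLength G (4 + (k + ℓ))
      close-path {A} {B} {k} {ℓ} A⊆ B⊆ d (lens {u} {v} eu ev p) (lens {u′} {v′} eu′ ev′ q) =
        path→cycle walk-round (~-sym eu′) (s≤s (s≤s z≤n))
        where
        back : Path (⁅ y ⁆ ∪ B) y u′ (suc ℓ)
        back = step (inj₁ refl) ev′ (path-mono (λ { z b → inj₂ b , λ { refl → proj₂ (B⊆ z b) refl } }) (path-rev q))
        dj : Disjoint A (⁅ y ⁆ ∪ B)
        dj z a (inj₁ refl) = proj₂ (A⊆ z a) refl
        dj z a (inj₂ b)    = d z a b
        sub : (A ∪ (⁅ y ⁆ ∪ B)) ⊆ (full ⊖ x)
        sub z (inj₁ a)           = tt , proj₂ (proj₁ (A⊆ z a))
        sub z (inj₂ (inj₁ refl)) = tt , y≢x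
        sub z (inj₂ (inj₂ b))    = tt , proj₂ (proj₁ (B⊆ z b))
        walk-round : Path full x u′ (3 + (k + ℓ))
        walk-round = subst (Path full x u′) (cong (λ z → suc (suc z)) (+-suc k ℓ))
          (step tt eu (path-mono {A ∪ (⁅ y ⁆ ∪ B)} sub (path-concat (λ z → inj₁) (λ z → inj₂) dj p (~-sym ev) back)))

      -- Here `x` is an ordinary vertex and the sole entry, at cost 0, so that a `Colouring` covers
      -- every vertex except `y`.
      S₀ : Entries
      S₀ false = ⁅ x ⁆
      S₀ true  = ∅

      conn-full : ∀ u → u ∈ F → Conn (full ⊖ y) (⋃ S₀) (N y)
      conn-full u₀ m₀ = record { connected = λ u v mu mv → nocut-full y u v (proj₂ mu) (proj₂ mv) ; source = x , (tt , x≢y) , inj₁ refl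
                               ; target = tgt ; cut = ct }
        where
        before-y : ∀ v u → v ≢ y → u ≢ v → u ≢ y → ∃ λ z → Walk ((full ⊖ y) ⊖ v) u z × y ~ z
        before-y v u ne nuv nuy with exit-to (full ⊖ y) (nocut-full v u y nuv (λ eq → ne (sym eq))) (tt , nuy) (λ m → proj₂ m refl)
        ... | w , w′ , p , k , e , _ , ¬k with w′ ≟ y
        ...   | yes refl = w , restrict full (full ⊖ y) p , ~-sym e
        ...   | no ny    = ⊥-elim (¬k (tt , ny))
        tgt : ∃ λ r → r ∈ (full ⊖ y) × y ~ r
        tgt with target (conn-K u₀ m₀)
        ... | r , k , e = r , (tt , proj₂ (walk-end k)) , e
        ct : ∀ v u → v ∈ (full ⊖ y) → u ∈ (full ⊖ y) → u ≢ v → ∃ λ z → Walk ((full ⊖ y) ⊖ v) u z × (z ∈ ⋃ S₀ ⊎ y ~ z)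
        ct v u (_ , nv) (_ , nu) ne with before-y v u nv ne nu
        ... | z , w , e = z , w , inj₂ e

  -- From spans to odd cycles

  sum-tabulate : ∀ {m} (f : Fin m → ℕ) → sum (tabulate f) ≡ cnt f
  sum-tabulate {zero}  f = refl
  sum-tabulate {suc m} f = cong (f zero +_) (sum-tabulate (λ i → f (suc i)))

  degree≤deg : ∀ v → degree G v ≤ deg full v
  degree≤deg v = ≤-trans (≤-reflexive (trans (cong sum (map-tabulate (λ i → i) f)) (sum-tabulate f)))
    (cnt-mono f [ N v ∩ full ]ι h)
    where
    f : V → ℕ
    f u = if adj G v u then 1 else 0
    h : ∀ u → f u ≤ [ N v ∩ full ]ι u
    h u with adj G v u
    ... | true  = ≤-refl
    ... | false = z≤n

  half≤ : ∀ e i → i < ⌈ suc e /2⌉ → i + i ≤ e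
  half≤ e i (s≤s l) = ≤-trans (+-mono-≤ l (≤-trans l (⌊n/2⌋≤⌈n/2⌉ e))) (≤-reflexive (⌊n/2⌋+⌈n/2⌉≡n e))

  double-cancel : ∀ i m → i + i ≤ m + m → i ≤ m
  double-cancel i m l = ≮⇒≥ (λ m<i → <-irrefl refl (≤-trans (+-mono-<-≤ m<i (<⇒≤ m<i)) l))

  -- A run is thinned out to every second length, an alternating progression is cut short; with `k`
  -- equal to `suc e` both leave ⌈ k /2⌉ lengths.
  Span→evens : ∀ {L : ℕ → Set} e → Span L e → ∃ λ ℓ → ∀ i → i < ⌈ suc e /2⌉ → L (ℓ + (i + i))
  Span→evens e (run ℓ h)     = ℓ , λ i l → h (i + i) (half≤ e i l)
  Span→evens e (alt ℓ m b h) = ℓ , λ i l → h i (double-cancel i m (≤-trans (half≤ e i l) b))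

  odd : ∀ ℓ → parity ℓ ≡ true → Odd ℓ
  odd (suc zero)    eq = 0 , refl
  odd (suc (suc ℓ)) eq with odd ℓ (trans (sym (Bool.not-involutive (parity ℓ))) eq)
  ... | m , refl = suc m , cong suc (cong suc (sym (+-suc m (m + 0))))

  OddCycles : ℕ → Set
  OddCycles k = Σ ℕ λ ℓ → Odd ℓ × (∀ i → i < ⌈ k /2⌉ → HasCycleOfLength G (ℓ + 2 * i))

  module Assemble (kc : KConnected G 2) (nb : ¬ Bipartite G) (e : ℕ) (md : MinDegreeAtLeast G (suc (suc e)))
                  (x y : V) (x≢y : x ≢ y) where
    open TwoConnected kc
    open Separation x y x≢y

    -- In a `Colouring` all neighbours of `y` share a colour, so giving `y` the other one would make
    -- `G` bipartite.
    both : ∀ u → u ∈ F → Both (full ⊖ y) S₀ (N y)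
    both u mu with both-or-colouring (full ⊖ y) S₀ (N y) (conn-full u mu)
    ... | inj₁ b = b
    ... | inj₂ c = ⊥-elim (nb (col , λ a b ab eq → proper a b ab (a ≟ y) (b ≟ y) eq))
      where
      module C = Colouring c
      col : V → Bool
      col z with z ≟ y
      ... | yes _ = not C.exits
      ... | no _  = C.col z
      col-y : ∀ {z} → z ≡ y → col z ≡ not C.exits
      col-y {z} eq with z ≟ y
      ... | yes _ = refl
      ... | no ne = ⊥-elim (ne eq)
      col-z : ∀ {z} → z ≢ y → col z ≡ C.col z
      col-z {z} ne with z ≟ y
      ... | yes eq = ⊥-elim (ne eq)
      ... | no _   = refl
      proper : ∀ a b → a ~ b → Dec (a ≡ y) → Dec (b ≡ y) → col a ≢ col b
      proper a b ab (yes refl) (yes refl) _ = ~-irrefl ab refl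
      proper a b ab (yes refl) (no nb) eq =
        Bool.not-¬ refl (trans (sym (C.exits≡ b (tt , nb) ab)) (trans (sym (col-z nb)) (trans (sym eq) (col-y refl))))
      proper a b ab (no na) (yes refl) eq =
        Bool.not-¬ refl (trans (sym (C.exits≡ a (tt , na) (~-sym ab))) (trans (sym (col-z na)) (trans eq (col-y refl))))
      proper a b ab (no na) (no nb) eq =
        Bool.not-¬ refl (trans (trans (sym (col-z na)) (trans eq (col-z nb))) (C.proper a b (tt , na) (tt , nb) ab))

    evens : ∀ u → (mu : u ∈ F) → ∃ λ ℓ → ∀ i → i < ⌈ suc e /2⌉ → Lens (C F u) (N x) (N y) (ℓ + (i + i))
    evens u mu = Span→evens e (main (C F u) e (N x) (N y) (conn-K u mu)
      (λ w k → ≤-trans (md w) (≤-trans (degree≤deg w) (deg-K u mu w k))))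

    with-path : ∀ {A B k} ℓ → A ⊆ F → B ⊆ F → Disjoint A B → (∀ i → i < ⌈ suc e /2⌉ → Lens A (N x) (N y) (ℓ + (i + i))) →
                Lens B (N x) (N y) k → parity k ≡ not (parity ℓ) → OddCycles (suc e)
    with-path {k = k} ℓ A⊆ B⊆ d h L par = 4 + (ℓ + k) , odd (4 + (ℓ + k)) p , λ i l →
      subst (HasCycleOfLength G) (solve 3 (λ a b i → con 4 :+ (a :+ (i :+ i) :+ b) := con 4 :+ (a :+ b) :+ con 2 :* i) refl ℓ k i)
        (close-path A⊆ B⊆ d (h i l) L)
      where
      p : parity (4 + (ℓ + k)) ≡ true
      p = trans (Bool.not-involutive _) (trans (Bool.not-involutive _) (trans (parity-+ ℓ k) (trans (cong (parity ℓ xor_) par) (Bool.xor-inverseʳ (parity ℓ)))))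

    with-edge : ∀ {A} ℓ → A ⊆ F → x ~ y → (∀ i → i < ⌈ suc e /2⌉ → Lens A (N x) (N y) (ℓ + (i + i))) →
                parity ℓ ≡ false → OddCycles (suc e)
    with-edge ℓ A⊆ xy h par = 3 + ℓ , odd (3 + ℓ) (trans (Bool.not-involutive _) (cong not par)) , λ i l →
      subst (HasCycleOfLength G) (solve 2 (λ a i → con 3 :+ (a :+ (i :+ i)) := con 3 :+ a :+ con 2 :* i) refl ℓ i)
        (close-edge A⊆ xy (h i l))

    separated : ∀ u v → u ∈ F → v ∈ F → ¬ Walk F u v → OddCycles (suc e)
    separated u v mu mv ¬w with evens u mu | evens v mv
    ... | ℓ , h | ℓ′ , h′ with parity ℓ′ Bool.≟ not (parity ℓ)
    ...   | yes eq = with-path ℓ (C⊆ F u) (C⊆ F v) dj h (h′ 0 (s≤s z≤n)) (trans (cong parity (+-identityʳ ℓ′)) eq)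
      where
      dj : Disjoint (C F u) (C F v)
      dj z k k′ = ¬w (walk-++ k (walk-rev k′))
    ...   | no ne = detour (both u mu (parity ℓ))
      where
      same : parity ℓ′ ≡ parity ℓ
      same = ≢not⇒≡ ne
      detour : PLens (full ⊖ y) S₀ (N y) (parity ℓ) → OddCycles (suc e)
      detour (plens true (lens () _ _) _)
      -- The detour is the vertex `x` alone: `x` and `y` are adjacent, and its length 0 makes `ℓ`
      -- even.
      detour (plens false (lens refl r∈ (stop _)) eq) = with-edge ℓ (C⊆ F u) (~-sym r∈) h (sym eq)
      detour (plens {suc k} false (lens {_} {r} refl r∈ (step {w = w} _ xw p)) eq) = by (walk? F u w)
        where
        q : Path F w r k
        q = path-mono (λ { z ((_ , ny) , nx) → (tt , nx) , ny }) p
        inC : ∀ d → w ∈ C F d → Lens (C F d) (N x) (N y) k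
        inC d k = lens xw r∈ (path-mono (λ z → proj₂) (path-restrict (C F d) q k (λ kw f mz → C-closed F d kw f mz)))
        par : parity k ≡ not (parity ℓ)
        par = trans (sym (Bool.not-involutive (parity k))) (cong not eq)
        by : Dec (Walk F u w) → OddCycles (suc e)
        -- After its first edge the detour stays in the component of `u`, so it is closed up through
        -- that of `v`, whose lengths have the same parity.
        by (yes k) = with-path ℓ′ (C⊆ F v) (C⊆ F u) (λ z a b → ¬w (walk-++ b (walk-rev a))) h′ (inC u k)
                       (trans par (cong not (sym same)))
        by (no ¬k) = with-path ℓ (C⊆ F u) (C⊆ F w) (λ z a b → ¬k (walk-++ a (walk-rev b))) h (inC w (stop (path-start q))) par

  mem-subset : Subset n → VSet
  mem-subset X = vset (λ z → lookup X z ≡ true) (λ z → lookup X z Bool.≟ true)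

  cnt-subset : ∀ {m} (X : Subset m) → cnt (λ z → ι (lookup X z Bool.≟ true)) ≡ ∣ X ∣
  cnt-subset []          = refl
  cnt-subset (true ∷ X)  = cong suc (cnt-subset X)
  cnt-subset (false ∷ X) = cnt-subset X

  -- Only sets of exactly two vertices go beyond 2-connectivity; such an `X` consists of the two
  -- elements `x` and `y` found in it.
  three-connected : KConnected G 2 → 3 < n →
    (∀ x y u v → x ≢ y → u ∈ ((full ⊖ x) ⊖ y) → v ∈ ((full ⊖ x) ⊖ y) → Walk ((full ⊖ x) ⊖ y) u v) → KConnected G 3
  three-connected kc l h = l , conn
    where
    conn : ∀ X → ∣ X ∣ < 3 → ConnectedAfterRemoving G X
    conn X small with 2 ≤? ∣ X ∣
    ... | no small′ = proj₂ kc X (≰⇒> small′)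
    ... | yes big = λ u v u∉ v∉ → conv (h x y u v (λ eq → ne (sym eq)) (out u∉) (out v∉))
      where
      A : VSet
      A = mem-subset X
      A≡ : count A ≡ ∣ X ∣
      A≡ = cnt-subset X
      px : ∃ λ x → x ∈ A
      px = count-elem A (≤-trans (≤-trans (s≤s z≤n) big) (≤-reflexive (sym A≡)))
      x : V
      x = proj₁ px
      py : ∃ λ y → y ∈ A × y ≢ x
      py = count-two A (≤-trans big (≤-reflexive (sym A≡))) x
      y : V
      y = proj₁ py
      ne : y ≢ x
      ne = proj₂ (proj₂ py)
      in-X : ∀ {z} → z ∈ A → ¬ z ∉ˢ X
      in-X {z} m z∉ = z∉ (lookup⇒[]= z X m)
      out : ∀ {z} → z ∉ˢ X → z ∈ ((full ⊖ x) ⊖ y)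
      out z∉ = (tt , λ { refl → in-X (proj₂ px) z∉ }) , λ { refl → in-X (proj₁ (proj₂ py)) z∉ }
      avoid : ∀ z → z ∈ ((full ⊖ x) ⊖ y) → z ∉ˢ X
      avoid z ((_ , nx) , ny) m = <-irrefl refl (≤-trans (≤-trans (s≤s three) (count-< (A ⊖ x) A (λ _ → proj₁) x (proj₂ px) (λ k → proj₂ k refl)))
                                    (≤-trans (≤-reflexive A≡) (s≤s⁻¹ small)))
        where
        three : 2 ≤ count (A ⊖ x)
        three = count-≥2 (A ⊖ x) z y ([]=⇒lookup m , nx) (proj₁ (proj₂ py) , ne) ny
      conv : ∀ {a b} → Walk ((full ⊖ x) ⊖ y) a b → WalkAvoiding G X a b
      conv (stop _)     = stop
      conv (step _ e w) = step e (avoid _ (walk-start w)) (conv w)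

  odd-cycles : ∀ e → KConnected G 2 → ¬ Bipartite G → ¬ KConnected G 3 → MinDegreeAtLeast G (suc (suc e)) → 3 < n → OddCycles (suc e)
  odd-cycles e kc nb ¬kc md l
    with any? (λ x → any? (λ y → any? (λ u → any? (λ v → ¬? (x ≟ y) ×-dec mem? ((full ⊖ x) ⊖ y) u ×-dec mem? ((full ⊖ x) ⊖ y) v
                ×-dec ¬? (walk? ((full ⊖ x) ⊖ y) u v)))))
  ... | yes (x , y , u , v , ne , mu , mv , ¬w) = Assemble.separated kc nb e md x y ne u v mu mv ¬w
  ... | no none = ⊥-elim (¬kc (three-connected kc l h))
    where
    h : ∀ x y u v → x ≢ y → u ∈ ((full ⊖ x) ⊖ y) → v ∈ ((full ⊖ x) ⊖ y) → Walk ((full ⊖ x) ⊖ y) u v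
    h x y u v ne mu mv with walk? ((full ⊖ x) ⊖ y) u v
    ... | yes w = w
    ... | no ¬w = ⊥-elim (none (x , y , u , v , ne , mu , mv , ¬w))

-- Graphs with three vertices

two-of-three : ∀ k → 1 ≤ k → ∀ a b c → a ≡ false →
  suc k ≤ (if a then 1 else 0) + ((if b then 1 else 0) + ((if c then 1 else 0) + 0)) → k ≡ 1 × b ≡ true × c ≡ true
two-of-three (suc zero)    _ false true  true  _ _ = refl , refl , refl
two-of-three (suc (suc k)) _ false true  true  _ (s≤s (s≤s ()))
two-of-three (suc k)       _ false true  false _ (s≤s ())
two-of-three (suc k)       _ false false true  _ (s≤s ())

two-of-three′ : ∀ a b c → a ≡ true → b ≡ false →
  2 ≤ (if a then 1 else 0) + ((if b then 1 else 0) + ((if c then 1 else 0) + 0)) → c ≡ true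
two-of-three′ true false true  _ _ _ = refl
two-of-three′ true false false _ _ (s≤s ())

-- Three vertices are too few for 3-connectivity, so a 2-cut may fail to exist. The degree bound
-- then forces `k` to be 1 and all edges to be present, and a single odd cycle is asked for.
triangle : ∀ k → 1 ≤ k → (G : Graph 3) → MinDegreeAtLeast G (suc k) → OddCycles G k
triangle k 1≤k G md with two-of-three k 1≤k (adj G zero zero) (adj G zero (suc zero)) (adj G zero (suc (suc zero))) (irrefl G zero) (md zero)
... | refl , e₀₁ , e₀₂ = 3 , (1 , refl) , λ { zero _ → ≤-refl , (λ i → i) , (λ eq → eq) , along , around ; (suc i) (s≤s ()) }
  where
  e₁₂ : adj G (suc zero) (suc (suc zero)) ≡ true
  e₁₂ = two-of-three′ (adj G (suc zero) zero) (adj G (suc zero) (suc zero)) _ (trans (symm G (suc zero) zero) e₀₁) (irrefl G (suc zero)) (md (suc zero))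
  along : ∀ (i j : Fin 3) → suc (toℕ i) ≡ toℕ j → adj G i j ≡ true
  along zero (suc zero) _ = e₀₁
  along (suc zero) (suc (suc zero)) _ = e₁₂
  along (suc (suc zero)) zero ()
  along (suc (suc zero)) (suc zero) ()
  along (suc (suc zero)) (suc (suc zero)) ()
  around : ∀ (i j : Fin 3) → suc (toℕ i) ≡ 3 → toℕ j ≡ 0 → adj G i j ≡ true
  around (suc (suc zero)) zero _ _ = trans (symm G (suc (suc zero)) zero) e₀₂

theorem1p4 : ∀ (k : ℕ) → 1 ≤ k → ∀ {n : ℕ} (G : Graph n) →
    KConnected G 2 → ¬ Bipartite G → ¬ KConnected G 3 →
    MinDegreeAtLeast G (suc k) →
    Σ ℕ λ ℓ → Odd ℓ × (∀ (i : ℕ) → i < ⌈ k /2⌉ → HasCycleOfLength G (ℓ + 2 * i))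
theorem1p4 k@(suc e) 1≤k {n} G kc nb ¬kc md with 3 <? n
... | yes 3<n = odd-cycles G e kc nb ¬kc md 3<n
... | no 3≮n with ≤-antisym (proj₁ kc) (≮⇒≥ 3≮n)
...   | refl = triangle k 1≤k G md
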